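{- Let $n\ge1$, $a>0$, and let $K_a$ be the Kasteleyn matrix of the Aztec diamond of size $n$ with weights $1$ and $a$, i.e. for $x\in\mathtt{B}$, $y\in\mathtt{W}$, $$K_a(x,y)=\begin{cases}1 & x-y=\pm e_1,\\ a\mathrm{i} & x-y=\pm e_2,\\ 0&\text{otherwise.}\end{cases}$$ Let $G_n(\mathtt{w},\mathtt{b})=\sum_{x\in\mathtt{W},\,y\in\mathtt{B}} K_a^{ -1}(x,y)\,w_1^{x_1}w_2^{x_2}b_1^{y_1}b_2^{y_2}$. Then $$\begin{aligned}G_n(\mathtt{w},\mathtt{b})=&\ \frac{w_1w_2^2b_2\,f_{n+1}(w_1^2b_1^2)\,f_n(w_2^2b_2^2)}{C(w_1,w_2)}\\ &+(1+\mathrm{i}aw_1^2)\frac{(1+\mathrm{i}ab_2^2)F^{0,0}_n+b_1^2\big(b_2w_1f_n(b_1^2w_1^2)+(\mathrm{i}a+b_2^2)F^{0,1}_n\big)}{C(w_1,w_2)C(b_1,b_2)}\\ &+(\mathrm{i}a+w_1^2)w_2^2\frac{b_1^2b_2^{2n+1}w_1w_2^{2n}f_n(b_1^2w_1^2)+(1+\mathrm{i}ab_2^2)F^{1,0}_n+b_1^2(\mathrm{i}a+b_2^2)F^{1,1}_n}{C(w_1,w_2)C(b_1,b_2)},\end{aligned}$$ where $C(r_1,r_2)=1+r_1^2r_2^2+\mathrm{i}a(r_1^2+r_2^2)$ and $F^{k,l}_n=F^{k,l}_n(\mathtt{w},\mathtt{b},a)$ are as in the context.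
   Context: $\mathrm{i}=\sqrt{ -1}$. Aztec diamond of size $n$: white vertices $\mathtt{W}=\{(x_1,x_2): x_1\text{ odd},\ x_2\text{ even},\ 1\le x_1\le 2n-1,\ 0\le x_2\le 2n\}$, black vertices $\mathtt{B}=\{(x_1,x_2): x_1\text{ even},\ x_2\text{ odd},\ 0\le x_1\le 2n,\ 1\le x_2\le 2n-1\}$, $e_1=(1,1)$, $e_2=(-1,1)$. $K_a$ has rows indexed by $\mathtt{B}$ and columns by $\mathtt{W}$; $K_a^{ -1}$ is indexed by $\mathtt{W}\times\mathtt{B}$. $f_n(t)=(1-t^n)/(1-t)$. Define $F_n(w,b,a)=-\frac{\mathrm{i}\,a}{1+a^2}\,f_n\!\left(\frac{(1+ba\mathrm{i})(1+wa\mathrm{i})}{1+a^2}\right)$ and $F^{0,0}_n(\mathtt{w},\mathtt{b},a)=F_n(w_1^2,b_2^2,a)w_1b_2$, $F^{0,1}_n(\mathtt{w},\mathtt{b},a)=F_n(-1/w_1^2,-b_2^2,a^{ -1})w_1^{2n-1}b_1^{2n}b_2\mathrm{i}/a$, $F^{1,0}_n(\mathtt{w},\mathtt{b},a)=F_n(-w_1^2,-1/b_2^2,a^{ -1})w_1w_2^{2n}b_2^{2n-1}\mathrm{i}/a$, $F^{1,1}_n(\mathtt{w},\mathtt{b},a)=F_n(1/w_1^2,1/b_2^2,a)w_1^{2n-1}w_2^{2n}b_1^{2n}b_2^{2n-1}$. -}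

module Defs where

open import Algebra.Apartness.Bundles using (HeytingField)
open import Algebra.Bundles using (CommutativeRing)
open import Algebra.Bundles.Raw using (RawRing)
open import Data.Bool.Base using (if_then_else_; _∨_)
open import Data.Fin.Base using (Fin; toℕ)
import Data.Fin.Properties as Fin
open import Data.Integer.Base as ℤ using (ℤ; _⊖_)
import Data.Integer.Properties as ℤ
open import Data.Nat.Base as ℕ using (ℕ; suc; _∸_)
open import Data.Product.Base using (_×_; _,_; proj₁; proj₂; ∃-syntax)
open import Data.Product.Properties using (≡-dec)
open import Data.Sum.Base using (_⊎_; inj₁; inj₂)
open import Function.Base using (_∘_)
open import Level using (_⊔_) renaming (suc to lsuc)
open import Relation.Binary.Core using (Rel)
open import Relation.Binary.Definitions using (DecidableEquality)
open import Relation.Binary.Structures using (IsStrictPartialOrder)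
open import Relation.Nullary.Decidable using (does)
open import Relation.Nullary.Negation using (¬_; contradiction)

import Algebra.Apartness.Properties.HeytingCommutativeRing as HeytingProperties
import Algebra.Definitions.RawMonoid as RawMonoidDefinitions
import Algebra.Definitions.RawSemiring as RawSemiringDefinitions
import Algebra.Properties.Ring as RingProperties
import Algebra.Solver.Ring.NaturalCoefficients.Default as SemiringSolver

-- The real numbers, axiomatised as a Cauchy-complete Archimedean ordered
-- field.  Strict order and apartness are the primitive notions, so the axioms
-- hold for the constructive reals; classically _#_ is just _≉_.

record RealNumbers c ℓ₁ ℓ₂ ℓ₃ : Set (lsuc (c ⊔ ℓ₁ ⊔ ℓ₂ ⊔ ℓ₃)) where
  infix 4 _<_
  field
    heytingField : HeytingField c ℓ₁ ℓ₂

  open HeytingField heytingField public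

  commutativeRing : CommutativeRing c ℓ₁
  commutativeRing = record { isCommutativeRing = isCommutativeRing }

  open RawMonoidDefinitions (CommutativeRing.+-rawMonoid commutativeRing) public
    using () renaming (_×_ to _·_)

  field
    _<_                  : Rel Carrier ℓ₃
    isStrictPartialOrder : IsStrictPartialOrder _≈_ _<_
    <⇒#                  : ∀ {x y} → x < y → x # y
    #⇒<⊎>                : ∀ {x y} → x # y → x < y ⊎ y < x
    +-monoˡ-<            : ∀ {x y} z → x < y → x + z < y + z
    *-pos                : ∀ {x y} → 0# < x → 0# < y → 0# < x * y
    archimedean          : ∀ x → ∃[ n ] x < n · 1#

  Close : Carrier → Carrier → Carrier → Set ℓ₃
  Close ε x y = (x < y + ε) × (y < x + ε)

  field
    complete :
      (s : ℕ → Carrier) →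
      (∀ ε → 0# < ε → ∃[ N ] ∀ m n → N ℕ.≤ m → N ℕ.≤ n → Close ε (s m) (s n)) →
      ∃[ l ] ∀ ε → 0# < ε → ∃[ N ] ∀ n → N ℕ.≤ n → Close ε (s n) l

module RealProperties {c ℓ₁ ℓ₂ ℓ₃} (ℝ : RealNumbers c ℓ₁ ℓ₂ ℓ₃) where

  open RealNumbers ℝ
  open CommutativeRing commutativeRing using (ring; commutativeSemiring)
  open HeytingProperties (HeytingField.heytingCommutativeRing heytingField)
  open RingProperties ring using (-‿distribˡ-*; -‿distribʳ-*; -‿involutive)
  open IsStrictPartialOrder isStrictPartialOrder
    renaming (irrefl to <-irrefl; trans to <-trans)
    using (<-respˡ-≈; <-respʳ-≈)

  <-cotrans : ∀ {x y} → x < y → ∀ z → x < z ⊎ z < y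
  <-cotrans x<y z with #-cotrans (<⇒# x<y) z
  ... | inj₁ x#z with #⇒<⊎> x#z
  ...   | inj₁ x<z = inj₁ x<z
  ...   | inj₂ z<x = inj₂ (<-trans z<x x<y)
  <-cotrans x<y z | inj₂ z#y with #⇒<⊎> z#y
  ...   | inj₁ z<y = inj₂ z<y
  ...   | inj₂ y<z = inj₁ (<-trans x<y y<z)

  pos⇒#0 : ∀ {x} → 0# < x → x # 0#
  pos⇒#0 = #-sym ∘ <⇒#

  neg⇒0<- : ∀ {x} → x < 0# → 0# < - x
  neg⇒0<- {x} x<0 =
    <-respˡ-≈ (-‿inverseʳ x) (<-respʳ-≈ (+-identityˡ (- x)) (+-monoˡ-< (- x) x<0))

  #0⇒sq-pos : ∀ {x} → x # 0# → 0# < x * x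
  #0⇒sq-pos {x} x#0 with #⇒<⊎> x#0
  ... | inj₂ 0<x = *-pos 0<x 0<x
  ... | inj₁ x<0 = <-respʳ-≈ -x*-x≈x*x (*-pos (neg⇒0<- x<0) (neg⇒0<- x<0))
    where
    -x*-x≈x*x : - x * - x ≈ x * x
    -x*-x≈x*x = trans (sym (-‿distribˡ-* x (- x)))
      (trans (-‿cong (sym (-‿distribʳ-* x x))) (-‿involutive (x * x)))

  sq#0⇒#0 : ∀ {x} → x * x # 0# → x # 0#
  sq#0⇒#0 {x} xx#0 with #⇒invertible xx#0
  ... | y , _ , xx-0*y≈1 = invertibleʳ⇒# (x * y ,
    trans (*-congʳ (x-0≈x x))
      (trans (sym (*-assoc x x y)) (trans (*-congʳ (sym (x-0≈x (x * x)))) xx-0*y≈1)))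

  ¬sq-neg : ∀ {x} → ¬ (x * x < 0#)
  ¬sq-neg xx<0 = <-irrefl refl (<-trans (#0⇒sq-pos (sq#0⇒#0 (<⇒# xx<0))) xx<0)

  0<1 : 0# < 1#
  0<1 = <-respʳ-≈ (*-identityˡ 1#) (#0⇒sq-pos 1#0)

  pos+sq : ∀ {x} y → 0# < x → 0# < x + y * y
  pos+sq {x} y 0<x with <-cotrans 0<x (x + y * y)
  ... | inj₁ 0<x+yy = 0<x+yy
  ... | inj₂ x+yy<x = contradiction
      (<-respˡ-≈ cancel (<-respʳ-≈ (-‿inverseʳ x) (+-monoˡ-< (- x) x+yy<x))) ¬sq-neg
    where
    cancel : (x + y * y) - x ≈ y * y
    cancel = trans (+-congʳ (+-comm x (y * y)))
      (trans (+-assoc (y * y) x (- x)) (trans (+-congˡ (-‿inverseʳ x)) (+-identityʳ (y * y))))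

  inv : ∀ x → x # 0# → Carrier
  inv x x#0 = proj₁ (#⇒invertible x#0)

  *-inverseʳ : ∀ x (x#0 : x # 0#) → x * inv x x#0 ≈ 1#
  *-inverseʳ x x#0 =
    trans (*-congʳ (sym (x-0≈x x))) (proj₂ (proj₂ (#⇒invertible x#0)))

  inv-pos : ∀ {x} (0<x : 0# < x) → 0# < inv x (pos⇒#0 0<x)
  inv-pos {x} 0<x with #⇒<⊎> (pos⇒#0 0<1)
  ... | inj₁ 1<0 = contradiction (<-trans 0<1 1<0) (<-irrefl refl)
  ... | inj₂ _   = <-respʳ-≈ yyx≈y (*-pos (#0⇒sq-pos y#0) 0<x)
    where
    y : Carrier
    y = inv x (pos⇒#0 0<x)

    xy≈1 : x * y ≈ 1#
    xy≈1 = *-inverseʳ x (pos⇒#0 0<x)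

    y#0 : y # 0#
    y#0 = invertibleʳ⇒# (x , trans (*-congʳ (x-0≈x y)) (trans (*-comm y x) xy≈1))

    yyx≈y : y * y * x ≈ y
    yyx≈y = trans (*-assoc y y x)
      (trans (*-congˡ (trans (*-comm y x) xy≈1)) (*-identityʳ y))

  sum-squares#0 : ∀ x y → x # 0# ⊎ y # 0# → x * x + y * y # 0#
  sum-squares#0 x y (inj₁ x#0) = pos⇒#0 (pos+sq y (#0⇒sq-pos x#0))
  sum-squares#0 x y (inj₂ y#0) =
    pos⇒#0 (<-respʳ-≈ (+-comm (y * y) (x * x)) (pos+sq x (#0⇒sq-pos y#0)))

  sum-squares#0⁻¹ : ∀ x y → x * x + y * y # 0# → x # 0# ⊎ y # 0#
  sum-squares#0⁻¹ x y s#0 with #-cotrans s#0 (y * y)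
  ... | inj₂ yy#0 = inj₂ (sq#0⇒#0 yy#0)
  ... | inj₁ s#yy with #⇒invertible s#yy
  ...   | z , _ , [s-yy]z≈1 = inj₁ (sq#0⇒#0 (invertibleʳ⇒# (z ,
          trans (*-congʳ (trans (x-0≈x (x * x)) (sym cancel))) [s-yy]z≈1)))
    where
    cancel : (x * x + y * y) - y * y ≈ x * x
    cancel = trans (+-assoc (x * x) (y * y) (- (y * y)))
      (trans (+-congˡ (-‿inverseʳ (y * y))) (+-identityʳ (x * x)))

  two-squares : ∀ a b c d →
    (a * c - b * d) * (a * c - b * d) + (a * d + b * c) * (a * d + b * c)
      ≈ (a * a + b * b) * (c * c + d * d)
  two-squares a b c d = trans expand (trans (+-congʳ (*-cong p-q+q≈p p-q+q≈p)) regroup)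
    where
    open SemiringSolver commutativeSemiring

    p-q+q≈p : (a * c - b * d) + b * d ≈ a * c
    p-q+q≈p = trans (+-assoc (a * c) (- (b * d)) (b * d))
      (trans (+-congˡ (-‿inverseˡ (b * d))) (+-identityʳ (a * c)))

    e : Carrier
    e = a * c - b * d

    r : Carrier
    r = b * b * (d * d) + (a * a * (d * d) + b * b * (c * c))

    -- e² + 2(ad)(bc) = e² + 2(ac)(bd) = (e + bd)² + (bd)², as ac = e + bd
    expand : e * e + (a * d + b * c) * (a * d + b * c) ≈ (e + b * d) * (e + b * d) + r
    expand = trans
      (solve 5 (λ e a b c d →
          e :* e :+ (a :* d :+ b :* c) :* (a :* d :+ b :* c) :=
          e :* e :+ (a :* c :+ a :* c) :* (b :* d) :+ (a :* a :* (d :* d) :+ b :* b :* (c :* c)))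
        refl e a b c d)
      (trans
        (+-congʳ (+-congˡ (*-congʳ (+-cong (sym p-q+q≈p) (sym p-q+q≈p)))))
        (solve 5 (λ e a b c d →
            e :* e :+ ((e :+ b :* d) :+ (e :+ b :* d)) :* (b :* d)
              :+ (a :* a :* (d :* d) :+ b :* b :* (c :* c)) :=
            (e :+ b :* d) :* (e :+ b :* d)
              :+ (b :* b :* (d :* d) :+ (a :* a :* (d :* d) :+ b :* b :* (c :* c))))
          refl e a b c d))

    regroup : (a * c) * (a * c) + r ≈ (a * a + b * b) * (c * c + d * d)
    regroup = solve 4 (λ a b c d →
        (a :* c) :* (a :* c)
          :+ (b :* b :* (d :* d) :+ (a :* a :* (d :* d) :+ b :* b :* (c :* c))) :=
        (a :* a :+ b :* b) :* (c :* c :+ d :* d))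
      refl a b c d

record Complex {c} (R : Set c) : Set c where
  no-eta-equality
  constructor _+i_
  field
    re im : R

module ComplexNumbers {c ℓ₁ ℓ₂ ℓ₃} (R : RealNumbers c ℓ₁ ℓ₂ ℓ₃) where

  private
    module ℝ = RealNumbers R
    open ℝ using () renaming
      (_+_ to _+ᵣ_; _*_ to _*ᵣ_; _-_ to _-ᵣ_; -_ to -ᵣ_; 0# to 0ᵣ; 1# to 1ᵣ)

  open RealProperties R
  open HeytingProperties (HeytingField.heytingCommutativeRing ℝ.heytingField)
    using (x#0y#0→xy#0; #-congʳ)
  open Complex public

  ℝ⁺ : Set (c ⊔ ℓ₃)
  ℝ⁺ = ∃[ x ] 0ᵣ ℝ.< x

  infix 9 _⁻¹
  _⁻¹ : ℝ⁺ → ℝ⁺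
  (x , 0<x) ⁻¹ = inv x (pos⇒#0 0<x) , inv-pos 0<x

  ℂ : Set c
  ℂ = Complex ℝ.Carrier

  infix  8 -_
  infixl 7 _*_
  infixl 6 _+_ _-_
  infix  4 _≈_

  record _≈_ (z w : ℂ) : Set ℓ₁ where
    constructor mk≈
    field
      re-≈ : re z ℝ.≈ re w
      im-≈ : im z ℝ.≈ im w

  -- The operations are defined by copatterns so that z * w, say, does not
  -- reduce by itself: with the components inlined, terms grow exponentially.

  _+_ : ℂ → ℂ → ℂ
  re (z + w) = re z +ᵣ re w
  im (z + w) = im z +ᵣ im w

  _*_ : ℂ → ℂ → ℂ
  re (z * w) = re z *ᵣ re w -ᵣ im z *ᵣ im w
  im (z * w) = re z *ᵣ im w +ᵣ im z *ᵣ re w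

  -_ : ℂ → ℂ
  re (- z) = -ᵣ re z
  im (- z) = -ᵣ im z

  _-_ : ℂ → ℂ → ℂ
  z - w = z + - w

  0# : ℂ
  0# = 0ᵣ +i 0ᵣ

  1# : ℂ
  1# = 1ᵣ +i 0ᵣ

  ℂ-rawRing : RawRing c ℓ₁
  ℂ-rawRing = record
    { _≈_ = _≈_
    ; _+_ = _+_
    ; _*_ = _*_
    ; -_  = -_
    ; 0#  = 0#
    ; 1#  = 1#
    }

  open RawSemiringDefinitions (RawRing.rawSemiring ℂ-rawRing) public using (_^_; sum)

  𝕚 : ℂ
  𝕚 = 0ᵣ +i 1ᵣ

  ⟦_⟧ : ℝ⁺ → ℂ
  ⟦ x , _ ⟧ = x +i 0ᵣ

  record NonZero (z : ℂ) : Set ℓ₂ where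
    constructor nonZero
    field
      apart : re z ℝ.# 0ᵣ ⊎ im z ℝ.# 0ᵣ

  ∣_∣² : ℂ → ℝ.Carrier
  ∣ z ∣² = re z *ᵣ re z +ᵣ im z *ᵣ im z

  recip : ∀ z → NonZero z → ℂ
  re (recip z (nonZero z≠0)) = re z *ᵣ inv ∣ z ∣² (sum-squares#0 (re z) (im z) z≠0)
  im (recip z (nonZero z≠0)) = (-ᵣ im z) *ᵣ inv ∣ z ∣² (sum-squares#0 (re z) (im z) z≠0)

  infixl 7 _/_[_]
  _/_[_] : ∀ (z w : ℂ) → NonZero w → ℂ
  z / w [ w≠0 ] = z * recip w w≠0

  *-nonZero : ∀ {z w} → NonZero z → NonZero w → NonZero (z * w)
  *-nonZero {z} {w} (nonZero z≠0) (nonZero w≠0) = nonZero (sum-squares#0⁻¹ _ _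
    (#-congʳ (ℝ.sym (two-squares (re z) (im z) (re w) (im w)))
      (x#0y#0→xy#0 (sum-squares#0 _ _ z≠0) (sum-squares#0 _ _ w≠0))))

  ⟦⟧-nonZero : ∀ a → NonZero ⟦ a ⟧
  ⟦⟧-nonZero (_ , 0<a) = nonZero (inj₁ (pos⇒#0 0<a))

  1+a²-nonZero : ∀ a → NonZero (1# + ⟦ a ⟧ ^ 2)
  1+a²-nonZero (a , 0<a) =
    nonZero (inj₁ (#-congʳ (ℝ.sym re≈1+aa) (pos⇒#0 (pos+sq a 0<1))))
    where
    open RingProperties (CommutativeRing.ring ℝ.commutativeRing) using (-0#≈0#)

    x-0y≈x : ∀ x y → x -ᵣ 0ᵣ *ᵣ y ℝ.≈ x
    x-0y≈x x y = ℝ.trans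
      (ℝ.+-congˡ (ℝ.trans (ℝ.-‿cong (ℝ.zeroˡ y)) -0#≈0#)) (ℝ.+-identityʳ x)

    re≈1+aa : re (1# + (a +i 0ᵣ) ^ 2) ℝ.≈ 1ᵣ +ᵣ a *ᵣ a
    re≈1+aa = ℝ.+-congˡ (ℝ.trans (x-0y≈x _ _)
      (ℝ.*-congˡ (ℝ.trans (x-0y≈x _ _) (ℝ.*-identityʳ a))))

-- Vertices are indexed by the coordinates left free by the parity and range
-- conditions: (i , j) stands for the white vertex (2i+1 , 2j), respectively
-- the black vertex (2i , 2j+1).

White : ℕ → Set
White n = Fin n × Fin (suc n)

Black : ℕ → Set
Black n = Fin (suc n) × Fin n

white : ∀ {n} → White n → ℕ × ℕ
white (i , j) = 2 ℕ.* toℕ i ℕ.+ 1 , 2 ℕ.* toℕ j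

black : ∀ {n} → Black n → ℕ × ℕ
black (i , j) = 2 ℕ.* toℕ i , 2 ℕ.* toℕ j ℕ.+ 1

_≟ᵂ_ : ∀ {n} → DecidableEquality (White n)
_≟ᵂ_ = ≡-dec Fin._≟_ Fin._≟_

_≟ᴮ_ : ∀ {n} → DecidableEquality (Black n)
_≟ᴮ_ = ≡-dec Fin._≟_ Fin._≟_

_≟ᶻ_ : DecidableEquality (ℤ × ℤ)
_≟ᶻ_ = ≡-dec ℤ._≟_ ℤ._≟_

e₁ e₂ : ℤ × ℤ
e₁ = ℤ.1ℤ , ℤ.1ℤ
e₂ = ℤ.-1ℤ , ℤ.1ℤ

neg : ℤ × ℤ → ℤ × ℤ
neg (k , l) = ℤ.- k , ℤ.- l

-- m ⊖ n is the integer difference of the naturals m and n.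
displacement : ℕ × ℕ → ℕ × ℕ → ℤ × ℤ
displacement (x₁ , x₂) (y₁ , y₂) = x₁ ⊖ y₁ , x₂ ⊖ y₂

module AztecDiamond {c ℓ₁ ℓ₂ ℓ₃} (R : RealNumbers c ℓ₁ ℓ₂ ℓ₃) where

  open ComplexNumbers R public

  ∑ᵂ : ∀ {n} → (White n → ℂ) → ℂ
  ∑ᵂ g = sum λ i → sum λ j → g (i , j)

  ∑ᴮ : ∀ {n} → (Black n → ℂ) → ℂ
  ∑ᴮ g = sum λ i → sum λ j → g (i , j)

  K : ∀ {n} → ℝ⁺ → Black n → White n → ℂ
  K a x y =
    if      does (d ≟ᶻ e₁) ∨ does (d ≟ᶻ neg e₁) then 1#
    else if does (d ≟ᶻ e₂) ∨ does (d ≟ᶻ neg e₂) then ⟦ a ⟧ * 𝕚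
    else 0#
    where
    d : ℤ × ℤ
    d = displacement (black x) (white y)

  -- Both composites are required to be identities, so N is determined by M up
  -- to _≈_.
  IsInverse : ∀ {n} → (Black n → White n → ℂ) → (White n → Black n → ℂ) → Set ℓ₁
  IsInverse M N =
    (∀ x x′ → ∑ᵂ (λ y → M x y * N y x′) ≈ (if does (x ≟ᴮ x′) then 1# else 0#)) ×
    (∀ y y′ → ∑ᴮ (λ x → N y x * M x y′) ≈ (if does (y ≟ᵂ y′) then 1# else 0#))

  G : ∀ {n} → (White n → Black n → ℂ) → (w b : ℂ × ℂ) → ℂ
  G K⁻¹ (w₁ , w₂) (b₁ , b₂) =
    ∑ᵂ λ x → ∑ᴮ λ y →
      K⁻¹ x y * w₁ ^ proj₁ (white x) * w₂ ^ proj₂ (white x)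
              * b₁ ^ proj₁ (black y) * b₂ ^ proj₂ (black y)

  C : ℝ⁺ → ℂ → ℂ → ℂ
  C a r₁ r₂ = 1# + r₁ ^ 2 * r₂ ^ 2 + 𝕚 * ⟦ a ⟧ * (r₁ ^ 2 + r₂ ^ 2)

  f : ℕ → (t : ℂ) → NonZero (1# - t) → ℂ
  f n t 1-t≠0 = (1# - t ^ n) / (1# - t) [ 1-t≠0 ]

  T : ℂ → ℂ → ℝ⁺ → ℂ
  T w b a = (1# + b * ⟦ a ⟧ * 𝕚) * (1# + w * ⟦ a ⟧ * 𝕚) / (1# + ⟦ a ⟧ ^ 2) [ 1+a²-nonZero a ]

  F : ℕ → (w b : ℂ) (a : ℝ⁺) → NonZero (1# - T w b a) → ℂ
  F n w b a 1-T≠0 = - (𝕚 * ⟦ a ⟧ / (1# + ⟦ a ⟧ ^ 2) [ 1+a²-nonZero a ]) * f n (T w b a) 1-T≠0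

  𝕚/_ : ℝ⁺ → ℂ
  𝕚/ a = 𝕚 / ⟦ a ⟧ [ ⟦⟧-nonZero a ]

  -- The generating function identity is one of rational functions in
  -- w₁, w₂, b₁, b₂.  These are the points at which no denominator occurring
  -- in it vanishes.
  record NoPole (a : ℝ⁺) (w b : ℂ × ℂ) : Set ℓ₂ where
    w₁ = proj₁ w
    w₂ = proj₂ w
    b₁ = proj₁ b
    b₂ = proj₂ b

    field
      w₁²≠0    : NonZero (w₁ ^ 2)
      b₂²≠0    : NonZero (b₂ ^ 2)
      Cʷ≠0     : NonZero (C a w₁ w₂)
      Cᵇ≠0     : NonZero (C a b₁ b₂)
      w₁²b₁²≠1 : NonZero (1# - w₁ ^ 2 * b₁ ^ 2)
      w₂²b₂²≠1 : NonZero (1# - w₂ ^ 2 * b₂ ^ 2)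

    -1/w₁² = (- 1#) / w₁ ^ 2 [ w₁²≠0 ]
    1/w₁²  = 1# / w₁ ^ 2 [ w₁²≠0 ]
    -1/b₂² = (- 1#) / b₂ ^ 2 [ b₂²≠0 ]
    1/b₂²  = 1# / b₂ ^ 2 [ b₂²≠0 ]

    field
      T⁰⁰≠1 : NonZero (1# - T (w₁ ^ 2) (b₂ ^ 2) a)
      T⁰¹≠1 : NonZero (1# - T -1/w₁² (- (b₂ ^ 2)) (a ⁻¹))
      T¹⁰≠1 : NonZero (1# - T (- (w₁ ^ 2)) -1/b₂² (a ⁻¹))
      T¹¹≠1 : NonZero (1# - T 1/w₁² 1/b₂² a)

    CʷCᵇ≠0 : NonZero (C a w₁ w₂ * C a b₁ b₂)
    CʷCᵇ≠0 = *-nonZero Cʷ≠0 Cᵇ≠0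

    F⁰⁰ F⁰¹ F¹⁰ F¹¹ : ℕ → ℂ
    F⁰⁰ n = F n (w₁ ^ 2) (b₂ ^ 2) a T⁰⁰≠1 * w₁ * b₂
    F⁰¹ n = F n -1/w₁² (- (b₂ ^ 2)) (a ⁻¹) T⁰¹≠1
              * w₁ ^ (2 ℕ.* n ∸ 1) * b₁ ^ (2 ℕ.* n) * b₂ * 𝕚/ a
    F¹⁰ n = F n (- (w₁ ^ 2)) -1/b₂² (a ⁻¹) T¹⁰≠1
              * w₁ * w₂ ^ (2 ℕ.* n) * b₂ ^ (2 ℕ.* n ∸ 1) * 𝕚/ a
    F¹¹ n = F n 1/w₁² 1/b₂² a T¹¹≠1
              * w₁ ^ (2 ℕ.* n ∸ 1) * w₂ ^ (2 ℕ.* n) * b₁ ^ (2 ℕ.* n) * b₂ ^ (2 ℕ.* n ∸ 1)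

{-# OPTIONS --safe #-}

-- Write α = ia, δ = 1/(1 - α²), u = w₁², q = b₂², s = 1 + αu and t = α + u.  A
-- column of K⁻¹ is a sequence P₀, …, Pₙ of polynomials in u of degree < n with
-- s Pⱼ₊₁ + t Pⱼ = [j = l] uᵏ for 0 ≤ j < n.  As s and t are independent linear
-- forms, expanding in the products sʳ tⁿ⁻¹⁻ʳ turns multiplication by s and t
-- into shifts, and the system falls apart into triangular ones with
-- coefficients ±1; this gives a right inverse.  Exchanging the two coordinates
-- preserves K, so the transpose of that right inverse is a left inverse.
-- Hence K⁻¹ is invariant under the exchange, and summing the column equations
-- for K⁻¹ and for its transpose expresses G through the values of K⁻¹ on pairs
-- of boundary edges.  The generating function of each of these four corner
-- blocks telescopes: (t + q s) times it is a difference of two n-th powers,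
-- which is the geometric sum f_n in F_n.

module Submission where

open import Algebra.Bundles using (CommutativeRing)
open import Data.Bool.Base using (Bool; true; false; if_then_else_; _∨_)
open import Data.Fin.Base using (Fin; zero; suc; toℕ; fromℕ<)
import Data.Fin.Properties as Fin
open import Data.Integer.Base as ℤ using (ℤ; +_; -[1+_]; _⊖_; _◃_)
import Data.Integer.Properties as ℤ
open import Data.Maybe.Base using (Maybe; just; nothing)
open import Data.Nat.Base as ℕ using (ℕ; zero; suc; _≤_; _<_; z≤n; s≤s; _∸_)
  renaming (_+_ to _+ℕ_; _*_ to _*ℕ_)
import Data.Nat.Properties as ℕ
open import Data.Product.Base using (_×_; _,_; ∃-syntax; proj₁; proj₂; swap)
open import Data.Product.Properties using (≡-dec)
import Data.Sign.Base as Sign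
open import Defs
open import Function.Base using (_∘_)
open import Level using (_⊔_)
open import Relation.Binary.PropositionalEquality.Core as ≡ using (_≡_; _≢_)
open import Relation.Nullary.Decidable using (yes; no; does; dec-true; dec-false)
open import Relation.Nullary.Negation using (contradiction)

import Algebra.Properties.CommutativeSemiring.Exp as Exp

-- Independence of s and t is used in the form δ(s - αt) = 1 and δ(t - αs) = u. Thus uᵏ is the value
-- at S = s, T = t of the binary form δⁿ(S - αT)ⁿ⁻ᵏ(T - αS)ᵏ of degree n, while each Pⱼ is sought as
-- a form of degree n - 1. The coefficient of Sʳ in the equation for j involves only coefficient r -
-- 1 of Pⱼ₊₁ and coefficient r of Pⱼ, so r + j is constant along each triangular system. The two
-- ends r = 0 and r = n, where one of the two coefficients is absent, decide from which side a
-- system is solved.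
--
-- Summing over l with weights qˡ turns a corner block into the quotient of a binary form by T + qS.
-- The remainder is governed by the value of the form at a zero of T + qS, and for k = 0 and k = n
-- the form is a pure n-th power: this is the origin of the n-th powers in f_n. The four blocks give
-- ζⁿ - τⁿ with ζ = 1, u, q, uq, and the argument of f_n is the ratio τ/ζ; for ζ = u and ζ = q this
-- ratio takes the shape of T with 1/a in place of a.

-- Normalisation in commutative rings with integer coefficients

module IntegerCoefficients {c ℓ} (R : CommutativeRing c ℓ) where

  open CommutativeRing R hiding (zero)
  open import Algebra.Properties.Ring ring
    using (-‿distribˡ-*; -‿distribʳ-*; -‿involutive; -0#≈0#)
  open import Algebra.Properties.AbelianGroup +-abelianGroup using (⁻¹-∙-comm)
  open import Algebra.Properties.Semiring.Mult.TCOptimised semiring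
    using (1+×; ×-homo-+; ×1-homo-*) renaming (_×_ to _·_)
  open import Algebra.Solver.Ring.AlmostCommutativeRing
    using (_-Raw-AlmostCommutative⟶_; fromCommutativeRing)
  open import Relation.Binary.Reasoning.Setoid setoid

  private
    ι : ℤ → Carrier
    ι (+ n)    = n · 1#
    ι -[1+ n ] = - (suc n · 1#)

    ι-⊖ : ∀ m n → ι (m ⊖ n) ≈ m · 1# - n · 1#
    ι-⊖ m zero = sym (trans (+-congˡ -0#≈0#) (+-identityʳ _))
    ι-⊖ zero (suc n) = sym (+-identityˡ _)
    ι-⊖ (suc m) (suc n) = begin
      ι (suc m ⊖ suc n)                ≡⟨ ≡.cong ι (ℤ.[1+m]⊖[1+n]≡m⊖n m n) ⟩
      ι (m ⊖ n)                        ≈⟨ ι-⊖ m n ⟩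
      x - y                            ≈⟨ +-congʳ (+-identityʳ x) ⟨
      x + 0# - y                       ≈⟨ +-congʳ (+-congˡ (-‿inverseʳ 1#)) ⟨
      x + (1# - 1#) - y                ≈⟨ +-congʳ (+-assoc x 1# (- 1#)) ⟨
      x + 1# - 1# - y                  ≈⟨ +-assoc _ _ _ ⟩
      x + 1# + (- 1# - y)              ≈⟨ +-cong (+-comm x 1#) (⁻¹-∙-comm 1# y) ⟩
      1# + x - (1# + y)                ≈⟨ +-cong (1+× m 1#) (-‿cong (1+× n 1#)) ⟨
      suc m · 1# - suc n · 1#          ∎
      where
      x = m · 1#
      y = n · 1#

    ι-neg◃ : ∀ n → ι (Sign.- ◃ n) ≈ - (n · 1#)
    ι-neg◃ zero    = sym -0#≈0#
    ι-neg◃ (suc n) = refl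

    ι-pos◃ : ∀ n → ι (Sign.+ ◃ n) ≈ n · 1#
    ι-pos◃ zero    = refl
    ι-pos◃ (suc n) = refl

    ι-+ : ∀ i j → ι (i ℤ.+ j) ≈ ι i + ι j
    ι-+ (+ m) (+ n) = ×-homo-+ 1# m n
    ι-+ (+ m) -[1+ n ] = ι-⊖ m (suc n)
    ι-+ -[1+ m ] (+ n) = trans (ι-⊖ n (suc m)) (+-comm _ _)
    ι-+ -[1+ m ] -[1+ n ] = begin
      - (suc (suc (m ℕ.+ n)) · 1#)      ≡⟨ ≡.cong (λ k → - (suc k · 1#)) (ℕ.+-suc m n) ⟨
      - ((suc m ℕ.+ suc n) · 1#)        ≈⟨ -‿cong (×-homo-+ 1# (suc m) (suc n)) ⟩
      - (suc m · 1# + suc n · 1#)       ≈⟨ ⁻¹-∙-comm _ _ ⟨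
      - (suc m · 1#) - suc n · 1#       ∎

    ι-* : ∀ i j → ι (i ℤ.* j) ≈ ι i * ι j
    ι-* (+ m) (+ n) = trans (ι-pos◃ (m ℕ.* n)) (×1-homo-* m n)
    ι-* (+ m) -[1+ n ] = trans (ι-neg◃ (m ℕ.* suc n))
      (trans (-‿cong (×1-homo-* m (suc n))) (-‿distribʳ-* _ _))
    ι-* -[1+ m ] (+ n) = trans (ι-neg◃ (suc m ℕ.* n))
      (trans (-‿cong (×1-homo-* (suc m) n)) (-‿distribˡ-* _ _))
    ι-* -[1+ m ] -[1+ n ] = begin
      (suc m ℕ.* suc n) · 1#              ≈⟨ ×1-homo-* (suc m) (suc n) ⟩
      x * y                               ≈⟨ -‿involutive _ ⟨
      - - (x * y)                         ≈⟨ -‿cong (-‿distribˡ-* x y) ⟩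
      - (- x * y)                         ≈⟨ -‿distribʳ-* (- x) y ⟩
      - x * - y                           ∎
      where
      x = suc m · 1#
      y = suc n · 1#

    ι-neg : ∀ i → ι (ℤ.- i) ≈ - ι i
    ι-neg (+ zero)  = sym -0#≈0#
    ι-neg (+ suc n) = refl
    ι-neg -[1+ n ]  = sym (-‿involutive _)

    -- Equality in `R` need not be decidable. Integers have decidable equality and act on every
    -- commutative ring, so opposite terms can be cancelled by the solver.
    homomorphism : ℤ.+-*-rawRing -Raw-AlmostCommutative⟶ fromCommutativeRing R
    homomorphism = record
      { ⟦_⟧    = ι
      ; +-homo = ι-+
      ; *-homo = ι-*
      ; -‿homo = ι-neg
      ; 0-homo = refl
      ; 1-homo = refl
      }

    _≟_ : ∀ i j → Maybe (ι i ≈ ι j)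
    i ≟ j with i ℤ.≟ j
    ... | yes i≡j = just (reflexive (≡.cong ι i≡j))
    ... | no  _   = nothing

  open import Algebra.Solver.Ring ℤ.+-*-rawRing (fromCommutativeRing R) homomorphism _≟_ public
    using (Polynomial; solve; _:+_; _:*_; _:-_; :-_; _:^_; _:=_; con)

  𝟘 𝟙 : ∀ {n} → Polynomial n
  𝟘 = con (+ 0)
  𝟙 = con (+ 1)

-- Finite sums over initial segments of ℕ

module RangeSums {c ℓ} (R : CommutativeRing c ℓ) where

  open CommutativeRing R hiding (zero)
  open IntegerCoefficients R
  open import Algebra.Properties.Semiring.Sum semiring
    using (sum; sum-cong-≋; ∑-distrib-+; *-distribˡ-sum; ∑-comm; sum-replicate-zero)
  open import Relation.Binary.Reasoning.Setoid setoid

  -- Opaque, so that the summand can be recovered from the sum by unification.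
  opaque
    ∑< : ℕ → (ℕ → Carrier) → Carrier
    ∑< n f = sum {n} (f ∘ toℕ)

    ∑<-sum : ∀ n f → ∑< n f ≈ sum {n} (f ∘ toℕ)
    ∑<-sum n f = refl

    ∑<-empty : ∀ f → ∑< 0 f ≈ 0#
    ∑<-empty f = refl

    ∑<-head : ∀ n f → ∑< (suc n) f ≈ f 0 + ∑< n (f ∘ suc)
    ∑<-head n f = refl

    ∑<-cong : ∀ n {f g} → (∀ i → i < n → f i ≈ g i) → ∑< n f ≈ ∑< n g
    ∑<-cong n f≈g = sum-cong-≋ {n} (λ i → f≈g (toℕ i) (Fin.toℕ<n i))

    ∑<-distrib-+ : ∀ n f g → ∑< n (λ i → f i + g i) ≈ ∑< n f + ∑< n g
    ∑<-distrib-+ n f g = ∑-distrib-+ {n} (f ∘ toℕ) (g ∘ toℕ)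

    ∑<-distribˡ : ∀ n x f → x * ∑< n f ≈ ∑< n (λ i → x * f i)
    ∑<-distribˡ n x f = *-distribˡ-sum {n} x (f ∘ toℕ)

    ∑<-zero : ∀ n → ∑< n (λ _ → 0#) ≈ 0#
    ∑<-zero = sum-replicate-zero

    ∑<-comm : ∀ m n (f : ℕ → ℕ → Carrier) →
      ∑< m (λ i → ∑< n (f i)) ≈ ∑< n (λ j → ∑< m (λ i → f i j))
    ∑<-comm m n f = ∑-comm {m} {n} (λ i j → f (toℕ i) (toℕ j))

  ∑<-last : ∀ n f → ∑< (suc n) f ≈ ∑< n f + f n
  ∑<-last zero f = begin
    ∑< 1 f                ≈⟨ ∑<-head 0 f ⟩
    f 0 + ∑< 0 (f ∘ suc)  ≈⟨ +-congˡ (trans (∑<-empty (f ∘ suc)) (sym (∑<-empty f))) ⟩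
    f 0 + ∑< 0 f          ≈⟨ +-comm (f 0) _ ⟩
    ∑< 0 f + f 0          ∎
  ∑<-last (suc n) f = begin
    ∑< (suc (suc n)) f                     ≈⟨ ∑<-head (suc n) f ⟩
    f 0 + ∑< (suc n) (f ∘ suc)             ≈⟨ +-congˡ (∑<-last n (f ∘ suc)) ⟩
    f 0 + (∑< n (f ∘ suc) + f (suc n))     ≈⟨ +-assoc _ _ _ ⟨
    f 0 + ∑< n (f ∘ suc) + f (suc n)       ≈⟨ +-congʳ (∑<-head n f) ⟨
    ∑< (suc n) f + f (suc n)               ∎

  ∑<-telescope : ∀ n (f : ℕ → Carrier) → ∑< n (λ i → f i - f (suc i)) ≈ f 0 - f n
  ∑<-telescope zero f = trans (∑<-empty _) (sym (-‿inverseʳ (f 0)))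
  ∑<-telescope (suc n) f = begin
    ∑< (suc n) (λ i → f i - f (suc i))              ≈⟨ ∑<-last n _ ⟩
    ∑< n (λ i → f i - f (suc i)) + (f n - f (suc n))  ≈⟨ +-congʳ (∑<-telescope n f) ⟩
    f 0 - f n + (f n - f (suc n))
      ≈⟨ solve 3 (λ x y z → x :- y :+ (y :- z) := x :- z) refl (f 0) (f n) (f (suc n)) ⟩
    f 0 - f (suc n)                                 ∎

-- Coefficient sequences, read as polynomials and as binary forms

module Polynomials {c ℓ} (R : CommutativeRing c ℓ) where

  open CommutativeRing R hiding (zero)
  open IntegerCoefficients R
  open RangeSums R
  open import Algebra.Properties.Semiring.Exp semiring using (_^_)
  open import Relation.Binary.Reasoning.Setoid setoid

  infix 4 _≋_
  _≋_ : (p q : ℕ → Carrier) → Set ℓ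
  p ≋ q = ∀ i → p i ≈ q i

  shift : (ℕ → Carrier) → ℕ → Carrier
  shift p zero    = 0#
  shift p (suc i) = p i

  -- The coefficients of uᵏ. As a function of two indices this is also the Kronecker delta, and both
  -- readings are used.
  mono : ℕ → ℕ → Carrier
  mono zero zero    = 1#
  mono zero (suc _) = 0#
  mono (suc k)      = shift (mono k)

  -- Multiplication by `x₁ u + x₀`. If the sequence lists the coefficients of a binary form by the
  -- exponent of S, it is multiplication by `x₁ S + x₀ T`.
  lin : (x₁ x₀ : Carrier) → (ℕ → Carrier) → ℕ → Carrier
  lin x₁ x₀ p i = x₁ * shift p i + x₀ * p i

  Degree≤ : ℕ → (ℕ → Carrier) → Set ℓ
  Degree≤ m p = ∀ i → m < i → p i ≈ 0#

  eval : ℕ → Carrier → (ℕ → Carrier) → Carrier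
  eval n u p = ∑< n (λ i → p i * u ^ i)

  shift-cong : ∀ {p q} → p ≋ q → shift p ≋ shift q
  shift-cong p≈q zero    = refl
  shift-cong p≈q (suc i) = p≈q i

  lin-cong : ∀ {x₁ x₀ y₁ y₀ p q} → x₁ ≈ y₁ → x₀ ≈ y₀ → p ≋ q → lin x₁ x₀ p ≋ lin y₁ y₀ q
  lin-cong eq₁ eq₀ p≈q i = +-cong (*-cong eq₁ (shift-cong p≈q i)) (*-cong eq₀ (p≈q i))

  lin-comm : ∀ x₁ x₀ y₁ y₀ p → lin x₁ x₀ (lin y₁ y₀ p) ≋ lin y₁ y₀ (lin x₁ x₀ p)
  lin-comm x₁ x₀ y₁ y₀ p zero =
    solve 5 (λ x₁ x₀ y₁ y₀ p →
        x₁ :* 𝟘 :+ x₀ :* (y₁ :* 𝟘 :+ y₀ :* p) := y₁ :* 𝟘 :+ y₀ :* (x₁ :* 𝟘 :+ x₀ :* p))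
      refl x₁ x₀ y₁ y₀ (p 0)
  lin-comm x₁ x₀ y₁ y₀ p (suc i) =
    solve 7 (λ x₁ x₀ y₁ y₀ p q r →
        x₁ :* (y₁ :* r :+ y₀ :* q) :+ x₀ :* (y₁ :* q :+ y₀ :* p) :=
        y₁ :* (x₁ :* r :+ x₀ :* q) :+ y₀ :* (x₁ :* q :+ x₀ :* p))
      refl x₁ x₀ y₁ y₀ (p (suc i)) (p i) (shift p i)

  shift-linear : ∀ a b p q → shift (λ i → a * p i + b * q i) ≋ λ i → a * shift p i + b * shift q i
  shift-linear a b p q zero    = solve 2 (λ a b → 𝟘 := a :* 𝟘 :+ b :* 𝟘) refl a b
  shift-linear a b p q (suc i) = refl

  lin-linear : ∀ x₁ x₀ a b p q →
    lin x₁ x₀ (λ i → a * p i + b * q i) ≋ λ i → a * lin x₁ x₀ p i + b * lin x₁ x₀ q i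
  lin-linear x₁ x₀ a b p q i = trans (+-congʳ (*-congˡ (shift-linear a b p q i)))
    (solve 8 (λ x₁ x₀ a b p p′ q q′ →
        x₁ :* (a :* p′ :+ b :* q′) :+ x₀ :* (a :* p :+ b :* q) :=
        a :* (x₁ :* p′ :+ x₀ :* p) :+ b :* (x₁ :* q′ :+ x₀ :* q))
      refl x₁ x₀ a b (p i) (shift p i) (q i) (shift q i))

  degree-lin : ∀ {m p} x₁ x₀ → Degree≤ m p → Degree≤ (suc m) (lin x₁ x₀ p)
  degree-lin x₁ x₀ p≤m (suc i) (s≤s m<i) =
    trans (+-cong (trans (*-congˡ (p≤m i m<i)) (zeroʳ x₁))
                  (trans (*-congˡ (p≤m (suc i) (ℕ.m<n⇒m<1+n m<i))) (zeroʳ x₀)))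
          (+-identityˡ 0#)

  degree-mono : ∀ k → Degree≤ k (mono k)
  degree-mono zero    (suc i) _         = refl
  degree-mono (suc k) (suc i) (s≤s k<i) = degree-mono k i k<i

  eval-shift : ∀ n u p → eval (suc n) u (shift p) ≈ u * eval n u p
  eval-shift n u p = begin
    eval (suc n) u (shift p)                  ≈⟨ ∑<-head n _ ⟩
    0# * 1# + ∑< n (λ i → p i * (u * u ^ i))  ≈⟨ +-cong (zeroˡ 1#) (∑<-cong n λ i _ → x∙uy≈u∙xy (p i) (u ^ i)) ⟩
    0# + ∑< n (λ i → u * (p i * u ^ i))       ≈⟨ +-identityˡ _ ⟩
    ∑< n (λ i → u * (p i * u ^ i))            ≈⟨ ∑<-distribˡ n u _ ⟨
    u * eval n u p                            ∎
    where
    x∙uy≈u∙xy : ∀ x y → x * (u * y) ≈ u * (x * y)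
    x∙uy≈u∙xy x y = solve 3 (λ u x y → x :* (u :* y) := u :* (x :* y)) refl u x y

  eval-linear : ∀ n u a b p q →
    eval n u (λ i → a * p i + b * q i) ≈ a * eval n u p + b * eval n u q
  eval-linear n u a b p q = begin
    ∑< n (λ i → (a * p i + b * q i) * u ^ i)
      ≈⟨ ∑<-cong n (λ i _ → solve 5 (λ a b p q u → (a :* p :+ b :* q) :* u := a :* (p :* u) :+ b :* (q :* u))
           refl a b (p i) (q i) (u ^ i)) ⟩
    ∑< n (λ i → a * (p i * u ^ i) + b * (q i * u ^ i))
      ≈⟨ ∑<-distrib-+ n _ _ ⟩
    ∑< n (λ i → a * (p i * u ^ i)) + ∑< n (λ i → b * (q i * u ^ i))
      ≈⟨ +-cong (∑<-distribˡ n a _) (∑<-distribˡ n b _) ⟨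
    a * eval n u p + b * eval n u q ∎

  -- Because `p n` vanishes, truncating `p` after `n` or after `suc n` terms gives the same value,
  -- so the shifted and the unshifted part can be compared.
  eval-lin : ∀ n u x₁ x₀ p → p n ≈ 0# →
    eval (suc n) u (lin x₁ x₀ p) ≈ (x₁ * u + x₀) * eval n u p
  eval-lin n u x₁ x₀ p pn≈0 = begin
    eval (suc n) u (lin x₁ x₀ p)
      ≈⟨ eval-linear (suc n) u x₁ x₀ (shift p) p ⟩
    x₁ * eval (suc n) u (shift p) + x₀ * eval (suc n) u p
      ≈⟨ +-cong (*-congˡ (eval-shift n u p)) (*-congˡ (∑<-last n _)) ⟩
    x₁ * (u * eval n u p) + x₀ * (eval n u p + p n * u ^ n)
      ≈⟨ +-congˡ (*-congˡ (+-congˡ (*-congʳ pn≈0))) ⟩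
    x₁ * (u * eval n u p) + x₀ * (eval n u p + 0# * u ^ n)
      ≈⟨ solve 5 (λ u x₁ x₀ e y → x₁ :* (u :* e) :+ x₀ :* (e :+ 𝟘 :* y) := (x₁ :* u :+ x₀) :* e)
           refl u x₁ x₀ (eval n u p) (u ^ n) ⟩
    (x₁ * u + x₀) * eval n u p ∎

  eval-mono : ∀ n k u → k < n → eval n u (mono k) ≈ u ^ k
  eval-mono (suc n) zero u _ = begin
    eval (suc n) u (mono 0)                  ≈⟨ ∑<-head n _ ⟩
    1# * 1# + ∑< n (λ i → 0# * (u * u ^ i))  ≈⟨ +-cong (*-identityˡ 1#) (∑<-cong n λ i _ → zeroˡ _) ⟩
    1# + ∑< n (λ _ → 0#)                     ≈⟨ +-congˡ (∑<-zero n) ⟩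
    1# + 0#                                  ≈⟨ +-identityʳ 1# ⟩
    1#                                       ∎
  eval-mono (suc n) (suc k) u (s≤s k<n) =
    trans (eval-shift n u (mono k)) (*-congˡ (eval-mono n k u k<n))

  mono-sym : ∀ i j → mono i j ≈ mono j i
  mono-sym zero    zero    = refl
  mono-sym zero    (suc j) = refl
  mono-sym (suc i) zero    = refl
  mono-sym (suc i) (suc j) = mono-sym i j

  mono-sift : ∀ N (h : ℕ → Carrier) k → k < N → ∑< N (λ i → mono k i * h i) ≈ h k
  mono-sift (suc N) h zero _ = begin
    ∑< (suc N) (λ i → mono zero i * h i)              ≈⟨ ∑<-head N _ ⟩
    1# * h 0 + ∑< N (λ i → 0# * h (suc i))
      ≈⟨ +-cong (*-identityˡ _) (trans (∑<-cong N λ i _ → zeroˡ _) (∑<-zero N)) ⟩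
    h 0 + 0#                                          ≈⟨ +-identityʳ _ ⟩
    h 0                                               ∎
  mono-sift (suc N) h (suc k) (s≤s k<N) = begin
    ∑< (suc N) (λ i → mono (suc k) i * h i)           ≈⟨ ∑<-head N _ ⟩
    0# * h 0 + ∑< N (λ i → mono k i * h (suc i))      ≈⟨ +-cong (zeroˡ _) (mono-sift N (λ i → h (suc i)) k k<N) ⟩
    0# + h (suc k)                                    ≈⟨ +-identityˡ _ ⟩
    h (suc k)                                         ∎

  mono-expand : ∀ {m p} → Degree≤ m p → ∀ i → ∑< (suc m) (λ k → mono k i * p k) ≈ p i
  mono-expand {m} {p} p≤m i with i ℕ.<? (suc m)
  ... | yes i≤m = trans (∑<-cong (suc m) λ k _ → *-congʳ (mono-sym k i)) (mono-sift (suc m) p i i≤m)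
  ... | no  i≰m = begin
    ∑< (suc m) (λ k → mono k i * p k)
      ≈⟨ ∑<-cong (suc m) (λ k k≤m → trans (*-congʳ (degree-mono k i (ℕ.<-≤-trans k≤m (ℕ.≮⇒≥ i≰m)))) (zeroˡ _)) ⟩
    ∑< (suc m) (λ _ → 0#)  ≈⟨ ∑<-zero (suc m) ⟩
    0#                     ≈⟨ p≤m i (ℕ.≮⇒≥ i≰m) ⟨
    p i                    ∎

  -- The numbers `lin a b (mono k) i` form the matrix of multiplication by `a u + b`; for a
  -- polynomial of degree at most `m` its first `suc m` columns suffice.
  lin-expand : ∀ {m p} a b → Degree≤ m p → ∀ i → ∑< (suc m) (λ k → lin a b (mono k) i * p k) ≈ lin a b p i
  lin-expand {m} {p} a b p≤m i = begin
    ∑< (suc m) (λ k → (a * shift (mono k) i + b * mono k i) * p k)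
      ≈⟨ ∑<-cong (suc m) (λ k _ → solve 5 (λ a b x y p → (a :* x :+ b :* y) :* p := a :* (x :* p) :+ b :* (y :* p))
           refl a b (shift (mono k) i) (mono k i) (p k)) ⟩
    ∑< (suc m) (λ k → a * (shift (mono k) i * p k) + b * (mono k i * p k))
      ≈⟨ ∑<-distrib-+ (suc m) _ _ ⟩
    ∑< (suc m) (λ k → a * (shift (mono k) i * p k)) + ∑< (suc m) (λ k → b * (mono k i * p k))
      ≈⟨ +-cong (∑<-distribˡ (suc m) a _) (∑<-distribˡ (suc m) b _) ⟨
    a * ∑< (suc m) (λ k → shift (mono k) i * p k) + b * ∑< (suc m) (λ k → mono k i * p k)
      ≈⟨ +-cong (*-congˡ (shift-expand i)) (*-congˡ (mono-expand p≤m i)) ⟩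
    lin a b p i ∎
    where
    shift-expand : ∀ i → ∑< (suc m) (λ k → shift (mono k) i * p k) ≈ shift p i
    shift-expand zero    = trans (∑<-cong (suc m) λ k _ → zeroˡ _) (∑<-zero (suc m))
    shift-expand (suc i) = mono-expand p≤m i

  1^n≈1 : ∀ n → 1# ^ n ≈ 1#
  1^n≈1 zero    = refl
  1^n≈1 (suc n) = trans (*-identityˡ _) (1^n≈1 n)

  -- Summation by parts: the terms `s * P (suc j)` and `t * P j` carry the same power of `v`, which
  -- leaves one unpaired term at each end.
  ∑-recurrence : ∀ n s t v (P : ℕ → Carrier) →
    (s + v * t) * ∑< (suc n) (λ j → P j * v ^ j) ≈
      s * P 0 + v ^ suc n * t * P n + ∑< n (λ j → v ^ suc j * (s * P (suc j) + t * P j))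
  ∑-recurrence zero s t v P = begin
    (s + v * t) * ∑< 1 (λ j → P j * v ^ j)
      ≈⟨ *-congˡ (∑<-last 0 _) ⟩
    (s + v * t) * (∑< 0 (λ j → P j * v ^ j) + P 0 * 1#)
      ≈⟨ *-congˡ (+-congʳ (∑<-empty _)) ⟩
    (s + v * t) * (0# + P 0 * 1#)
      ≈⟨ solve 4 (λ s t v p → (s :+ v :* t) :* (𝟘 :+ p :* 𝟙) := s :* p :+ v :* 𝟙 :* t :* p :+ 𝟘)
           refl s t v (P 0) ⟩
    s * P 0 + v ^ 1 * t * P 0 + 0#
      ≈⟨ +-congˡ (∑<-empty _) ⟨
    s * P 0 + v ^ 1 * t * P 0 + ∑< 0 (λ j → v ^ suc j * (s * P (suc j) + t * P j)) ∎
  ∑-recurrence (suc n) s t v P = begin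
    (s + v * t) * ∑< (suc (suc n)) (λ j → P j * v ^ j)
      ≈⟨ *-congˡ (∑<-last (suc n) _) ⟩
    (s + v * t) * (∑< (suc n) (λ j → P j * v ^ j) + p′ * vⁿ)
      ≈⟨ distribˡ _ _ _ ⟩
    (s + v * t) * ∑< (suc n) (λ j → P j * v ^ j) + (s + v * t) * (p′ * vⁿ)
      ≈⟨ +-congʳ (∑-recurrence n s t v P) ⟩
    s * P 0 + vⁿ * t * P n + S + (s + v * t) * (p′ * vⁿ)
      ≈⟨ solve 8 (λ s t v p₀ p p′ vⁿ S →
           s :* p₀ :+ vⁿ :* t :* p :+ S :+ (s :+ v :* t) :* (p′ :* vⁿ) :=
           s :* p₀ :+ v :* vⁿ :* t :* p′ :+ (S :+ vⁿ :* (s :* p′ :+ t :* p)))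
           refl s t v (P 0) (P n) p′ vⁿ S ⟩
    s * P 0 + v * vⁿ * t * p′ + (S + vⁿ * (s * p′ + t * P n))
      ≈⟨ +-congˡ (∑<-last n _) ⟨
    s * P 0 + v * vⁿ * t * p′ + ∑< (suc n) (λ j → v ^ suc j * (s * P (suc j) + t * P j)) ∎
    where
    p′ = P (suc n)
    vⁿ = v ^ suc n
    S  = ∑< n (λ j → v ^ suc j * (s * P (suc j) + t * P j))

  -- The form c₀ yᵐ + ... + c_m xᵐ in Horner shape. The degree is an argument, so one sequence
  -- represents forms of different degrees that differ by powers of `y`.
  hom : (x y : Carrier) → ℕ → (ℕ → Carrier) → Carrier
  hom x y zero    c = c 0
  hom x y (suc m) c = y * hom x y m c + c (suc m) * x ^ suc m

  hom-cong : ∀ x y m {c d} → (∀ r → r ≤ m → c r ≈ d r) → hom x y m c ≈ hom x y m d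
  hom-cong x y zero    c≈d = c≈d 0 z≤n
  hom-cong x y (suc m) c≈d =
    +-cong (*-congˡ (hom-cong x y m λ r r≤m → c≈d r (ℕ.m≤n⇒m≤1+n r≤m))) (*-congʳ (c≈d (suc m) ℕ.≤-refl))

  -- c₀ Yᵐ + … + c_m Xᵐ evaluated at the linear polynomials X = x₁ u + x₀ and
  -- Y = y₁ u + y₀.
  module Substitution (x₁ x₀ y₁ y₀ : Carrier) where

    X Y : (ℕ → Carrier) → ℕ → Carrier
    X = lin x₁ x₀
    Y = lin y₁ y₀

    X^ : ℕ → ℕ → Carrier
    X^ zero    = mono 0
    X^ (suc r) = X (X^ r)

    subst : ℕ → (ℕ → Carrier) → ℕ → Carrier
    subst zero    c i = c 0 * mono 0 i
    subst (suc m) c i = Y (subst m c) i + c (suc m) * X^ (suc m) i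

    subst-cong : ∀ m {c d} → (∀ r → r ≤ m → c r ≈ d r) → subst m c ≋ subst m d
    subst-cong zero    c≈d i = *-congʳ (c≈d 0 z≤n)
    subst-cong (suc m) c≈d i =
      +-cong (lin-cong refl refl (subst-cong m λ r r≤m → c≈d r (ℕ.m≤n⇒m≤1+n r≤m)) i)
             (*-congʳ (c≈d (suc m) ℕ.≤-refl))

    subst-linear : ∀ m a b c d →
      subst m (λ r → a * c r + b * d r) ≋ λ i → a * subst m c i + b * subst m d i
    subst-linear zero a b c d i =
      solve 5 (λ a b c d e → (a :* c :+ b :* d) :* e := a :* (c :* e) :+ b :* (d :* e))
        refl a b (c 0) (d 0) (mono 0 i)
    subst-linear (suc m) a b c d i = trans
      (+-congʳ (trans (lin-cong refl refl (subst-linear m a b c d) i)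
                      (lin-linear y₁ y₀ a b (subst m c) (subst m d) i)))
      (solve 7 (λ a b c d e s t →
          a :* s :+ b :* t :+ (a :* c :+ b :* d) :* e :=
          a :* (s :+ c :* e) :+ b :* (t :+ d :* e))
        refl a b (c (suc m)) (d (suc m)) (X^ (suc m) i) (Y (subst m c) i) (Y (subst m d) i))

    -- Reading the same coefficients in one degree more multiplies the form by Y. Together with
    -- `subst-shift` this makes multiplication by X and Y a mere re-indexing.
    subst-suc : ∀ m c → c (suc m) ≈ 0# → subst (suc m) c ≋ Y (subst m c)
    subst-suc m c c≈0 i = trans (+-congˡ (trans (*-congʳ c≈0) (zeroˡ _))) (+-identityʳ _)

    subst-shift : ∀ m c → subst (suc m) (shift c) ≋ X (subst m c)
    subst-shift zero c i = trans
      (+-cong (trans (lin-cong refl refl (λ j → zeroˡ (mono 0 j)) i) (lin-0 i))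
              (sym (lin-* (c 0) (mono 0) i)))
      (+-identityˡ _)
      where
      lin-0 : lin y₁ y₀ (λ _ → 0#) ≋ λ _ → 0#
      lin-0 zero    = solve 2 (λ a b → a :* 𝟘 :+ b :* 𝟘 := 𝟘) refl y₁ y₀
      lin-0 (suc _) = solve 2 (λ a b → a :* 𝟘 :+ b :* 𝟘 := 𝟘) refl y₁ y₀
      lin-* : ∀ a p → X (λ i → a * p i) ≋ λ i → a * X p i
      lin-* a p zero    = solve 4 (λ a p x₁ x₀ → x₁ :* 𝟘 :+ x₀ :* (a :* p) := a :* (x₁ :* 𝟘 :+ x₀ :* p))
        refl a (p 0) x₁ x₀
      lin-* a p (suc i) = solve 5 (λ a p q x₁ x₀ →
          x₁ :* (a :* q) :+ x₀ :* (a :* p) := a :* (x₁ :* q :+ x₀ :* p))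
        refl a (p (suc i)) (p i) x₁ x₀
    subst-shift (suc m) c i = begin
      Y (subst (suc m) (shift c)) i + c (suc m) * X (X^ (suc m)) i
        ≈⟨ +-congʳ (lin-cong refl refl (subst-shift m c) i) ⟩
      Y (X (subst m c)) i + c (suc m) * X (X^ (suc m)) i
        ≈⟨ +-cong (trans (lin-comm y₁ y₀ x₁ x₀ (subst m c) i) (sym (*-identityˡ _))) refl ⟩
      1# * X (Y (subst m c)) i + c (suc m) * X (X^ (suc m)) i
        ≈⟨ lin-linear x₁ x₀ 1# (c (suc m)) (Y (subst m c)) (X^ (suc m)) i ⟨
      X (λ j → 1# * Y (subst m c) j + c (suc m) * X^ (suc m) j) i
        ≈⟨ lin-cong refl refl (λ j → +-congʳ (*-identityˡ _)) i ⟩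
      X (subst (suc m) c) i ∎

    subst-lin : ∀ m a b c → c (suc m) ≈ 0# →
      subst (suc m) (lin a b c) ≋ lin (a * x₁ + b * y₁) (a * x₀ + b * y₀) (subst m c)
    subst-lin m a b c c≈0 i = begin
      subst (suc m) (lin a b c) i
        ≈⟨ subst-linear (suc m) a b (shift c) c i ⟩
      a * subst (suc m) (shift c) i + b * subst (suc m) c i
        ≈⟨ +-cong (*-congˡ (subst-shift m c i)) (*-congˡ (subst-suc m c c≈0 i)) ⟩
      a * X (subst m c) i + b * Y (subst m c) i
        ≈⟨ solve 8 (λ a b x₁ x₀ y₁ y₀ p q →
               a :* (x₁ :* q :+ x₀ :* p) :+ b :* (y₁ :* q :+ y₀ :* p) :=
               (a :* x₁ :+ b :* y₁) :* q :+ (a :* x₀ :+ b :* y₀) :* p)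
             refl a b x₁ x₀ y₁ y₀ (subst m c i) (shift (subst m c) i) ⟩
      lin (a * x₁ + b * y₁) (a * x₀ + b * y₀) (subst m c) i ∎

    degree-X^ : ∀ r → Degree≤ r (X^ r)
    degree-X^ zero    = degree-mono 0
    degree-X^ (suc r) = degree-lin x₁ x₀ (degree-X^ r)

    degree-subst : ∀ m c → Degree≤ m (subst m c)
    degree-subst zero    c i 0<i = trans (*-congˡ (degree-mono 0 i 0<i)) (zeroʳ _)
    degree-subst (suc m) c i m<i = trans
      (+-cong (degree-lin y₁ y₀ (degree-subst m c) i m<i)
              (trans (*-congˡ (degree-X^ (suc m) i m<i)) (zeroʳ _)))
      (+-identityˡ 0#)

    eval-X^ : ∀ r u → eval (suc r) u (X^ r) ≈ (x₁ * u + x₀) ^ r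
    eval-X^ zero    u = eval-mono 1 0 u (s≤s z≤n)
    eval-X^ (suc r) u = trans (eval-lin (suc r) u x₁ x₀ (X^ r) (degree-X^ r (suc r) ℕ.≤-refl))
      (*-congˡ (eval-X^ r u))

    eval-subst : ∀ m c u → eval (suc m) u (subst m c) ≈ hom (x₁ * u + x₀) (y₁ * u + y₀) m c
    eval-subst zero c u = begin
      ∑< 1 (λ i → c 0 * mono 0 i * u ^ i)   ≈⟨ ∑<-cong 1 (λ i _ → *-assoc (c 0) (mono 0 i) (u ^ i)) ⟩
      ∑< 1 (λ i → c 0 * (mono 0 i * u ^ i)) ≈⟨ ∑<-distribˡ 1 (c 0) _ ⟨
      c 0 * eval 1 u (mono 0)               ≈⟨ *-congˡ (eval-mono 1 0 u (s≤s z≤n)) ⟩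
      c 0 * 1#                              ≈⟨ *-identityʳ (c 0) ⟩
      c 0                                   ∎
    eval-subst (suc m) c u = begin
      eval (suc (suc m)) u (subst (suc m) c)
        ≈⟨ ∑<-cong (suc (suc m)) (λ i _ → *-congʳ (+-congʳ (sym (*-identityˡ _)))) ⟩
      eval (suc (suc m)) u (λ i → 1# * Y (subst m c) i + c (suc m) * X^ (suc m) i)
        ≈⟨ eval-linear (suc (suc m)) u 1# (c (suc m)) (Y (subst m c)) (X^ (suc m)) ⟩
      1# * eval (suc (suc m)) u (Y (subst m c)) + c (suc m) * eval (suc (suc m)) u (X^ (suc m))
        ≈⟨ +-cong (trans (*-identityˡ _) (eval-lin (suc m) u y₁ y₀ (subst m c) (degree-subst m c (suc m) ℕ.≤-refl)))
                  (*-congˡ (eval-X^ (suc m) u)) ⟩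
      (y₁ * u + y₀) * eval (suc m) u (subst m c) + c (suc m) * (x₁ * u + x₀) ^ suc m
        ≈⟨ +-congʳ (*-congˡ (eval-subst m c u)) ⟩
      hom (x₁ * u + x₀) (y₁ * u + y₀) (suc m) c ∎

    X^-at-0 : ∀ r → X^ r 0 ≈ x₀ ^ r
    X^-at-0 zero    = refl
    X^-at-0 (suc r) = trans (+-congʳ (zeroʳ x₁)) (trans (+-identityˡ _) (*-congˡ (X^-at-0 r)))

    subst-at-0 : ∀ m c → subst m c 0 ≈ hom x₀ y₀ m c
    subst-at-0 zero    c = *-identityʳ (c 0)
    subst-at-0 (suc m) c = +-cong
      (trans (+-congʳ (zeroʳ y₁)) (trans (+-identityˡ _) (*-congˡ (subst-at-0 m c))))
      (*-congˡ (X^-at-0 (suc m)))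

    subst-∑ : ∀ m n (a : ℕ → Carrier) (c : ℕ → ℕ → Carrier) i →
      subst m (λ r → ∑< n (λ l → a l * c l r)) i ≈ ∑< n (λ l → a l * subst m (c l) i)
    subst-∑ m zero a c i = begin
      subst m (λ r → ∑< 0 (λ l → a l * c l r)) i
        -- Zero is written as a trivial linear combination, so that `subst-linear` annihilates it.
        ≈⟨ subst-cong m (λ r _ → trans (∑<-empty _) (solve 0 (𝟘 := 𝟘 :* 𝟘 :+ 𝟘 :* 𝟘) refl)) i ⟩
      subst m (λ r → 0# * 0# + 0# * 0#) i
        ≈⟨ subst-linear m 0# 0# (λ _ → 0#) (λ _ → 0#) i ⟩
      0# * subst m (λ _ → 0#) i + 0# * subst m (λ _ → 0#) i
        ≈⟨ +-cong (zeroˡ _) (zeroˡ _) ⟩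
      0# + 0#
        ≈⟨ +-identityˡ 0# ⟩
      0#
        ≈⟨ ∑<-empty _ ⟨
      ∑< 0 (λ l → a l * subst m (c l) i) ∎
    subst-∑ m (suc n) a c i = begin
      subst m (λ r → ∑< (suc n) (λ l → a l * c l r)) i
        ≈⟨ subst-cong m (λ r _ → trans (∑<-last n _) (+-congʳ (sym (*-identityˡ _)))) i ⟩
      subst m (λ r → 1# * ∑< n (λ l → a l * c l r) + a n * c n r) i
        ≈⟨ subst-linear m 1# (a n) _ (c n) i ⟩
      1# * subst m (λ r → ∑< n (λ l → a l * c l r)) i + a n * subst m (c n) i
        ≈⟨ +-congʳ (trans (*-identityˡ _) (subst-∑ m n a c i)) ⟩
      ∑< n (λ l → a l * subst m (c l) i) + a n * subst m (c n) i
        ≈⟨ ∑<-last n _ ⟨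
      ∑< (suc n) (λ l → a l * subst m (c l) i) ∎

-- The triangular systems and their sums over the source row

module Columns {c ℓ} (R : CommutativeRing c ℓ) where

  open CommutativeRing R hiding (zero)
  open IntegerCoefficients R
  open RangeSums R
  open Polynomials R
  open import Algebra.Properties.Semiring.Exp semiring using (_^_)
  open import Relation.Binary.Reasoning.Setoid setoid

  -- (-1)ˡ⁻ʲ if j ≤ l, and 0 otherwise.
  sign≤ : ℕ → ℕ → Carrier
  sign≤ zero    l       = (- 1#) ^ l
  sign≤ (suc j) zero    = 0#
  sign≤ (suc j) (suc l) = sign≤ j l

  -- (-1)ʲ⁻¹⁻ˡ if j > l, and 0 otherwise.
  sign> : ℕ → ℕ → Carrier
  sign> zero    l       = 0#
  sign> (suc j) zero    = (- 1#) ^ j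
  sign> (suc j) (suc l) = sign> j l

  -1*x+x≈0 : ∀ x → - 1# * x + x ≈ 0#
  -1*x+x≈0 = solve 1 (λ x → :- 𝟙 :* x :+ x := 𝟘) refl

  -- `sign≤` and `sign>` are two Green functions of the same first-order recurrence: one vanishes
  -- for j > l, the other for j ≤ l.
  sign≤-step : ∀ j l → sign≤ (suc j) l + sign≤ j l ≈ mono l j
  sign≤-step zero    zero    = +-identityˡ 1#
  sign≤-step zero    (suc l) = trans (+-comm _ _) (-1*x+x≈0 _)
  sign≤-step (suc j) zero    = +-identityˡ 0#
  sign≤-step (suc j) (suc l) = sign≤-step j l

  sign>-step : ∀ j l → sign> (suc j) l + sign> j l ≈ mono l j
  sign>-step zero    zero    = +-identityʳ 1#
  sign>-step zero    (suc l) = +-identityˡ 0#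
  sign>-step (suc j) zero    = -1*x+x≈0 _
  sign>-step (suc j) (suc l) = sign>-step j l

  sign>-zero : ∀ {j l} → j ≤ l → sign> j l ≈ 0#
  sign>-zero z≤n       = refl
  sign>-zero (s≤s j≤l) = sign>-zero j≤l

  -- The value at `i` is `g (i - l)`, with 0 for i < l.
  shifts : ℕ → (ℕ → Carrier) → ℕ → Carrier
  shifts zero    g = g
  shifts (suc l) g = shift (shifts l g)

  degree-shifts : ∀ {m g} l → Degree≤ m g → Degree≤ (m ℕ.+ l) (shifts l g)
  degree-shifts {m} zero    g≤m i m<i rewrite ℕ.+-identityʳ m = g≤m i m<i
  degree-shifts {m} (suc l) g≤m zero m<i = refl
  degree-shifts {m} (suc l) g≤m (suc i) m<i rewrite ℕ.+-suc m l =
    degree-shifts l g≤m i (ℕ.s<s⁻¹ m<i)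

  sign≤-shifts : ∀ j l g → sign≤ j l * shifts l g j ≈ mono l j * g 0
  sign≤-shifts zero    zero    g = refl
  sign≤-shifts zero    (suc l) g = trans (zeroʳ _) (sym (zeroˡ _))
  sign≤-shifts (suc j) zero    g = trans (zeroˡ _) (sym (zeroˡ _))
  sign≤-shifts (suc j) (suc l) g = sign≤-shifts j l g

  mono-shifts : ∀ j l g r → mono l j * shifts l g (r ℕ.+ j) ≈ mono l j * g r
  mono-shifts zero    zero    g r rewrite ℕ.+-identityʳ r = refl
  mono-shifts (suc j) zero    g r = trans (zeroˡ _) (sym (zeroˡ _))
  mono-shifts zero    (suc l) g r = trans (zeroˡ _) (sym (zeroˡ _))
  mono-shifts (suc j) (suc l) g r rewrite ℕ.+-suc r j = mono-shifts j l g r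

  module Diagonal (n : ℕ) where

    χ : ℕ → ℕ → ℕ → Carrier
    χ d j l = if does (d ℕ.<? n) then sign≤ j l else sign> j l

    χ-low : ∀ {d} j l → d < n → χ d j l ≡ sign≤ j l
    χ-low {d} j l d<n = ≡.cong (if_then sign≤ j l else sign> j l) (dec-true (d ℕ.<? n) d<n)

    χ-high : ∀ {d} j l → n ≤ d → χ d j l ≡ sign> j l
    χ-high {d} j l n≤d =
      ≡.cong (if_then sign≤ j l else sign> j l) (dec-false (d ℕ.<? n) (ℕ.≤⇒≯ n≤d))

    χ-step : ∀ d j l → χ d (suc j) l + χ d j l ≈ mono l j
    χ-step d j l with does (d ℕ.<? n)
    ... | true  = sign≤-step j l
    ... | false = sign>-step j l

    -- The recurrence of diagonal-step relates only entries with equal r + j.  Its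
    -- diagonals r + j < n are solved from r = 0, the others from r = n.
    diagonal : ℕ → ℕ → (ℕ → Carrier) → ℕ → Carrier
    diagonal j l g r = χ (r ℕ.+ j) j l * shifts l g (r ℕ.+ j)

    -- Along r + j = d the right-hand side is nonzero only at j = l, where it is `g (d - l)`. The
    -- solution is therefore that number times a Green function in `j`.
    diagonal-step : ∀ j l g → j < n → ∀ r →
      shift (diagonal (suc j) l g) r + diagonal j l g r ≈ mono l j * g r
    -- For r = 0 the diagonal is numbered by `j` itself, so `j<n` selects `sign≤`. For j < l the
    -- shift vanishes and for j > l the sign does; only j = l remains.
    diagonal-step j l g j<n zero = trans (+-identityˡ _)
      (trans (*-congʳ (reflexive (χ-low j l j<n))) (sign≤-shifts j l g))
    diagonal-step j l g j<n (suc r) rewrite ℕ.+-suc r j = begin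
      χ d (suc j) l * shifts l g d + χ d j l * shifts l g d  ≈⟨ distribʳ _ _ _ ⟨
      (χ d (suc j) l + χ d j l) * shifts l g d               ≈⟨ *-congʳ (χ-step d j l) ⟩
      mono l j * shifts l g (suc r ℕ.+ j)                    ≈⟨ mono-shifts j l g (suc r) ⟩
      mono l j * g (suc r)                                   ∎
      where d = suc r ℕ.+ j

    -- This is the boundary condition that a form of degree n - 1 has no Sⁿ term. The shifted index
    -- exceeds the degree of `g` if l < j, and `sign>` vanishes otherwise.
    diagonal-top : ∀ j l g → Degree≤ n g → diagonal j l g n ≈ 0#
    diagonal-top j l g g≤n with l ℕ.<? j
    ... | yes l<j = trans (*-congˡ (degree-shifts l g≤n (n ℕ.+ j) (ℕ.+-monoʳ-< n l<j))) (zeroʳ _)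
    ... | no  l≮j = trans
      (*-congʳ (trans (reflexive (χ-high j l (ℕ.m≤m+n n j))) (sign>-zero (ℕ.≮⇒≥ l≮j))))
      (zeroˡ _)

  -- Division of Q (g₀ yⁿ + … + gₙ xⁿ) by y + q x.
  hom-divide : ∀ q Q g b x y m →
    (∀ r → r ≤ m → b (suc r) + q * b r ≈ Q * g (suc r)) →
    (y + q * x) * hom x y m b ≈
      Q * hom x y (suc m) g + y ^ suc m * (b 0 - Q * g 0) - x ^ suc m * b (suc m)
  hom-divide q Q g b x y zero step = begin
    (y + q * x) * b 0
      ≈⟨ solve 6 (λ q x y b₀ b₁ g₀ → (y :+ q :* x) :* b₀ :=
           y :* b₀ :+ (b₁ :+ q :* b₀) :* x :- x :* b₁) refl q x y (b 0) (b 1) (g 0) ⟩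
    y * b 0 + (b 1 + q * b 0) * x - x * b 1
      ≈⟨ +-congʳ (+-congˡ (*-congʳ (step 0 z≤n))) ⟩
    y * b 0 + (Q * g 1) * x - x * b 1
      ≈⟨ solve 7 (λ Q x y b₀ b₁ g₀ g₁ → y :* b₀ :+ Q :* g₁ :* x :- x :* b₁ :=
           Q :* (y :* g₀ :+ g₁ :* (x :* 𝟙)) :+ y :* 𝟙 :* (b₀ :- Q :* g₀) :- x :* 𝟙 :* b₁)
           refl Q x y (b 0) (b 1) (g 0) (g 1) ⟩
    Q * hom x y 1 g + y ^ 1 * (b 0 - Q * g 0) - x ^ 1 * b 1 ∎
  hom-divide q Q g b x y (suc m) step = begin
    (y + q * x) * (y * h + b₁ * xᵐ)
      ≈⟨ solve 6 (λ q x y h b₁ xᵐ → (y :+ q :* x) :* (y :* h :+ b₁ :* xᵐ) :=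
           y :* ((y :+ q :* x) :* h) :+ (y :+ q :* x) :* (b₁ :* xᵐ)) refl q x y h b₁ xᵐ ⟩
    y * ((y + q * x) * h) + (y + q * x) * (b₁ * xᵐ)
      ≈⟨ +-congʳ (*-congˡ (hom-divide q Q g b x y m λ r r≤m → step r (ℕ.m≤n⇒m≤1+n r≤m))) ⟩
    y * (Q * k + yᵐ * z - xᵐ * b₁) + (y + q * x) * (b₁ * xᵐ)
      ≈⟨ solve 10 (λ q Q x y k yᵐ z xᵐ b₁ b₂ →
           y :* (Q :* k :+ yᵐ :* z :- xᵐ :* b₁) :+ (y :+ q :* x) :* (b₁ :* xᵐ) :=
           Q :* (y :* k) :+ (b₂ :+ q :* b₁) :* (x :* xᵐ) :+ y :* yᵐ :* z :- x :* xᵐ :* b₂)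
           refl q Q x y k yᵐ z xᵐ b₁ b₂ ⟩
    Q * (y * k) + (b₂ + q * b₁) * (x * xᵐ) + y * yᵐ * z - x * xᵐ * b₂
      ≈⟨ +-congʳ (+-congʳ (+-congˡ (*-congʳ (step (suc m) ℕ.≤-refl)))) ⟩
    Q * (y * k) + Q * g₂ * (x * xᵐ) + y * yᵐ * z - x * xᵐ * b₂
      ≈⟨ +-congʳ (+-congʳ (solve 4 (λ Q a b c → Q :* a :+ Q :* b :* c := Q :* (a :+ b :* c))
           refl Q (y * k) g₂ (x * xᵐ))) ⟩
    Q * (y * k + g₂ * (x * xᵐ)) + y * yᵐ * z - x * xᵐ * b₂ ∎
    where
    h  = hom x y m b
    k  = hom x y (suc m) g
    xᵐ = x ^ suc m
    yᵐ = y ^ suc m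
    b₁ = b (suc m)
    b₂ = b (suc (suc m))
    g₂ = g (suc (suc m))
    z  = b 0 - Q * g 0

  -- The sum is the convolution of `g` with the powers of `- q`. Since r < n, the cut-off at `n`
  -- loses no term with l ≤ r.
  bottom-sum : ∀ n q g r → r < n →
    ∑< n (λ l → q ^ l * (sign≤ 0 l * shifts l g r)) ≈ hom 1# (- q) r g
  bottom-sum (suc n) q g zero _ = begin
    ∑< (suc n) (λ l → q ^ l * (sign≤ 0 l * shifts l g 0))
      ≈⟨ ∑<-head n _ ⟩
    1# * (1# * g 0) + ∑< n (λ l → q * q ^ l * (- 1# * sign≤ 0 l * 0#))
      ≈⟨ +-cong (trans (*-identityˡ _) (*-identityˡ _))
                (∑<-cong n λ l _ → solve 2 (λ x y → x :* (y :* 𝟘) := 𝟘) refl _ _) ⟩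
    g 0 + ∑< n (λ _ → 0#)  ≈⟨ +-congˡ (∑<-zero n) ⟩
    g 0 + 0#               ≈⟨ +-identityʳ _ ⟩
    g 0                    ∎
  bottom-sum (suc n) q g (suc r) (s≤s r<n) = begin
    ∑< (suc n) (λ l → q ^ l * (sign≤ 0 l * shifts l g (suc r)))
      ≈⟨ ∑<-head n _ ⟩
    1# * (1# * g (suc r)) + ∑< n (λ l → q * q ^ l * (- 1# * sign≤ 0 l * shifts l g r))
      ≈⟨ +-congˡ (∑<-cong n λ l _ → solve 4 (λ q x y z →
           q :* x :* (:- 𝟙 :* y :* z) := :- q :* (x :* (y :* z))) refl q (q ^ l) (sign≤ 0 l) (shifts l g r)) ⟩
    1# * (1# * g (suc r)) + ∑< n (λ l → - q * (q ^ l * (sign≤ 0 l * shifts l g r)))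
      ≈⟨ +-congˡ (∑<-distribˡ n (- q) _) ⟨
    1# * (1# * g (suc r)) + - q * ∑< n (λ l → q ^ l * (sign≤ 0 l * shifts l g r))
      ≈⟨ +-cong (trans (*-identityˡ _) (*-comm _ _)) (*-congˡ (bottom-sum n q g r r<n)) ⟩
    g (suc r) * 1# + - q * hom 1# (- q) r g
      ≈⟨ +-comm _ _ ⟩
    - q * hom 1# (- q) r g + g (suc r) * 1#
      ≈⟨ +-congˡ (*-congˡ (1^n≈1 (suc r))) ⟨
    hom 1# (- q) (suc r) g ∎

  -- The coefficients of the corner block with j = n. The range, the sign and the offset share one
  -- `n`, independent of the degree of `g`, which permits induction on it.
  top-sum : ℕ → Carrier → (ℕ → Carrier) → ℕ → Carrier
  top-sum n q g r = ∑< n (λ l → q ^ l * (sign> n l * shifts l g (r ℕ.+ n)))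

  top-sum-suc : ∀ n q g r →
    top-sum (suc n) q g r ≈ (- 1#) ^ n * g (suc (r ℕ.+ n)) + q * top-sum n q g r
  top-sum-suc n q g r rewrite ℕ.+-suc r n = begin
    ∑< (suc n) (λ l → q ^ l * (sign> (suc n) l * shifts l g (suc (r ℕ.+ n))))
      ≈⟨ ∑<-head n _ ⟩
    1# * ((- 1#) ^ n * g (suc (r ℕ.+ n))) + ∑< n (λ l → q * q ^ l * (sign> n l * shifts l g (r ℕ.+ n)))
      ≈⟨ +-cong (*-identityˡ _) (∑<-cong n λ l _ → *-assoc _ _ _) ⟩
    (- 1#) ^ n * g (suc (r ℕ.+ n)) + ∑< n (λ l → q * (q ^ l * (sign> n l * shifts l g (r ℕ.+ n))))
      ≈⟨ +-congˡ (∑<-distribˡ n q _) ⟨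
    (- 1#) ^ n * g (suc (r ℕ.+ n)) + q * top-sum n q g r ∎

  -- This is the recurrence needed for `hom-divide` with Q = qⁿ, up to a last term that lies beyond
  -- the degree of `g` in the application.
  top-sum-step : ∀ n q g r →
    top-sum n q g (suc r) + q * top-sum n q g r ≈
      q ^ n * g (suc r) - (- 1#) ^ n * g (suc r ℕ.+ n)
  top-sum-step zero q g r = begin
    top-sum 0 q g (suc r) + q * top-sum 0 q g r
      ≈⟨ +-cong (∑<-empty _) (*-congˡ (∑<-empty _)) ⟩
    0# + q * 0#
      ≈⟨ solve 2 (λ q x → 𝟘 :+ q :* 𝟘 := 𝟙 :* x :- 𝟙 :* x) refl q (g (suc r)) ⟩
    1# * g (suc r) - 1# * g (suc r)
      ≡⟨ ≡.cong (λ i → 1# * g (suc r) - 1# * g (suc i)) (≡.sym (ℕ.+-identityʳ r)) ⟩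
    1# * g (suc r) - 1# * g (suc r ℕ.+ 0) ∎
  top-sum-step (suc n) q g r = begin
    top-sum (suc n) q g (suc r) + q * top-sum (suc n) q g r
      ≈⟨ +-cong (top-sum-suc n q g (suc r)) (*-congˡ (top-sum-suc n q g r)) ⟩
    e * x + q * b + q * (e * y + q * a)
      ≈⟨ solve 6 (λ e x q a b y → e :* x :+ q :* b :+ q :* (e :* y :+ q :* a) :=
           e :* x :+ q :* (b :+ q :* a) :+ q :* (e :* y)) refl e x q a b y ⟩
    e * x + q * (b + q * a) + q * (e * y)
      ≈⟨ +-congʳ (+-congˡ (*-congˡ (top-sum-step n q g r))) ⟩
    e * x + q * (q ^ n * z - e * y) + q * (e * y)
      ≈⟨ solve 6 (λ e x q qⁿ y z → e :* x :+ q :* (qⁿ :* z :- e :* y) :+ q :* (e :* y) :=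
           q :* qⁿ :* z :- :- 𝟙 :* e :* x) refl e x q (q ^ n) y z ⟩
    q * q ^ n * z - - 1# * e * x
      ≡⟨ ≡.cong (λ i → q * q ^ n * z - - 1# * e * g (suc i)) (≡.sym (ℕ.+-suc r n)) ⟩
    q * q ^ n * z - - 1# * e * g (suc r ℕ.+ suc n) ∎
    where
    e = (- 1#) ^ n
    x = g (suc (suc (r ℕ.+ n)))
    y = g (suc (r ℕ.+ n))
    z = g (suc r)
    a = top-sum n q g r
    b = top-sum n q g (suc r)

  -- The initial defect `b 0 - Q * g 0` of `hom-divide` thus becomes minus the value of the form at
  -- (-1, q), a zero of T + qS.
  top-sum-0 : ∀ n q g → top-sum n q g 0 ≈ q ^ n * g 0 - hom (- 1#) q n g
  top-sum-0 zero q g = trans (∑<-empty _) (solve 1 (λ x → 𝟘 := 𝟙 :* x :- x) refl (g 0))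
  top-sum-0 (suc n) q g = begin
    top-sum (suc n) q g 0            ≈⟨ top-sum-suc n q g 0 ⟩
    e * x + q * top-sum n q g 0      ≈⟨ +-congˡ (*-congˡ (top-sum-0 n q g)) ⟩
    e * x + q * (q ^ n * g 0 - h)
      ≈⟨ solve 6 (λ e x q qⁿ g₀ h → e :* x :+ q :* (qⁿ :* g₀ :- h) :=
           q :* qⁿ :* g₀ :- (q :* h :+ x :* (:- 𝟙 :* e))) refl e x q (q ^ n) (g 0) h ⟩
    q * q ^ n * g 0 - (q * h + x * (- 1# * e)) ∎
    where
    e = (- 1#) ^ n
    x = g (suc n)
    h = hom (- 1#) q n g

  top-sum-n : ∀ n q g → Degree≤ n g → top-sum n q g n ≈ 0#
  top-sum-n n q g g≤n = trans
    (∑<-cong n λ l l<n → trans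
      (*-congˡ (trans (*-congˡ (degree-shifts l g≤n (n ℕ.+ n) (ℕ.+-monoʳ-< n l<n))) (zeroʳ _)))
      (zeroʳ _))
    (∑<-zero n)

-- The Kasteleyn weights are 1 and α = ia, and δ = 1/(1 + a²).
record Parameter {c ℓ} (R : CommutativeRing c ℓ) : Set (c ⊔ ℓ) where
  open CommutativeRing R
  field
    α δ       : Carrier
    [1-α²]δ≈1 : (1# - α * α) * δ ≈ 1#

-- Explicit entries of the right inverse and closed forms of its corner blocks

module InverseEntries {c ℓ} (R : CommutativeRing c ℓ) (P : Parameter R) where

  open CommutativeRing R hiding (zero)
  open Parameter P
  open IntegerCoefficients R
  open RangeSums R
  open Polynomials R
  open Columns R
  open import Algebra.Properties.Semiring.Exp semiring using (_^_)
  open import Relation.Binary.Reasoning.Setoid setoid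

  open Substitution α 1# 1# α

  -- The coefficients of δⁿ (S - αT)ⁿ⁻ᵏ (T - αS)ᵏ, which is uᵏ at S = s, T = t.
  basis : ℕ → ℕ → ℕ → Carrier
  basis zero    k       = mono 0
  basis (suc n) zero    = lin δ (- (α * δ)) (basis n zero)
  basis (suc n) (suc k) = lin (- (α * δ)) δ (basis n k)

  degree-basis : ∀ n k → Degree≤ n (basis n k)
  degree-basis zero    k       = degree-mono 0
  degree-basis (suc n) zero    = degree-lin _ _ (degree-basis n zero)
  degree-basis (suc n) (suc k) = degree-lin _ _ (degree-basis n k)

  basis-top : ∀ n k → basis n k (suc n) ≈ 0#
  basis-top n k = degree-basis n k (suc n) ℕ.≤-refl

  private
    -- With `zero-coefficient`, this computes δ(s - αt) and δ(t - αs) as polynomials in u: they are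
    -- 1 and u because (1 - α²)δ = 1.
    unit-coefficient : (1# - α * α) * δ ≈ - (α * δ) * α + δ * 1#
    unit-coefficient = solve 2 (λ α δ → (𝟙 :- α :* α) :* δ := :- (α :* δ) :* α :+ δ :* 𝟙) refl α δ

    zero-coefficient : δ * α + - (α * δ) * 1# ≈ 0#
    zero-coefficient = solve 2 (λ α δ → δ :* α :+ :- (α :* δ) :* 𝟙 := 𝟘) refl α δ

  subst-basis : ∀ n k → k ≤ n → subst n (basis n k) ≋ mono k
  subst-basis zero zero z≤n i = *-identityˡ _
  subst-basis (suc n) zero k≤n i = begin
    subst (suc n) (basis (suc n) zero) i
      ≈⟨ subst-lin n _ _ (basis n zero) (basis-top n zero) i ⟩
    lin (δ * α + - (α * δ) * 1#) (δ * 1# + - (α * δ) * α) (subst n (basis n zero)) i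
      ≈⟨ lin-cong zero-coefficient
           (trans (+-comm _ _) (trans (sym unit-coefficient) [1-α²]δ≈1)) (subst-basis n zero z≤n) i ⟩
    lin 0# 1# (mono 0) i
      ≈⟨ trans (+-cong (zeroˡ _) (*-identityˡ _)) (+-identityˡ _) ⟩
    mono 0 i ∎
  subst-basis (suc n) (suc k) (s≤s k≤n) i = begin
    subst (suc n) (basis (suc n) (suc k)) i
      ≈⟨ subst-lin n _ _ (basis n k) (basis-top n k) i ⟩
    lin (- (α * δ) * α + δ * 1#) (- (α * δ) * 1# + δ * α) (subst n (basis n k)) i
      ≈⟨ lin-cong (trans (sym unit-coefficient) [1-α²]δ≈1)
           (trans (+-comm _ _) zero-coefficient) (subst-basis n k k≤n) i ⟩
    lin 1# 0# (mono k) i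
      ≈⟨ trans (+-cong (*-identityˡ _) (zeroˡ _)) (+-identityʳ _) ⟩
    shift (mono k) i ∎

  module _ (x y : Carrier) where

    -- Substituting the constant polynomials `x` and `y` makes the constant coefficient of `subst`
    -- equal to `hom x y`, so `subst-lin` transfers to values of forms.
    private module At = Substitution 0# x 0# y

    hom-lin : ∀ n a b c → c (suc n) ≈ 0# →
      hom x y (suc n) (lin a b c) ≈ (a * x + b * y) * hom x y n c
    hom-lin n a b c c≈0 = begin
      hom x y (suc n) (lin a b c)
        ≈⟨ At.subst-at-0 (suc n) (lin a b c) ⟨
      At.subst (suc n) (lin a b c) 0
        ≈⟨ At.subst-lin n a b c c≈0 0 ⟩
      (a * 0# + b * 0#) * 0# + (a * x + b * y) * At.subst n c 0
        ≈⟨ +-cong (zeroʳ _) (*-congˡ (At.subst-at-0 n c)) ⟩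
      0# + (a * x + b * y) * hom x y n c
        ≈⟨ +-identityˡ _ ⟩
      (a * x + b * y) * hom x y n c ∎

    -- For k = 0, and likewise for k = n, only one of the two kinds of linear factor occurs, so the
    -- value is a single n-th power. For intermediate k it would be a mixed product.
    hom-basis-0 : ∀ n → hom x y n (basis n 0) ≈ (δ * (x - α * y)) ^ n
    hom-basis-0 zero    = refl
    hom-basis-0 (suc n) = trans (hom-lin n _ _ (basis n 0) (basis-top n 0))
      (*-cong (solve 4 (λ α δ x y → δ :* x :+ :- (α :* δ) :* y := δ :* (x :- α :* y)) refl α δ x y)
              (hom-basis-0 n))

    hom-basis-n : ∀ n → hom x y n (basis n n) ≈ (δ * (y - α * x)) ^ n
    hom-basis-n zero    = refl
    hom-basis-n (suc n) = trans (hom-lin n _ _ (basis n n) (basis-top n n))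
      (*-cong (solve 4 (λ α δ x y → :- (α :* δ) :* x :+ δ :* y := δ :* (y :- α :* x)) refl α δ x y)
              (hom-basis-n n))

  hom-basis : ∀ n k u → k ≤ n → hom (α * u + 1#) (1# * u + α) n (basis n k) ≈ u ^ k
  hom-basis n k u k≤n = begin
    hom (α * u + 1#) (1# * u + α) n (basis n k)  ≈⟨ eval-subst n (basis n k) u ⟨
    eval (suc n) u (subst n (basis n k))
      ≈⟨ ∑<-cong (suc n) (λ i _ → *-congʳ (subst-basis n k k≤n i)) ⟩
    eval (suc n) u (mono k)                      ≈⟨ eval-mono (suc n) k u (s≤s k≤n) ⟩
    u ^ k                                        ∎

  module Size (m : ℕ) where

    n : ℕ
    n = suc m

    open Diagonal n

    entry : (i j k l : ℕ) → Carrier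
    entry i j k l = subst m (diagonal j l (basis n k)) i

    entry-degree : ∀ j k l → Degree≤ m (λ i → entry i j k l)
    entry-degree j k l = degree-subst m (diagonal j l (basis n k))

    -- Both products become forms of degree n by `subst-shift` and `subst-suc`; `diagonal-step`
    -- compares their coefficients, and `subst-basis` turns the form on the right into uᵏ.
    -- `diagonal-top` is what allows `subst-suc`.
    entry-row : ∀ j k l → j < n → k ≤ n → ∀ i →
      lin α 1# (λ i → entry i (suc j) k l) i + lin 1# α (λ i → entry i j k l) i ≈ mono l j * mono k i
    entry-row j k l j<n k≤n i = begin
      X (subst m d′) i + Y (subst m d) i
        ≈⟨ +-cong (sym (subst-shift m d′ i))
             (sym (subst-suc m d (diagonal-top j l (basis n k) (degree-basis n k)) i)) ⟩
      subst n (shift d′) i + subst n d i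
        ≈⟨ +-cong (*-identityˡ _) (*-identityˡ _) ⟨
      1# * subst n (shift d′) i + 1# * subst n d i
        ≈⟨ subst-linear n 1# 1# (shift d′) d i ⟨
      subst n (λ r → 1# * shift d′ r + 1# * d r) i
        ≈⟨ subst-cong n (λ r _ → trans (+-cong (*-identityˡ _) (*-identityˡ _))
             (trans (diagonal-step j l (basis n k) j<n r) (sym (trans (+-congˡ (zeroˡ _)) (+-identityʳ _))))) i ⟩
      subst n (λ r → mono l j * basis n k r + 0# * basis n k r) i
        ≈⟨ subst-linear n (mono l j) 0# (basis n k) (basis n k) i ⟩
      mono l j * subst n (basis n k) i + 0# * subst n (basis n k) i
        ≈⟨ trans (+-congˡ (zeroˡ _)) (+-identityʳ _) ⟩
      mono l j * subst n (basis n k) i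
        ≈⟨ *-congˡ (subst-basis n k k≤n i) ⟩
      mono l j * mono k i ∎
      where
      d  = diagonal j l (basis n k)
      d′ = diagonal (suc j) l (basis n k)

    module _ (u : Carrier) where

      s t : Carrier
      s = α * u + 1#
      t = 1# * u + α

      row-sum : ℕ → ℕ → ℕ → Carrier
      row-sum j k l = eval n u (λ i → entry i j k l)

      row-sum-step : ∀ j k l → j < n → k ≤ n →
        s * row-sum (suc j) k l + t * row-sum j k l ≈ mono l j * u ^ k
      row-sum-step j k l j<n k≤n = begin
        s * row-sum (suc j) k l + t * row-sum j k l
          ≈⟨ +-cong (eval-lin n u α 1# _ (entry-degree (suc j) k l n ℕ.≤-refl))
                    (eval-lin n u 1# α _ (entry-degree j k l n ℕ.≤-refl)) ⟨
        eval (suc n) u p + eval (suc n) u q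
          ≈⟨ ∑<-distrib-+ (suc n) _ _ ⟨
        ∑< (suc n) (λ i → p i * u ^ i + q i * u ^ i)
          ≈⟨ ∑<-cong (suc n) (λ i _ → trans (sym (distribʳ _ _ _))
               (trans (*-congʳ (entry-row j k l j<n k≤n i)) (*-assoc _ _ _))) ⟩
        ∑< (suc n) (λ i → mono l j * (mono k i * u ^ i))
          ≈⟨ ∑<-distribˡ (suc n) (mono l j) _ ⟨
        mono l j * eval (suc n) u (mono k)
          ≈⟨ *-congˡ (eval-mono (suc n) k u (s≤s k≤n)) ⟩
        mono l j * u ^ k ∎
        where
        p = lin α 1# (λ i → entry i (suc j) k l)
        q = lin 1# α (λ i → entry i j k l)

      -- By `∑-recurrence`, interior rows contribute only through the column equation, whose
      -- right-hand side lives in the single row j = l. What is left unknown are the two boundary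
      -- rows.
      white-sum : ∀ v k l → k ≤ n → l < n →
        (s + v * t) * ∑< (suc n) (λ j → row-sum j k l * v ^ j) ≈
          s * row-sum 0 k l + v ^ suc n * t * row-sum n k l + v ^ suc l * u ^ k
      white-sum v k l k≤n l<n = trans (∑-recurrence n s t v (λ j → row-sum j k l)) (+-congˡ (begin
        ∑< n (λ j → v ^ suc j * (s * row-sum (suc j) k l + t * row-sum j k l))
          ≈⟨ ∑<-cong n (λ j j<n → trans (*-congˡ (row-sum-step j k l j<n k≤n))
               (solve 4 (λ v vʲ e uᵏ → v :* vʲ :* (e :* uᵏ) := v :* uᵏ :* (e :* vʲ))
                  refl v (v ^ j) (mono l j) (u ^ k))) ⟩
        ∑< n (λ j → v * u ^ k * (mono l j * v ^ j))
          ≈⟨ ∑<-distribˡ n _ _ ⟨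
        v * u ^ k * eval n v (mono l)
          ≈⟨ *-congˡ (eval-mono n l v l<n) ⟩
        v * u ^ k * v ^ l
          ≈⟨ solve 3 (λ v uᵏ vˡ → v :* uᵏ :* vˡ := v :* vˡ :* uᵏ) refl v (u ^ k) (v ^ l) ⟩
        v ^ suc l * u ^ k ∎))

      -- Only j and k in {0, n} matter: these are the four corner blocks.
      corner : ℕ → ℕ → Carrier → Carrier
      corner j k q = ∑< n (λ l → q ^ l * row-sum j k l)

      -- Substitution is linear in the coefficients, so the sum over `l` can be carried out
      -- coefficientwise before `s` and `t` are inserted.
      corner-hom : ∀ j k q →
        corner j k q ≈ hom s t m (λ r → ∑< n (λ l → q ^ l * diagonal j l (basis n k) r))
      corner-hom j k q = begin
        ∑< n (λ l → q ^ l * row-sum j k l)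
          ≈⟨ ∑<-cong n (λ l _ → ∑<-distribˡ n (q ^ l) _) ⟩
        ∑< n (λ l → ∑< n (λ i → q ^ l * (entry i j k l * u ^ i)))
          ≈⟨ ∑<-comm n n _ ⟩
        ∑< n (λ i → ∑< n (λ l → q ^ l * (entry i j k l * u ^ i)))
          ≈⟨ ∑<-cong n (λ i _ → trans
               (∑<-cong n λ l _ → solve 3 (λ x y z → x :* (y :* z) := z :* (x :* y)) refl _ _ _)
               (trans (sym (∑<-distribˡ n (u ^ i) _)) (*-comm _ _))) ⟩
        eval n u (λ i → ∑< n (λ l → q ^ l * entry i j k l))
          ≈⟨ ∑<-cong n (λ i _ → *-congʳ (subst-∑ m n (q ^_) (λ l → diagonal j l (basis n k)) i)) ⟨
        eval n u (subst m (λ r → ∑< n (λ l → q ^ l * diagonal j l (basis n k) r)))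
          ≈⟨ eval-subst m _ u ⟩
        hom s t m (λ r → ∑< n (λ l → q ^ l * diagonal j l (basis n k) r)) ∎

      -- A remainder theorem: modulo t + qs one has t ≡ -qs, so the form G satisfies G(s, t) ≡ sⁿ
      -- G(1, -q). All diagonals with j = 0 and r ≤ m are numbered below n, which makes every sign a
      -- `sign≤`.
      bottom-corner : ∀ k q → k ≤ n →
        (t + q * s) * corner 0 k q ≈ u ^ k - s ^ n * hom 1# (- q) n (basis n k)
      bottom-corner k q k≤n = begin
        (t + q * s) * corner 0 k q
          ≈⟨ *-congˡ (trans (corner-hom 0 k q) (hom-cong s t m λ r r≤m →
               trans (∑<-cong n λ l _ → *-congˡ (low r r≤m l)) (bottom-sum n q g r (s≤s r≤m)))) ⟩
        (t + q * s) * hom s t m (λ r → hom 1# (- q) r g)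
          ≈⟨ hom-divide q 1# g (λ r → hom 1# (- q) r g) s t m (λ r _ → begin
               - q * hom 1# (- q) r g + g (suc r) * 1# ^ suc r + q * hom 1# (- q) r g
                 ≈⟨ +-congʳ (+-congˡ (*-congˡ (1^n≈1 (suc r)))) ⟩
               - q * hom 1# (- q) r g + g (suc r) * 1# + q * hom 1# (- q) r g
                 ≈⟨ solve 3 (λ q h g → :- q :* h :+ g :* 𝟙 :+ q :* h := 𝟙 :* g) refl q _ (g (suc r)) ⟩
               1# * g (suc r) ∎) ⟩
        1# * hom s t n g + t ^ n * (g 0 - 1# * g 0) - s ^ n * hom 1# (- q) n g
          ≈⟨ solve 4 (λ h x g₀ y → 𝟙 :* h :+ x :* (g₀ :- 𝟙 :* g₀) :- y := h :- y) refl _ _ (g 0) _ ⟩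
        hom s t n g - s ^ n * hom 1# (- q) n g
          ≈⟨ +-congʳ (hom-basis n k u k≤n) ⟩
        u ^ k - s ^ n * hom 1# (- q) n g ∎
        where
        g = basis n k
        low : ∀ r → r ≤ m → ∀ l → diagonal 0 l g r ≈ sign≤ 0 l * shifts l g r
        low r r≤m l rewrite ℕ.+-identityʳ r = *-congʳ (reflexive (χ-low 0 l (s≤s r≤m)))

      -- The same division normalised by the other variable: qs ≡ -t gives qⁿ G(s, t) ≡ tⁿ G(-1, q).
      -- With j = n every diagonal number is at least n, so every sign is a `sign>`.
      top-corner : ∀ k q → k ≤ n →
        (t + q * s) * corner n k q ≈ q ^ n * u ^ k - t ^ n * hom (- 1#) q n (basis n k)
      top-corner k q k≤n = begin
        (t + q * s) * corner n k q
          ≈⟨ *-congˡ (trans (corner-hom n k q) (hom-cong s t m λ r r≤m →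
               ∑<-cong n λ l _ → *-congˡ (*-congʳ (reflexive (χ-high n l (ℕ.m≤n+m n r)))))) ⟩
        (t + q * s) * hom s t m (top-sum n q g)
          ≈⟨ hom-divide q (q ^ n) g (top-sum n q g) s t m (λ r _ → trans (top-sum-step n q g r)
               (trans (+-congˡ (-‿cong (trans (*-congˡ (degree-basis n k (suc r ℕ.+ n) (s≤s (ℕ.m≤n+m n r)))) (zeroʳ _))))
                      (solve 1 (λ x → x :- 𝟘 := x) refl _))) ⟩
        q ^ n * hom s t n g + t ^ n * (top-sum n q g 0 - q ^ n * g 0) - s ^ n * top-sum n q g n
          ≈⟨ +-cong (+-congˡ (*-congˡ (+-congʳ (top-sum-0 n q g))))
                    (-‿cong (*-congˡ (top-sum-n n q g (degree-basis n k)))) ⟩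
        q ^ n * hom s t n g + t ^ n * (q ^ n * g 0 - hom (- 1#) q n g - q ^ n * g 0) - s ^ n * 0#
          ≈⟨ solve 6 (λ x h y z w v → x :* h :+ y :* (z :- w :- z) :- v :* 𝟘 := x :* h :- y :* w)
               refl _ _ _ (q ^ n * g 0) _ _ ⟩
        q ^ n * hom s t n g - t ^ n * hom (- 1#) q n g
          ≈⟨ +-congʳ (*-congˡ (hom-basis n k u k≤n)) ⟩
        q ^ n * u ^ k - t ^ n * hom (- 1#) q n g ∎
        where g = basis n k

-- Sums over pairs of indices and uniqueness of inverse matrices

module DoubleSums {c ℓ} (R : CommutativeRing c ℓ) where

  open CommutativeRing R hiding (zero)
  open import Algebra.Properties.Semiring.Sum semiring
    using (sum; sum-cong-≋; *-distribˡ-sum; *-distribʳ-sum; ∑-comm; sum-replicate-zero)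
  open import Relation.Binary.Reasoning.Setoid setoid

  opaque
    ∑∑ : ∀ {m n} → (Fin m × Fin n → Carrier) → Carrier
    ∑∑ g = sum λ i → sum λ j → g (i , j)

    ∑∑-sum : ∀ {m n} (g : Fin m × Fin n → Carrier) → ∑∑ g ≈ sum λ i → sum λ j → g (i , j)
    ∑∑-sum g = refl

    ∑∑-cong : ∀ {m n} {f g : Fin m × Fin n → Carrier} → (∀ x → f x ≈ g x) → ∑∑ f ≈ ∑∑ g
    ∑∑-cong {m} {n} f≈g = sum-cong-≋ {m} λ i → sum-cong-≋ {n} λ j → f≈g (i , j)

    ∑∑-distribˡ : ∀ {m n} a (g : Fin m × Fin n → Carrier) → a * ∑∑ g ≈ ∑∑ (λ x → a * g x)
    ∑∑-distribˡ {m} {n} a g = trans (*-distribˡ-sum {m} a λ i → sum λ j → g (i , j))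
      (sum-cong-≋ {m} λ i → *-distribˡ-sum {n} a λ j → g (i , j))

    ∑∑-distribʳ : ∀ {m n} a (g : Fin m × Fin n → Carrier) → ∑∑ g * a ≈ ∑∑ (λ x → g x * a)
    ∑∑-distribʳ {m} {n} a g = trans (*-distribʳ-sum {m} a λ i → sum λ j → g (i , j))
      (sum-cong-≋ {m} λ i → *-distribʳ-sum {n} a λ j → g (i , j))

    ∑∑-swap : ∀ {m n} (g : Fin m × Fin n → Carrier) → ∑∑ g ≈ ∑∑ (λ x → g (swap x))
    ∑∑-swap g = ∑-comm λ i j → g (i , j)

    ∑-∑∑-comm : ∀ {k m n} (f : Fin k → Fin m × Fin n → Carrier) →
      sum (λ i → ∑∑ (f i)) ≈ ∑∑ (λ y → sum (λ i → f i y))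
    ∑-∑∑-comm {k} {m} {n} f = trans (∑-comm {k} {m} λ i k → sum λ l → f i (k , l))
      (sum-cong-≋ {m} λ j → ∑-comm {k} {n} λ i l → f i (j , l))

    ∑∑-comm : ∀ {k l m n} (f : Fin k × Fin l → Fin m × Fin n → Carrier) →
      ∑∑ (λ x → ∑∑ (f x)) ≈ ∑∑ (λ y → ∑∑ (λ x → f x y))
    ∑∑-comm {k} {l} f = trans (sum-cong-≋ {k} λ i → ∑-∑∑-comm {l} λ j → f (i , j))
      (∑-∑∑-comm {k} λ i y → sum {l} λ j → f (i , j) y)

  indicator : Bool → Carrier
  indicator b = if b then 1# else 0#

  ∑-indicator : ∀ {n} (g : Fin n → Carrier) k → sum (λ i → indicator (does (i Fin.≟ k)) * g i) ≈ g k
  ∑-indicator {suc n} g zero = begin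
    1# * g zero + sum (λ i → 0# * g (suc i))
      ≈⟨ +-cong (*-identityˡ _) (trans (sum-cong-≋ {n} λ i → zeroˡ _) (sum-replicate-zero n)) ⟩
    g zero + 0#  ≈⟨ +-identityʳ _ ⟩
    g zero       ∎
  ∑-indicator {suc n} g (suc k) = trans (+-cong (zeroˡ _) (∑-indicator (g ∘ suc) k)) (+-identityˡ _)

  indicator-× : ∀ {m n} (i k : Fin m) (j l : Fin n) →
    indicator (does (≡-dec Fin._≟_ Fin._≟_ (i , j) (k , l))) ≈
      indicator (does (i Fin.≟ k)) * indicator (does (j Fin.≟ l))
  indicator-× i k j l with i Fin.≟ k
  ... | yes ≡.refl = sym (*-identityˡ _)
  ... | no  _      = sym (zeroˡ _)

  indicator-swap : ∀ {m n} (x y : Fin m × Fin n) →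
    indicator (does (≡-dec Fin._≟_ Fin._≟_ (swap x) (swap y))) ≈
      indicator (does (≡-dec Fin._≟_ Fin._≟_ x y))
  indicator-swap (i , j) (k , l) = trans (indicator-× j l i k) (trans (*-comm _ _) (sym (indicator-× i k j l)))

  ∑∑-indicator : ∀ {m n} (g : Fin m × Fin n → Carrier) y →
    ∑∑ (λ x → indicator (does (≡-dec Fin._≟_ Fin._≟_ x y)) * g x) ≈ g y
  ∑∑-indicator g (k , l) = begin
    ∑∑ (λ x → indicator (does (≡-dec Fin._≟_ Fin._≟_ x (k , l))) * g x)
      ≈⟨ ∑∑-cong (λ (i , j) → trans (*-congʳ (indicator-× i k j l)) (*-assoc _ _ _)) ⟩
    ∑∑ (λ (i , j) → indicator (does (i Fin.≟ k)) * (indicator (does (j Fin.≟ l)) * g (i , j)))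
      ≈⟨ ∑∑-sum _ ⟩
    sum (λ i → sum (λ j → indicator (does (i Fin.≟ k)) * (indicator (does (j Fin.≟ l)) * g (i , j))))
      ≈⟨ sum-cong-≋ (λ i → *-distribˡ-sum (indicator (does (i Fin.≟ k)))
           (λ j → indicator (does (j Fin.≟ l)) * g (i , j))) ⟨
    sum (λ i → indicator (does (i Fin.≟ k)) * sum (λ j → indicator (does (j Fin.≟ l)) * g (i , j)))
      ≈⟨ ∑-indicator (λ i → sum (λ j → indicator (does (j Fin.≟ l)) * g (i , j))) k ⟩
    sum (λ j → indicator (does (j Fin.≟ l)) * g (k , j))
      ≈⟨ ∑-indicator (λ j → g (k , j)) l ⟩
    g (k , l) ∎

  indicator-sym : ∀ {m n} (x y : Fin m × Fin n) →
    indicator (does (≡-dec Fin._≟_ Fin._≟_ x y)) ≈ indicator (does (≡-dec Fin._≟_ Fin._≟_ y x))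
  indicator-sym x y with ≡-dec Fin._≟_ Fin._≟_ x y | ≡-dec Fin._≟_ Fin._≟_ y x
  ... | yes _   | yes _   = refl
  ... | no  _   | no  _   = refl
  ... | yes x≡y | no  y≢x = contradiction (≡.sym x≡y) y≢x
  ... | no  x≢y | yes y≡x = contradiction (≡.sym y≡x) x≢y

  -- The product N′MN is evaluated in its two bracketings.
  inverse-unique : ∀ {k l m n} (M : Fin m × Fin n → Fin k × Fin l → Carrier)
    (N N′ : Fin k × Fin l → Fin m × Fin n → Carrier) →
    (∀ x x′ → ∑∑ (λ y → M x y * N y x′) ≈ indicator (does (≡-dec Fin._≟_ Fin._≟_ x x′))) →
    (∀ y y′ → ∑∑ (λ x → N′ y x * M x y′) ≈ indicator (does (≡-dec Fin._≟_ Fin._≟_ y y′))) →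
    ∀ y x → N y x ≈ N′ y x
  inverse-unique M N N′ MN≈1 N′M≈1 y x = begin
    N y x
      ≈⟨ ∑∑-indicator (λ y′ → N y′ x) y ⟨
    ∑∑ (λ y′ → indicator (does (≡-dec Fin._≟_ Fin._≟_ y′ y)) * N y′ x)
      ≈⟨ ∑∑-cong (λ y′ → *-congʳ (trans (indicator-sym y′ y) (sym (N′M≈1 y y′)))) ⟩
    ∑∑ (λ y′ → ∑∑ (λ x′ → N′ y x′ * M x′ y′) * N y′ x)
      ≈⟨ ∑∑-cong (λ y′ → ∑∑-distribʳ (N y′ x) _) ⟩
    ∑∑ (λ y′ → ∑∑ (λ x′ → N′ y x′ * M x′ y′ * N y′ x))
      ≈⟨ ∑∑-comm (λ y′ x′ → N′ y x′ * M x′ y′ * N y′ x) ⟩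
    ∑∑ (λ x′ → ∑∑ (λ y′ → N′ y x′ * M x′ y′ * N y′ x))
      ≈⟨ ∑∑-cong (λ x′ → trans (∑∑-cong λ y′ → *-assoc _ _ _) (sym (∑∑-distribˡ (N′ y x′) _))) ⟩
    ∑∑ (λ x′ → N′ y x′ * ∑∑ (λ y′ → M x′ y′ * N y′ x))
      ≈⟨ ∑∑-cong (λ x′ → trans (*-congˡ (MN≈1 x′ x)) (*-comm _ _)) ⟩
    ∑∑ (λ x′ → indicator (does (≡-dec Fin._≟_ Fin._≟_ x′ x)) * N′ y x′)
      ≈⟨ ∑∑-indicator (λ x′ → N′ y x′) x ⟩
    N′ y x ∎

-- The two-sided inverse and its reflection symmetry

module KasteleynInverse {c ℓ} (R : CommutativeRing c ℓ) (P : Parameter R) (m : ℕ) where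

  open CommutativeRing R hiding (zero)
  open Parameter P
  open IntegerCoefficients R
  open RangeSums R
  open Polynomials R
  open DoubleSums R
  open InverseEntries R P
  open Size m public
  open import Algebra.Properties.Semiring.Sum semiring using (sum; sum-cong-≋)
  open import Relation.Binary.Reasoning.Setoid setoid

  -- The entry at black `(i , j)` and white `(i′ , j′)`. Neighbours with `j′ = suc j` carry the
  -- coefficients of s, those with `j′ = j` the coefficients of t.
  κ : (i j i′ j′ : ℕ) → Carrier
  κ i j i′ j′ = mono (suc j) j′ * lin α 1# (mono i′) i + mono j j′ * lin 1# α (mono i′) i

  -- Exchanging coordinates turns the black index (i, j) into the white index (j, i). The exchange
  -- fixes e₁ and sends e₂ to -e₂, so the weights are preserved.
  κ-symmetric : ∀ i j i′ j′ → κ j′ i′ j i ≈ κ i j i′ j′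
  κ-symmetric i j i′ j′ = begin
    mono (suc i′) i * (α * mono (suc j) j′ + 1# * mono j j′) + mono i′ i * (1# * mono (suc j) j′ + α * mono j j′)
      ≈⟨ solve 5 (λ α a b c d →
           a :* (α :* b :+ 𝟙 :* c) :+ d :* (𝟙 :* b :+ α :* c) :=
           b :* (α :* a :+ 𝟙 :* d) :+ c :* (𝟙 :* a :+ α :* d))
           refl α (mono (suc i′) i) (mono (suc j) j′) (mono j j′) (mono i′ i) ⟩
    mono (suc j) j′ * (α * mono (suc i′) i + 1# * mono i′ i) + mono j j′ * (1# * mono (suc i′) i + α * mono i′ i) ∎

  -- The deltas in `j′` pick out two adjacent rows; by `lin-expand` the sum over `i′` multiplies
  -- their polynomials by s and t, so the column equation results.
  κ-entry : ∀ i j k l → j < n → k ≤ n →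
    ∑< n (λ i′ → ∑< (suc n) (λ j′ → κ i j i′ j′ * entry i′ j′ k l)) ≈ mono l j * mono k i
  κ-entry i j k l j<n k≤n = begin
    ∑< n (λ i′ → ∑< (suc n) (λ j′ → κ i j i′ j′ * e i′ j′))
      ≈⟨ ∑<-cong n (λ i′ _ → column i′) ⟩
    ∑< n (λ i′ → lin α 1# (mono i′) i * e i′ (suc j) + lin 1# α (mono i′) i * e i′ j)
      ≈⟨ ∑<-distrib-+ n _ _ ⟩
    ∑< n (λ i′ → lin α 1# (mono i′) i * e i′ (suc j)) + ∑< n (λ i′ → lin 1# α (mono i′) i * e i′ j)
      ≈⟨ +-cong (lin-expand α 1# (entry-degree (suc j) k l) i) (lin-expand 1# α (entry-degree j k l) i) ⟩
    lin α 1# (λ i → e i (suc j)) i + lin 1# α (λ i → e i j) i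
      ≈⟨ entry-row j k l j<n k≤n i ⟩
    mono l j * mono k i ∎
    where
    e : ℕ → ℕ → Carrier
    e i′ j′ = entry i′ j′ k l
    column : ∀ i′ → ∑< (suc n) (λ j′ → κ i j i′ j′ * e i′ j′) ≈
      lin α 1# (mono i′) i * e i′ (suc j) + lin 1# α (mono i′) i * e i′ j
    column i′ = begin
      ∑< (suc n) (λ j′ → κ i j i′ j′ * e i′ j′)
        ≈⟨ ∑<-cong (suc n) (λ j′ _ → solve 5 (λ a b x y e →
             (a :* x :+ b :* y) :* e := a :* (x :* e) :+ b :* (y :* e))
             refl (mono (suc j) j′) (mono j j′) (lin α 1# (mono i′) i) (lin 1# α (mono i′) i) (e i′ j′)) ⟩
      ∑< (suc n) (λ j′ → mono (suc j) j′ * (lin α 1# (mono i′) i * e i′ j′)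
                       + mono j j′ * (lin 1# α (mono i′) i * e i′ j′))
        ≈⟨ ∑<-distrib-+ (suc n) _ _ ⟩
      ∑< (suc n) (λ j′ → mono (suc j) j′ * (lin α 1# (mono i′) i * e i′ j′))
        + ∑< (suc n) (λ j′ → mono j j′ * (lin 1# α (mono i′) i * e i′ j′))
        ≈⟨ +-cong (mono-sift (suc n) (λ j′ → lin α 1# (mono i′) i * e i′ j′) (suc j) (s≤s j<n))
                  (mono-sift (suc n) (λ j′ → lin 1# α (mono i′) i * e i′ j′) j (ℕ.m<n⇒m<1+n j<n)) ⟩
      lin α 1# (mono i′) i * e i′ (suc j) + lin 1# α (mono i′) i * e i′ j ∎

  kernel : Black n → White n → Carrier
  kernel (i , j) (i′ , j′) = κ (toℕ i) (toℕ j) (toℕ i′) (toℕ j′)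

  inverse : White n → Black n → Carrier
  inverse (i , j) (k , l) = entry (toℕ i) (toℕ j) (toℕ k) (toℕ l)

  mono-indicator : ∀ {N} (i k : Fin N) → mono (toℕ k) (toℕ i) ≈ indicator (does (i Fin.≟ k))
  mono-indicator zero    zero    = refl
  mono-indicator zero    (suc k) = refl
  mono-indicator (suc i) zero    = refl
  mono-indicator (suc i) (suc k) = mono-indicator i k

  kernel-inverse : ∀ x x′ → ∑∑ (λ y → kernel x y * inverse y x′) ≈ indicator (does (x ≟ᴮ x′))
  kernel-inverse x@(i , j) x′@(k , l) = begin
    ∑∑ (λ y → kernel x y * inverse y x′)
      ≈⟨ ∑∑-sum _ ⟩
    sum {n} (λ i′ → sum {suc n} (λ j′ → kernel x (i′ , j′) * inverse (i′ , j′) x′))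
      ≈⟨ sum-cong-≋ {n} (λ i′ → ∑<-sum (suc n) (λ j′ → κ (toℕ i) (toℕ j) (toℕ i′) j′ * entry (toℕ i′) j′ (toℕ k) (toℕ l))) ⟨
    sum {n} (λ i′ → ∑< (suc n) (λ j′ → κ (toℕ i) (toℕ j) (toℕ i′) j′ * entry (toℕ i′) j′ (toℕ k) (toℕ l)))
      ≈⟨ ∑<-sum n _ ⟨
    ∑< n (λ i′ → ∑< (suc n) (λ j′ → κ (toℕ i) (toℕ j) i′ j′ * entry i′ j′ (toℕ k) (toℕ l)))
      ≈⟨ κ-entry (toℕ i) (toℕ j) (toℕ k) (toℕ l) (Fin.toℕ<n j) (ℕ.s≤s⁻¹ (Fin.toℕ<n k)) ⟩
    mono (toℕ l) (toℕ j) * mono (toℕ k) (toℕ i)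
      ≈⟨ *-cong (mono-indicator j l) (mono-indicator i k) ⟩
    indicator (does (j Fin.≟ l)) * indicator (does (i Fin.≟ k))
      ≈⟨ *-comm _ _ ⟩
    indicator (does (i Fin.≟ k)) * indicator (does (j Fin.≟ l))
      ≈⟨ indicator-× i k j l ⟨
    indicator (does (x ≟ᴮ x′)) ∎

  -- The kernel equals its own reflected transpose, so after swapping the summation index this is
  -- `kernel-inverse` at the swapped vertices.
  transposed-inverse : ∀ y y′ →
    ∑∑ (λ x → inverse (swap x) (swap y) * kernel x y′) ≈ indicator (does (y ≟ᵂ y′))
  transposed-inverse y y′@(i′ , j′) = begin
    ∑∑ (λ x → inverse (swap x) (swap y) * kernel x y′)
      ≈⟨ ∑∑-cong (λ (i , j) → trans (*-comm _ _)
           (*-congʳ (sym (κ-symmetric (toℕ i) (toℕ j) (toℕ i′) (toℕ j′))))) ⟩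
    ∑∑ (λ x → kernel (swap y′) (swap x) * inverse (swap x) (swap y))
      ≈⟨ ∑∑-swap (λ x → kernel (swap y′) x * inverse x (swap y)) ⟨
    ∑∑ (λ x → kernel (swap y′) x * inverse x (swap y))
      ≈⟨ kernel-inverse (swap y′) (swap y) ⟩
    indicator (does (swap y′ ≟ᴮ swap y))
      ≈⟨ indicator-swap y′ y ⟩
    indicator (does (y′ ≟ᵂ y))
      ≈⟨ indicator-sym y′ y ⟩
    indicator (does (y ≟ᵂ y′)) ∎

  inverse-symmetric : ∀ y x → inverse y x ≈ inverse (swap x) (swap y)
  inverse-symmetric = inverse-unique kernel inverse (λ y x → inverse (swap x) (swap y))
    kernel-inverse transposed-inverse

  inverse-kernel : ∀ y y′ → ∑∑ (λ x → inverse y x * kernel x y′) ≈ indicator (does (y ≟ᵂ y′))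
  inverse-kernel y y′ = trans (∑∑-cong λ x → *-congʳ (inverse-symmetric y x)) (transposed-inverse y y′)

  -- Uniqueness of the inverse concerns matrices indexed by vertices; the bounds say that the
  -- natural numbers name vertices, which brings the symmetry down to `entry`.
  entry-symmetric : ∀ {i j k l} → i < n → j ≤ n → k ≤ n → l < n → entry i j k l ≈ entry l k j i
  entry-symmetric {i} {j} {k} {l} i<n j≤n k≤n l<n
    = trans (reflexive (≡.sym (entry-fromℕ< i<n (s≤s j≤n) (s≤s k≤n) l<n)))
      (trans (inverse-symmetric (fromℕ< i<n , fromℕ< (s≤s j≤n)) (fromℕ< (s≤s k≤n) , fromℕ< l<n))
             (reflexive (entry-fromℕ< l<n (s≤s k≤n) (s≤s j≤n) i<n)))
    where
    cong₄ : ∀ {i i′ j j′ k k′ l l′} → i ≡ i′ → j ≡ j′ → k ≡ k′ → l ≡ l′ →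
      entry i j k l ≡ entry i′ j′ k′ l′
    cong₄ ≡.refl ≡.refl ≡.refl ≡.refl = ≡.refl
    entry-fromℕ< : ∀ {i j k l} (i<n : i < n) (j<n : j < suc n) (k<n : k < suc n) (l<n : l < n) →
      inverse (fromℕ< i<n , fromℕ< j<n) (fromℕ< k<n , fromℕ< l<n) ≡ entry i j k l
    entry-fromℕ< i<n j<n k<n l<n =
      cong₄ (Fin.toℕ-fromℕ< i<n) (Fin.toℕ-fromℕ< j<n) (Fin.toℕ-fromℕ< k<n) (Fin.toℕ-fromℕ< l<n)

-- Reduction of the generating function to the corner blocks

module GeneratingFunction {c ℓ} (R : CommutativeRing c ℓ) (P : Parameter R) (m : ℕ) where

  open CommutativeRing R hiding (zero)
  open Parameter P
  open IntegerCoefficients R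
  open RangeSums R
  open Polynomials R using (1^n≈1)
  open InverseEntries R P using (hom-basis-0; hom-basis-n)
  open KasteleynInverse R P m public
  open import Algebra.Properties.CommutativeSemiring.Exp commutativeSemiring
    using (_^_; ^-congˡ; ^-distrib-*)
  open import Relation.Binary.Reasoning.Setoid setoid

  geometric : ℕ → Carrier → Carrier
  geometric n x = ∑< n (x ^_)

  geometric-sum : ∀ n x → (1# - x) * geometric n x ≈ 1# - x ^ n
  geometric-sum n x = begin
    (1# - x) * ∑< n (x ^_)              ≈⟨ ∑<-distribˡ n (1# - x) (x ^_) ⟩
    ∑< n (λ i → (1# - x) * x ^ i)
      ≈⟨ ∑<-cong n (λ i _ → solve 2 (λ x y → (𝟙 :- x) :* y := y :- x :* y) refl x (x ^ i)) ⟩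
    ∑< n (λ i → x ^ i - x ^ suc i)      ≈⟨ ∑<-telescope n (x ^_) ⟩
    1# - x ^ n                          ∎

  ∑ᴮ< : (ℕ → ℕ → Carrier) → Carrier
  ∑ᴮ< f = ∑< (suc n) (λ k → ∑< n (f k))

  ∑ᴮ<-cong : ∀ {f g} → (∀ k l → k ≤ n → l < n → f k l ≈ g k l) → ∑ᴮ< f ≈ ∑ᴮ< g
  ∑ᴮ<-cong f≈g = ∑<-cong (suc n) λ k k≤n → ∑<-cong n λ l l<n → f≈g k l (ℕ.s≤s⁻¹ k≤n) l<n

  ∑ᴮ<-distrib-+ : ∀ f g → ∑ᴮ< (λ k l → f k l + g k l) ≈ ∑ᴮ< f + ∑ᴮ< g
  ∑ᴮ<-distrib-+ f g = trans (∑<-cong (suc n) λ k _ → ∑<-distrib-+ n (f k) (g k)) (∑<-distrib-+ (suc n) _ _)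

  ∑ᴮ<-distribˡ : ∀ x f → x * ∑ᴮ< f ≈ ∑ᴮ< (λ k l → x * f k l)
  ∑ᴮ<-distribˡ x f = trans (∑<-distribˡ (suc n) x _) (∑<-cong (suc n) λ k _ → ∑<-distribˡ n x (f k))

  ∑ᴮ<-product : ∀ f g → ∑< (suc n) f * ∑< n g ≈ ∑ᴮ< (λ k l → f k * g l)
  ∑ᴮ<-product f g = begin
    ∑< (suc n) f * ∑< n g                       ≈⟨ *-comm _ _ ⟩
    ∑< n g * ∑< (suc n) f                       ≈⟨ ∑<-distribˡ (suc n) _ f ⟩
    ∑< (suc n) (λ k → ∑< n g * f k)
      ≈⟨ ∑<-cong (suc n) (λ k _ → trans (*-comm _ _) (∑<-distribˡ n (f k) g)) ⟩
    ∑ᴮ< (λ k l → f k * g l)                     ∎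

  module _ (u v p q : Carrier) where

    generating : Carrier
    generating = ∑ᴮ< (λ k l → p ^ k * q ^ l * ∑< (suc n) (λ j → row-sum u j k l * v ^ j))

    edge : ℕ → Carrier
    edge j = ∑ᴮ< (λ k l → p ^ k * q ^ l * row-sum u j k l)

    -- Applying `white-sum` under the black sum leaves the white edges j = 0 and j = n; the source
    -- terms uᵏ vˡ separate into a product of two geometric sums.
    generating-edges :
      (s u + v * t u) * generating ≈
        s u * edge 0 + v ^ suc n * t u * edge n + v * (geometric (suc n) (u * p) * geometric n (v * q))
    generating-edges = begin
      (s u + v * t u) * generating
        ≈⟨ ∑ᴮ<-distribˡ (s u + v * t u) _ ⟩
      ∑ᴮ< (λ k l → (s u + v * t u) * (p ^ k * q ^ l * ∑< (suc n) (λ j → row-sum u j k l * v ^ j)))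
        ≈⟨ ∑ᴮ<-cong (λ k l k≤n l<n → trans
             (solve 3 (λ x y z → x :* (y :* z) := y :* (x :* z)) refl _ _ _)
             (trans (*-congˡ (white-sum u v k l k≤n l<n))
               (solve 10 (λ s a vⁿ t b v vˡ uᵏ pᵏ qˡ →
                  pᵏ :* qˡ :* (s :* a :+ vⁿ :* t :* b :+ v :* vˡ :* uᵏ) :=
                  s :* (pᵏ :* qˡ :* a) :+ vⁿ :* t :* (pᵏ :* qˡ :* b) :+ v :* ((uᵏ :* pᵏ) :* (vˡ :* qˡ)))
                  refl (s u) (row-sum u 0 k l) (v ^ suc n) (t u) (row-sum u n k l) v (v ^ l) (u ^ k) (p ^ k) (q ^ l)))) ⟩
      ∑ᴮ< (λ k l → s u * (p ^ k * q ^ l * row-sum u 0 k l)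
                   + v ^ suc n * t u * (p ^ k * q ^ l * row-sum u n k l)
                   + v * ((u ^ k * p ^ k) * (v ^ l * q ^ l)))
        ≈⟨ trans (∑ᴮ<-distrib-+ _ _) (+-congʳ (∑ᴮ<-distrib-+ _ _)) ⟩
      ∑ᴮ< (λ k l → s u * (p ^ k * q ^ l * row-sum u 0 k l))
        + ∑ᴮ< (λ k l → v ^ suc n * t u * (p ^ k * q ^ l * row-sum u n k l))
        + ∑ᴮ< (λ k l → v * ((u ^ k * p ^ k) * (v ^ l * q ^ l)))
        ≈⟨ +-cong (+-cong (∑ᴮ<-distribˡ _ _) (∑ᴮ<-distribˡ _ _)) (∑ᴮ<-distribˡ _ _) ⟨
      s u * edge 0 + v ^ suc n * t u * edge n + v * ∑ᴮ< (λ k l → (u ^ k * p ^ k) * (v ^ l * q ^ l))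
        ≈⟨ +-congˡ (*-congˡ (∑ᴮ<-product (λ k → u ^ k * p ^ k) (λ l → v ^ l * q ^ l))) ⟨
      s u * edge 0 + v ^ suc n * t u * edge n
        + v * (∑< (suc n) (λ k → u ^ k * p ^ k) * ∑< n (λ l → v ^ l * q ^ l))
        ≈⟨ +-congˡ (*-congˡ (*-cong (∑<-cong (suc n) λ k _ → ^-distrib-* u p k)
                                    (∑<-cong n λ l _ → ^-distrib-* v q l))) ⟨
      s u * edge 0 + v ^ suc n * t u * edge n + v * (geometric (suc n) (u * p) * geometric n (v * q)) ∎

    -- The symmetry of the inverse makes the black indices play the role of white ones. The column
    -- equations then apply a second time, with `q` and `p` in place of `u` and `v`.
    edge-transpose : ∀ j → j ≤ n →
      edge j ≈ ∑< n (λ i → u ^ i * ∑< (suc n) (λ k → row-sum q k j i * p ^ k))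
    edge-transpose j j≤n = begin
      ∑ᴮ< (λ k l → p ^ k * q ^ l * row-sum u j k l)
        ≈⟨ ∑ᴮ<-cong (λ k l k≤n l<n → trans (∑<-distribˡ n _ _)
             (∑<-cong n λ i i<n → *-congˡ (*-congʳ (entry-symmetric i<n j≤n k≤n l<n)))) ⟩
      ∑< (suc n) (λ k → ∑< n (λ l → ∑< n (λ i → p ^ k * q ^ l * (entry l k j i * u ^ i))))
        ≈⟨ ∑<-cong (suc n) (λ k _ → ∑<-comm n n _) ⟩
      ∑< (suc n) (λ k → ∑< n (λ i → ∑< n (λ l → p ^ k * q ^ l * (entry l k j i * u ^ i))))
        ≈⟨ ∑<-comm (suc n) n _ ⟩
      ∑< n (λ i → ∑< (suc n) (λ k → ∑< n (λ l → p ^ k * q ^ l * (entry l k j i * u ^ i))))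
        ≈⟨ ∑<-cong n (λ i _ → trans (∑<-cong (suc n) λ k _ → trans (∑<-cong n λ l _ →
             solve 4 (λ pᵏ qˡ e uⁱ → pᵏ :* qˡ :* (e :* uⁱ) := uⁱ :* pᵏ :* (e :* qˡ))
               refl (p ^ k) (q ^ l) (entry l k j i) (u ^ i))
             (trans (sym (∑<-distribˡ n (u ^ i * p ^ k) _))
               (trans (*-assoc _ _ _) (*-congˡ (*-comm _ _)))))
             (sym (∑<-distribˡ (suc n) (u ^ i) _))) ⟩
      ∑< n (λ i → u ^ i * ∑< (suc n) (λ k → row-sum q k j i * p ^ k)) ∎

    edge-corners : ∀ j → j ≤ n →
      (s q + p * t q) * edge j ≈
        s q * corner q 0 j u + p ^ suc n * t q * corner q n j u + p * (q ^ j * geometric n (u * p))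
    edge-corners j j≤n = begin
      (s q + p * t q) * edge j
        ≈⟨ *-congˡ (edge-transpose j j≤n) ⟩
      (s q + p * t q) * ∑< n (λ i → u ^ i * ∑< (suc n) (λ k → row-sum q k j i * p ^ k))
        ≈⟨ ∑<-distribˡ n _ _ ⟩
      ∑< n (λ i → (s q + p * t q) * (u ^ i * ∑< (suc n) (λ k → row-sum q k j i * p ^ k)))
        ≈⟨ ∑<-cong n (λ i i<n → trans
             (solve 3 (λ x y z → x :* (y :* z) := y :* (x :* z)) refl _ _ _)
             (trans (*-congˡ (white-sum q p j i j≤n i<n))
               (solve 9 (λ s a pⁿ t b p pⁱ qʲ uⁱ →
                  uⁱ :* (s :* a :+ pⁿ :* t :* b :+ p :* pⁱ :* qʲ) :=
                  s :* (uⁱ :* a) :+ pⁿ :* t :* (uⁱ :* b) :+ p :* qʲ :* (uⁱ :* pⁱ))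
                  refl (s q) (row-sum q 0 j i) (p ^ suc n) (t q) (row-sum q n j i) p (p ^ i) (q ^ j) (u ^ i)))) ⟩
      ∑< n (λ i → s q * (u ^ i * row-sum q 0 j i) + p ^ suc n * t q * (u ^ i * row-sum q n j i)
                  + p * q ^ j * (u ^ i * p ^ i))
        ≈⟨ trans (∑<-distrib-+ n _ _) (+-congʳ (∑<-distrib-+ n _ _)) ⟩
      ∑< n (λ i → s q * (u ^ i * row-sum q 0 j i)) + ∑< n (λ i → p ^ suc n * t q * (u ^ i * row-sum q n j i))
        + ∑< n (λ i → p * q ^ j * (u ^ i * p ^ i))
        ≈⟨ +-cong (+-cong (∑<-distribˡ n _ _) (∑<-distribˡ n _ _)) (∑<-distribˡ n _ _) ⟨
      s q * corner q 0 j u + p ^ suc n * t q * corner q n j u + p * q ^ j * ∑< n (λ i → u ^ i * p ^ i)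
        ≈⟨ +-congˡ (trans (*-assoc _ _ _) (*-congˡ (*-congˡ (∑<-cong n λ i _ → sym (^-distrib-* u p i))))) ⟩
      s q * corner q 0 j u + p ^ suc n * t q * corner q n j u + p * (q ^ j * geometric n (u * p)) ∎

  module _ (u q : Carrier) where

    E : Carrier
    E = t q + u * s q

    -- Subscripts name the white edge, then the black edge. As the edges have been transposed, these
    -- appear in the opposite order among the arguments of `corner`, and `q` is now the row
    -- variable.
    corner₀₀ : E * corner q 0 0 u ≈ 1# ^ n - (s q * (δ * (1# - α * - u))) ^ n
    corner₀₀ = trans (bottom-corner q 0 u z≤n) (+-cong (sym (1^n≈1 n))
      (-‿cong (trans (*-congˡ (hom-basis-0 1# (- u) n)) (sym (^-distrib-* (s q) _ n)))))

    corner₀ₙ : E * corner q n 0 u ≈ u ^ n - (t q * (δ * (- 1# - α * u))) ^ n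
    corner₀ₙ = trans (top-corner q 0 u z≤n) (+-cong (*-identityʳ _)
      (-‿cong (trans (*-congˡ (hom-basis-0 (- 1#) u n)) (sym (^-distrib-* (t q) _ n)))))

    cornerₙ₀ : E * corner q 0 n u ≈ q ^ n - (s q * (δ * (- u - α * 1#))) ^ n
    cornerₙ₀ = trans (bottom-corner q n u ℕ.≤-refl) (+-congˡ
      (-‿cong (trans (*-congˡ (hom-basis-n 1# (- u) n)) (sym (^-distrib-* (s q) _ n)))))

    cornerₙₙ : E * corner q n n u ≈ (u * q) ^ n - (t q * (δ * (u - α * - 1#))) ^ n
    cornerₙₙ = trans (top-corner q n u ℕ.≤-refl) (+-cong (sym (^-distrib-* u q n))
      (-‿cong (trans (*-congˡ (hom-basis-n (- 1#) u n)) (sym (^-distrib-* (t q) _ n)))))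

    private
      -- The solver knows no relation between α and δ; inserting (1 - α²)δ into the leading term
      -- makes the four denominator identities polynomial ones.
      scale : ∀ x → x ≈ x * ((1# - α * α) * δ)
      scale x = trans (sym (*-identityʳ x)) (*-congˡ (sym [1-α²]δ≈1))

    denominator₀₀ : 1# - s q * (δ * (1# - α * - u)) ≈ - (α * δ) * E
    denominator₀₀ = trans (+-congʳ (scale 1#)) (solve 4 (λ α δ u q →
        𝟙 :* ((𝟙 :- α :* α) :* δ) :- (α :* q :+ 𝟙) :* (δ :* (𝟙 :- α :* :- u)) :=
        :- (α :* δ) :* ((𝟙 :* q :+ α) :+ u :* (α :* q :+ 𝟙)))
      refl α δ u q)

    denominator₀ₙ : u - t q * (δ * (- 1# - α * u)) ≈ δ * E
    denominator₀ₙ = trans (+-congʳ (scale u)) (solve 4 (λ α δ u q →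
        u :* ((𝟙 :- α :* α) :* δ) :- (𝟙 :* q :+ α) :* (δ :* (:- 𝟙 :- α :* u)) :=
        δ :* ((𝟙 :* q :+ α) :+ u :* (α :* q :+ 𝟙)))
      refl α δ u q)

    denominatorₙ₀ : q - s q * (δ * (- u - α * 1#)) ≈ δ * E
    denominatorₙ₀ = trans (+-congʳ (scale q)) (solve 4 (λ α δ u q →
        q :* ((𝟙 :- α :* α) :* δ) :- (α :* q :+ 𝟙) :* (δ :* (:- u :- α :* 𝟙)) :=
        δ :* ((𝟙 :* q :+ α) :+ u :* (α :* q :+ 𝟙)))
      refl α δ u q)

    denominatorₙₙ : u * q - t q * (δ * (u - α * - 1#)) ≈ - (α * δ) * E
    denominatorₙₙ = trans (+-congʳ (scale (u * q))) (solve 4 (λ α δ u q →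
        u :* q :* ((𝟙 :- α :* α) :* δ) :- (𝟙 :* q :+ α) :* (δ :* (u :- α :* :- 𝟙)) :=
        :- (α :* δ) :* ((𝟙 :* q :+ α) :+ u :* (α :* q :+ 𝟙)))
      refl α δ u q)

    -- Both sides agree after multiplication by ζ (1 - T) = c E, a unit.
    corner-unique : ∀ {Y ζ ζ⁻¹ T τ r c η d} →
      (1# - T) * r ≈ 1# → ζ * ζ⁻¹ ≈ 1# → ζ * T ≈ τ → ζ - τ ≈ c * E → η * d ≈ c →
      E * Y ≈ ζ ^ n - τ ^ n → ζ ^ m * η * (d * ((1# - T ^ n) * r)) ≈ Y
    corner-unique {Y} {ζ} {ζ⁻¹} {T} {τ} {r} {c} {η} {d} Tr ζζ⁻¹ ζT ζ-τ ηd EY = begin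
      X                              ≈⟨ cancel X ⟨
      ζ⁻¹ * r * (ζ * (1# - T) * X)   ≈⟨ *-congˡ (begin
        ζ * (1# - T) * (ζ ^ m * η * (d * ((1# - T ^ n) * r)))
          ≈⟨ solve 7 (λ ζ T ζᵐ η d Tⁿ r →
               ζ :* (𝟙 :- T) :* (ζᵐ :* η :* (d :* ((𝟙 :- Tⁿ) :* r))) :=
               η :* d :* (ζ :* ζᵐ :- ζ :* ζᵐ :* Tⁿ) :* ((𝟙 :- T) :* r))
               refl ζ T (ζ ^ m) η d (T ^ n) r ⟩
        η * d * (ζ ^ n - ζ ^ n * T ^ n) * ((1# - T) * r)
          ≈⟨ *-cong (*-cong ηd (+-congˡ (-‿cong (trans (sym (^-distrib-* ζ T n)) (^-congˡ n ζT))))) Tr ⟩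
        c * (ζ ^ n - τ ^ n) * 1#
          ≈⟨ *-identityʳ _ ⟩
        c * (ζ ^ n - τ ^ n)
          ≈⟨ *-congˡ EY ⟨
        c * (E * Y)
          ≈⟨ *-assoc c E Y ⟨
        c * E * Y
          ≈⟨ *-congʳ ζ-τ ⟨
        (ζ - τ) * Y
          ≈⟨ *-congʳ (+-congˡ (-‿cong ζT)) ⟨
        (ζ - ζ * T) * Y
          ≈⟨ *-congʳ (solve 2 (λ ζ T → ζ :- ζ :* T := ζ :* (𝟙 :- T)) refl ζ T) ⟩
        ζ * (1# - T) * Y ∎) ⟩
      ζ⁻¹ * r * (ζ * (1# - T) * Y)   ≈⟨ cancel Y ⟩
      Y                              ∎
      where
      X = ζ ^ m * η * (d * ((1# - T ^ n) * r))
      cancel : ∀ x → ζ⁻¹ * r * (ζ * (1# - T) * x) ≈ x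
      cancel x = begin
        ζ⁻¹ * r * (ζ * (1# - T) * x)
          ≈⟨ solve 5 (λ ζ ζ⁻¹ T r x → ζ⁻¹ :* r :* (ζ :* (𝟙 :- T) :* x) := ζ :* ζ⁻¹ :* ((𝟙 :- T) :* r) :* x)
               refl ζ ζ⁻¹ T r x ⟩
        ζ * ζ⁻¹ * ((1# - T) * r) * x  ≈⟨ *-congʳ (*-cong ζζ⁻¹ Tr) ⟩
        1# * 1# * x                   ≈⟨ trans (*-congʳ (*-identityˡ 1#)) (*-identityˡ x) ⟩
        x                             ∎

  module _ (u v p q : Carrier) where

    -- The two reductions are combined. The factor `z` is kept inside because it supplies the odd
    -- powers of w₁ and b₂ in each F-term.
    generating-corners : ∀ z {rʷ rʷᵇ} →
      (s u + v * t u) * rʷ ≈ 1# → (s u + v * t u) * (s q + p * t q) * rʷᵇ ≈ 1# →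
      z * generating u v p q ≈
        z * (v * (geometric (suc n) (u * p) * geometric n (v * q))) * rʷ
        + s u * (s q * (z * corner q 0 0 u)
                 + p * (z * geometric n (u * p) + t q * (z * p ^ n * corner q n 0 u))) * rʷᵇ
        + t u * v * (p * (z * v ^ n * q ^ n * geometric n (u * p))
                     + s q * (z * v ^ n * corner q 0 n u)
                     + p * t q * (z * p ^ n * v ^ n * corner q n n u)) * rʷᵇ
    generating-corners z {rʷ} {rʷᵇ} rʷ-inv rʷᵇ-inv = sym (begin
      z * (v * g) * rʷ
        + S * (S′ * (z * c₀₀) + p * (z * φ + T′ * (z * Pⁿ * c₀ₙ))) * rʷᵇ
        + T * v * (p * (z * V * Q * φ) + S′ * (z * V * cₙ₀) + p * T′ * (z * Pⁿ * V * cₙₙ)) * rʷᵇ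
        ≈⟨ +-cong (solve 16 (λ z v g rʷ rʷᵇ S S′ T T′ p φ Pⁿ V Q c₀₀ c₀ₙ →
             z :* (v :* g) :* rʷ :+ S :* (S′ :* (z :* c₀₀) :+ p :* (z :* φ :+ T′ :* (z :* Pⁿ :* c₀ₙ))) :* rʷᵇ :=
             z :* (v :* g :* rʷ :+ S :* (S′ :* c₀₀ :+ p :* Pⁿ :* T′ :* c₀ₙ :+ p :* (𝟙 :* φ)) :* rʷᵇ))
             refl z v g rʷ rʷᵇ S S′ T T′ p φ Pⁿ V Q c₀₀ c₀ₙ)
           (solve 13 (λ z v rʷᵇ S′ T T′ p φ Pⁿ V Q cₙ₀ cₙₙ →
             T :* v :* (p :* (z :* V :* Q :* φ) :+ S′ :* (z :* V :* cₙ₀) :+ p :* T′ :* (z :* Pⁿ :* V :* cₙₙ)) :* rʷᵇ :=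
             z :* (v :* V :* T :* (S′ :* cₙ₀ :+ p :* Pⁿ :* T′ :* cₙₙ :+ p :* (Q :* φ)) :* rʷᵇ))
             refl z v rʷᵇ S′ T T′ p φ Pⁿ V Q cₙ₀ cₙₙ) ⟩
      z * (v * g * rʷ + S * (S′ * c₀₀ + p * Pⁿ * T′ * c₀ₙ + p * (1# * φ)) * rʷᵇ)
        + z * (v * V * T * (S′ * cₙ₀ + p * Pⁿ * T′ * cₙₙ + p * (Q * φ)) * rʷᵇ)
        ≈⟨ +-cong (*-congˡ (+-congˡ (*-congʳ (*-congˡ (edge-corners u v p q 0 z≤n)))))
                  (*-congˡ (*-congʳ (*-congˡ (edge-corners u v p q n ℕ.≤-refl)))) ⟨
      z * (v * g * rʷ + S * (Cᵇ * H₀) * rʷᵇ) + z * (v * V * T * (Cᵇ * Hₙ) * rʷᵇ)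
        ≈⟨ solve 11 (λ z v g rʷ rʷᵇ S T V Cᵇ H₀ Hₙ →
             z :* (v :* g :* rʷ :+ S :* (Cᵇ :* H₀) :* rʷᵇ) :+ z :* (v :* V :* T :* (Cᵇ :* Hₙ) :* rʷᵇ) :=
             z :* (v :* g :* rʷ :+ (S :* H₀ :+ v :* V :* T :* Hₙ) :* (Cᵇ :* rʷᵇ)))
             refl z v g rʷ rʷᵇ S T V Cᵇ H₀ Hₙ ⟩
      z * (v * g * rʷ + (S * H₀ + v * V * T * Hₙ) * (Cᵇ * rʷᵇ))
        ≈⟨ *-congˡ (+-congˡ (*-congˡ Cᵇrʷᵇ≈rʷ)) ⟩
      z * (v * g * rʷ + (S * H₀ + v * V * T * Hₙ) * rʷ)
        ≈⟨ solve 9 (λ z v g rʷ S T V H₀ Hₙ →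
             z :* (v :* g :* rʷ :+ (S :* H₀ :+ v :* V :* T :* Hₙ) :* rʷ) :=
             z :* ((S :* H₀ :+ v :* V :* T :* Hₙ :+ v :* g) :* rʷ))
             refl z v g rʷ S T V H₀ Hₙ ⟩
      z * ((S * H₀ + v * V * T * Hₙ + v * g) * rʷ)
        ≈⟨ *-congˡ (*-congʳ (generating-edges u v p q)) ⟨
      z * (Cʷ * generating u v p q * rʷ)
        ≈⟨ *-congˡ (solve 3 (λ x y z → x :* y :* z := x :* z :* y) refl Cʷ (generating u v p q) rʷ) ⟩
      z * (Cʷ * rʷ * generating u v p q)
        ≈⟨ *-congˡ (trans (*-congʳ rʷ-inv) (*-identityˡ _)) ⟩
      z * generating u v p q ∎)
      where
      g = geometric (suc n) (u * p) * geometric n (v * q)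
      φ = geometric n (u * p)
      S = s u
      T = t u
      S′ = s q
      T′ = t q
      Pⁿ = p ^ n
      V = v ^ n
      Q = q ^ n
      c₀₀ = corner q 0 0 u
      c₀ₙ = corner q n 0 u
      cₙ₀ = corner q 0 n u
      cₙₙ = corner q n n u
      H₀ = edge u v p q 0
      Hₙ = edge u v p q n
      Cʷ = s u + v * t u
      Cᵇ = s q + p * t q
      -- `rʷᵇ` inverts only the product of the two factors; multiplied by `Cᵇ` it is another inverse
      -- of `Cʷ`, hence equal to `rʷ`.
      Cᵇrʷᵇ≈rʷ : Cᵇ * rʷᵇ ≈ rʷ
      Cᵇrʷᵇ≈rʷ = begin
        Cᵇ * rʷᵇ                ≈⟨ trans (*-congˡ rʷ-inv) (*-identityʳ _) ⟨
        Cᵇ * rʷᵇ * (Cʷ * rʷ)    ≈⟨ solve 4 (λ a b c d → a :* b :* (c :* d) := c :* a :* b :* d) refl Cᵇ rʷᵇ Cʷ rʷ ⟩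
        Cʷ * Cᵇ * rʷᵇ * rʷ      ≈⟨ trans (*-congʳ rʷᵇ-inv) (*-identityˡ _) ⟩
        rʷ                      ∎

-- a⁻¹, δ and δ′ stand for 1/a, 1/(1 + a²) and 1/(1 + 1/a²).
record Weighting {c ℓ} (R : CommutativeRing c ℓ) : Set (c ⊔ ℓ) where
  open CommutativeRing R
  open Exp commutativeSemiring using (_^_)
  field
    𝕚 a a⁻¹ δ δ′  : Carrier
    𝕚²≈-1         : 𝕚 * 𝕚 ≈ - 1#
    aa⁻¹≈1        : a * a⁻¹ ≈ 1#
    [1+a²]δ≈1     : (1# + a ^ 2) * δ ≈ 1#
    [1+a⁻²]δ′≈1   : (1# + a⁻¹ ^ 2) * δ′ ≈ 1#

-- Specialisation to α = ia and identification with the F-terms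

module WeightedKasteleyn {c ℓ} (R : CommutativeRing c ℓ) (W : Weighting R) (m : ℕ) where

  open CommutativeRing R hiding (zero)
  open Weighting W
  open IntegerCoefficients R
  open Exp commutativeSemiring using (_^_; ^-distrib-*; ^-assocʳ)
  open RangeSums R
  open Polynomials R using (1^n≈1)
  open import Algebra.Properties.Semiring.Sum semiring using (sum; sum-cong-≋)
  open import Relation.Binary.Reasoning.Setoid setoid

  α : Carrier
  α = 𝕚 * a

  𝕚²+1≈0 : 𝕚 * 𝕚 + 1# ≈ 0#
  𝕚²+1≈0 = trans (+-congʳ 𝕚²≈-1) (-‿inverseˡ 1#)

  [1-α²]δ≈1 : (1# - α * α) * δ ≈ 1#
  [1-α²]δ≈1 = begin
    (1# - 𝕚 * a * (𝕚 * a)) * δ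
      -- The solver treats `𝕚` as an indeterminate, so the multiple of 𝕚² + 1 is split off and
      -- removed separately.
      ≈⟨ solve 3 (λ 𝕚 a δ → (𝟙 :- 𝕚 :* a :* (𝕚 :* a)) :* δ :=
           (𝟙 :+ a :^ 2) :* δ :- (𝕚 :* 𝕚 :+ 𝟙) :* (a :* a :* δ)) refl 𝕚 a δ ⟩
    (1# + a ^ 2) * δ - (𝕚 * 𝕚 + 1#) * (a * a * δ)
      ≈⟨ +-cong [1+a²]δ≈1 (-‿cong (*-congʳ 𝕚²+1≈0)) ⟩
    1# - 0# * (a * a * δ)
      ≈⟨ solve 1 (λ x → 𝟙 :- 𝟘 :* x := 𝟙) refl (a * a * δ) ⟩
    1# ∎

  δ′≈a²δ : δ′ ≈ a * a * δ
  δ′≈a²δ = begin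
    δ′                                         ≈⟨ trans (*-congʳ [1+a²]δ≈1) (*-identityˡ δ′) ⟨
    (1# + a ^ 2) * δ * δ′
      ≈⟨ solve 3 (λ a δ δ′ → (𝟙 :+ a :^ 2) :* δ :* δ′ := (a :* a :+ 𝟙 :* 𝟙) :* (δ :* δ′)) refl a δ δ′ ⟩
    (a * a + 1# * 1#) * (δ * δ′)               ≈⟨ *-congʳ (+-congˡ (*-cong aa⁻¹≈1 aa⁻¹≈1)) ⟨
    (a * a + a * a⁻¹ * (a * a⁻¹)) * (δ * δ′)
      ≈⟨ solve 4 (λ a a⁻¹ δ δ′ → (a :* a :+ a :* a⁻¹ :* (a :* a⁻¹)) :* (δ :* δ′) :=
           a :* a :* δ :* ((𝟙 :+ a⁻¹ :^ 2) :* δ′)) refl a a⁻¹ δ δ′ ⟩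
    a * a * δ * ((1# + a⁻¹ ^ 2) * δ′)          ≈⟨ trans (*-congˡ [1+a⁻²]δ′≈1) (*-identityʳ _) ⟩
    a * a * δ                                  ∎

  parameter : Parameter R
  parameter = record { α = α ; δ = δ ; [1-α²]δ≈1 = [1-α²]δ≈1 }

  open GeneratingFunction R parameter m public

  T : (w b a δ : Carrier) → Carrier
  T w b a δ = (1# + b * a * 𝕚) * (1# + w * a * 𝕚) * δ

  -- Here `r` stands for 1/(1 - T). Quotients are written as products with a reciprocal, which is
  -- how `_/_[_]` unfolds.
  F : (w b a δ r : Carrier) → Carrier
  F w b a δ r = - (𝕚 * a * δ) * ((1# - T w b a δ ^ n) * r)

  module _ (u q : Carrier) where

    -- The case ζ = 1 of `corner-unique`: τ is already T, and -(αδ) is already the prefactor of F.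
    F⁰⁰-corner : ∀ {r} → (1# - T u q a δ) * r ≈ 1# → F u q a δ r ≈ corner q 0 0 u
    F⁰⁰-corner {r} Tr = trans
      (sym (trans (*-congʳ (trans (*-identityʳ _) (1^n≈1 m))) (*-identityˡ _)))
      (corner-unique u q {η = 1#} Tr (*-identityˡ 1#)
        (trans (*-identityˡ _)
          (solve 5 (λ 𝕚 a δ u q → (𝟙 :+ q :* a :* 𝕚) :* (𝟙 :+ u :* a :* 𝕚) :* δ :=
             (𝕚 :* a :* q :+ 𝟙) :* (δ :* (𝟙 :- 𝕚 :* a :* :- u))) refl 𝕚 a δ u q))
        (denominator₀₀ u q)
        (*-identityˡ _)
        (corner₀₀ u q))

    -- The case ζ = uq, which clears the inverses from both linear factors of T.
    F¹¹-corner : ∀ {r u⁻¹ q⁻¹} → u * u⁻¹ ≈ 1# → q * q⁻¹ ≈ 1# →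
      (1# - T (1# * u⁻¹) (1# * q⁻¹) a δ) * r ≈ 1# →
      (u * q) ^ m * F (1# * u⁻¹) (1# * q⁻¹) a δ r ≈ corner q n n u
    F¹¹-corner {r} {u⁻¹} {q⁻¹} uu⁻¹ qq⁻¹ Tr = trans
      (*-congʳ (sym (*-identityʳ _)))
      (corner-unique u q {ζ⁻¹ = u⁻¹ * q⁻¹} {η = 1#} Tr
        (trans (solve 4 (λ u q u⁻¹ q⁻¹ → u :* q :* (u⁻¹ :* q⁻¹) := u :* u⁻¹ :* (q :* q⁻¹)) refl u q u⁻¹ q⁻¹)
               (trans (*-cong uu⁻¹ qq⁻¹) (*-identityˡ 1#)))
        (begin
          u * q * ((1# + 1# * q⁻¹ * a * 𝕚) * (1# + 1# * u⁻¹ * a * 𝕚) * δ)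
            ≈⟨ solve 7 (λ 𝕚 a δ u q u⁻¹ q⁻¹ →
                 u :* q :* ((𝟙 :+ 𝟙 :* q⁻¹ :* a :* 𝕚) :* (𝟙 :+ 𝟙 :* u⁻¹ :* a :* 𝕚) :* δ) :=
                 (q :+ q :* q⁻¹ :* a :* 𝕚) :* (u :+ u :* u⁻¹ :* a :* 𝕚) :* δ) refl 𝕚 a δ u q u⁻¹ q⁻¹ ⟩
          (q + q * q⁻¹ * a * 𝕚) * (u + u * u⁻¹ * a * 𝕚) * δ
            ≈⟨ *-congʳ (*-cong (+-congˡ (*-congʳ (*-congʳ qq⁻¹))) (+-congˡ (*-congʳ (*-congʳ uu⁻¹)))) ⟩
          (q + 1# * a * 𝕚) * (u + 1# * a * 𝕚) * δ
            ≈⟨ solve 5 (λ 𝕚 a δ u q → (q :+ 𝟙 :* a :* 𝕚) :* (u :+ 𝟙 :* a :* 𝕚) :* δ :=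
                 (𝟙 :* q :+ 𝕚 :* a) :* (δ :* (u :- 𝕚 :* a :* :- 𝟙))) refl 𝕚 a δ u q ⟩
          t q * (δ * (u - α * - 1#)) ∎)
        (denominatorₙₙ u q)
        (*-identityˡ _)
        (cornerₙₙ u q))

    -- Two inverses of `a` occur: `a⁻¹` embeds the real reciprocal used as a weight, `ra` comes from
    -- the complex division in i/a.
    module _ {ra : Carrier} (a·ra≈1 : a * ra ≈ 1#) where

      private
        -- Since δ′ = a²δ, the prefactor of F at weight 1/a and the extra factor i/a multiply to
        -- -i²δ. This is the constant δ in `denominator₀ₙ` and `denominatorₙ₀`.
        prefactor : 𝕚 * ra * - (𝕚 * a⁻¹ * δ′) ≈ δ
        prefactor = begin
          𝕚 * ra * - (𝕚 * a⁻¹ * δ′)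
            ≈⟨ *-congˡ (-‿cong (*-congˡ δ′≈a²δ)) ⟩
          𝕚 * ra * - (𝕚 * a⁻¹ * (a * a * δ))
            ≈⟨ solve 5 (λ 𝕚 a a⁻¹ ra δ → 𝕚 :* ra :* :- (𝕚 :* a⁻¹ :* (a :* a :* δ)) :=
                 (a :* ra) :* (a :* a⁻¹) :* (δ :- (𝕚 :* 𝕚 :+ 𝟙) :* δ)) refl 𝕚 a a⁻¹ ra δ ⟩
          a * ra * (a * a⁻¹) * (δ - (𝕚 * 𝕚 + 1#) * δ)
            ≈⟨ *-cong (*-cong a·ra≈1 aa⁻¹≈1) (+-congˡ (-‿cong (*-congʳ 𝕚²+1≈0))) ⟩
          1# * 1# * (δ - 0# * δ)
            ≈⟨ solve 1 (λ δ → 𝟙 :* 𝟙 :* (δ :- 𝟘 :* δ) := δ) refl δ ⟩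
          δ ∎

        drop-𝕚²+1 : ∀ x y → x + y * (𝕚 * 𝕚 + 1#) ≈ x
        drop-𝕚²+1 x y = trans (+-congˡ (trans (*-congˡ 𝕚²+1≈0) (zeroʳ y))) (+-identityʳ x)

      F⁰¹-corner : ∀ {r u⁻¹} → u * u⁻¹ ≈ 1# →
        (1# - T (- 1# * u⁻¹) (- q) a⁻¹ δ′) * r ≈ 1# →
        u ^ m * (𝕚 * ra) * F (- 1# * u⁻¹) (- q) a⁻¹ δ′ r ≈ corner q n 0 u
      F⁰¹-corner {r} {u⁻¹} uu⁻¹ Tr =
        corner-unique u q Tr uu⁻¹
          (begin
            u * ((1# + - q * a⁻¹ * 𝕚) * (1# + - 1# * u⁻¹ * a⁻¹ * 𝕚) * δ′)
              ≈⟨ *-congˡ (*-congˡ δ′≈a²δ) ⟩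
            u * ((1# + - q * a⁻¹ * 𝕚) * (1# + - 1# * u⁻¹ * a⁻¹ * 𝕚) * (a * a * δ))
              ≈⟨ solve 7 (λ 𝕚 a a⁻¹ δ u q u⁻¹ →
                   u :* ((𝟙 :+ :- q :* a⁻¹ :* 𝕚) :* (𝟙 :+ :- 𝟙 :* u⁻¹ :* a⁻¹ :* 𝕚) :* (a :* a :* δ)) :=
                   (a :- q :* (a :* a⁻¹) :* 𝕚) :* (a :* u :- u :* u⁻¹ :* (a :* a⁻¹) :* 𝕚) :* δ)
                   refl 𝕚 a a⁻¹ δ u q u⁻¹ ⟩
            (a - q * (a * a⁻¹) * 𝕚) * (a * u - u * u⁻¹ * (a * a⁻¹) * 𝕚) * δ
              ≈⟨ *-congʳ (*-cong (+-congˡ (-‿cong (*-congʳ (*-congˡ aa⁻¹≈1))))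
                                 (+-congˡ (-‿cong (*-congʳ (*-cong uu⁻¹ aa⁻¹≈1))))) ⟩
            (a - q * 1# * 𝕚) * (a * u - 1# * 1# * 𝕚) * δ
              -- In ℂ one has q + ia = i(a - iq) and -1 - iau = -i(au - i), so the factors i and -i
              -- cancel; the last summand records the use of i² = -1.
              ≈⟨ solve 5 (λ 𝕚 a δ u q → (a :- q :* 𝟙 :* 𝕚) :* (a :* u :- 𝟙 :* 𝟙 :* 𝕚) :* δ :=
                   (𝟙 :* q :+ 𝕚 :* a) :* (δ :* (:- 𝟙 :- 𝕚 :* a :* u))
                     :+ (a :* a :* u :+ q) :* δ :* (𝕚 :* 𝕚 :+ 𝟙)) refl 𝕚 a δ u q ⟩
            t q * (δ * (- 1# - α * u)) + (a * a * u + q) * δ * (𝕚 * 𝕚 + 1#)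
              ≈⟨ drop-𝕚²+1 _ _ ⟩
            t q * (δ * (- 1# - α * u)) ∎)
          (denominator₀ₙ u q) prefactor (corner₀ₙ u q)

      F¹⁰-corner : ∀ {r q⁻¹} → q * q⁻¹ ≈ 1# →
        (1# - T (- u) (- 1# * q⁻¹) a⁻¹ δ′) * r ≈ 1# →
        q ^ m * (𝕚 * ra) * F (- u) (- 1# * q⁻¹) a⁻¹ δ′ r ≈ corner q 0 n u
      F¹⁰-corner {r} {q⁻¹} qq⁻¹ Tr =
        corner-unique u q Tr qq⁻¹
          (begin
            q * ((1# + - 1# * q⁻¹ * a⁻¹ * 𝕚) * (1# + - u * a⁻¹ * 𝕚) * δ′)
              ≈⟨ *-congˡ (*-congˡ δ′≈a²δ) ⟩
            q * ((1# + - 1# * q⁻¹ * a⁻¹ * 𝕚) * (1# + - u * a⁻¹ * 𝕚) * (a * a * δ))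
              ≈⟨ solve 7 (λ 𝕚 a a⁻¹ δ u q q⁻¹ →
                   q :* ((𝟙 :+ :- 𝟙 :* q⁻¹ :* a⁻¹ :* 𝕚) :* (𝟙 :+ :- u :* a⁻¹ :* 𝕚) :* (a :* a :* δ)) :=
                   (a :* q :- q :* q⁻¹ :* (a :* a⁻¹) :* 𝕚) :* (a :- u :* (a :* a⁻¹) :* 𝕚) :* δ)
                   refl 𝕚 a a⁻¹ δ u q q⁻¹ ⟩
            (a * q - q * q⁻¹ * (a * a⁻¹) * 𝕚) * (a - u * (a * a⁻¹) * 𝕚) * δ
              ≈⟨ *-congʳ (*-cong (+-congˡ (-‿cong (*-congʳ (*-cong qq⁻¹ aa⁻¹≈1))))
                                 (+-congˡ (-‿cong (*-congʳ (*-congˡ aa⁻¹≈1))))) ⟩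
            (a * q - 1# * 1# * 𝕚) * (a - u * 1# * 𝕚) * δ
              ≈⟨ solve 5 (λ 𝕚 a δ u q → (a :* q :- 𝟙 :* 𝟙 :* 𝕚) :* (a :- u :* 𝟙 :* 𝕚) :* δ :=
                   (𝕚 :* a :* q :+ 𝟙) :* (δ :* (:- u :- 𝕚 :* a :* 𝟙))
                     :+ (a :* a :* q :+ u) :* δ :* (𝕚 :* 𝕚 :+ 𝟙)) refl 𝕚 a δ u q ⟩
            s q * (δ * (- u - α * 1#)) + (a * a * q + u) * δ * (𝕚 * 𝕚 + 1#)
              ≈⟨ drop-𝕚²+1 _ _ ⟩
            s q * (δ * (- u - α * 1#)) ∎)
          (denominatorₙ₀ u q) prefactor (cornerₙ₀ u q)

  x^2k+1 : ∀ x k → x ^ (2 ℕ.* k ℕ.+ 1) ≈ x * (x ^ 2) ^ k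
  x^2k+1 x k = begin
    x ^ (2 ℕ.* k ℕ.+ 1)  ≡⟨ ≡.cong (x ^_) (ℕ.+-comm (2 ℕ.* k) 1) ⟩
    x * x ^ (2 ℕ.* k)    ≈⟨ *-congˡ (^-assocʳ x 2 k) ⟨
    x * (x ^ 2) ^ k      ∎

  -- As n = `suc m`, the truncated subtraction is exact and the exponent is 2m + 1.
  x^2n∸1 : ∀ x → x ^ (2 ℕ.* n ∸ 1) ≈ x * (x ^ 2) ^ m
  x^2n∸1 x = trans (reflexive (≡.cong (x ^_) (≡.trans (ℕ.+-suc m _) (≡.sym (ℕ.+-comm (2 ℕ.* m) 1)))))
    (x^2k+1 x m)

  geometric-quotient : ∀ k x {r} → (1# - x) * r ≈ 1# → geometric k x ≈ (1# - x ^ k) * r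
  geometric-quotient k x {r} xr = begin
    geometric k x                    ≈⟨ trans (*-congʳ xr) (*-identityˡ _) ⟨
    (1# - x) * r * geometric k x     ≈⟨ solve 3 (λ x y z → x :* y :* z := x :* z :* y) refl (1# - x) r _ ⟩
    (1# - x) * geometric k x * r     ≈⟨ *-congʳ (geometric-sum k x) ⟩
    (1# - x ^ k) * r                 ∎

  C : (r₁ r₂ : Carrier) → Carrier
  C r₁ r₂ = 1# + r₁ ^ 2 * r₂ ^ 2 + 𝕚 * a * (r₁ ^ 2 + r₂ ^ 2)

  C-form : ∀ r₁ r₂ → C r₁ r₂ ≈ s (r₁ ^ 2) + r₂ ^ 2 * t (r₁ ^ 2)
  C-form r₁ r₂ = solve 3 (λ α x y → 𝟙 :+ x :* y :+ α :* (x :+ y) := α :* x :+ 𝟙 :+ y :* (𝟙 :* x :+ α))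
    refl α (r₁ ^ 2) (r₂ ^ 2)

  -- C is symmetric in its arguments. The white factor is grouped by w₁², the black one by b₂²,
  -- because transposition makes `q` the polynomial variable.
  C-form′ : ∀ r₁ r₂ → C r₁ r₂ ≈ s (r₂ ^ 2) + r₁ ^ 2 * t (r₂ ^ 2)
  C-form′ r₁ r₂ = solve 3 (λ α x y → 𝟙 :+ x :* y :+ α :* (x :+ y) := α :* y :+ 𝟙 :+ x :* (𝟙 :* y :+ α))
    refl α (r₁ ^ 2) (r₂ ^ 2)

  module _ (w₁ w₂ b₁ b₂ : Carrier) where

    u v p q z : Carrier
    u = w₁ ^ 2
    v = w₂ ^ 2
    p = b₁ ^ 2
    q = b₂ ^ 2
    z = w₁ * b₂

    term : (i j k l : ℕ) → Carrier
    term i j k l = entry i j k l * w₁ ^ (2 ℕ.* i ℕ.+ 1) * w₂ ^ (2 ℕ.* j) * b₁ ^ (2 ℕ.* k) * b₂ ^ (2 ℕ.* l ℕ.+ 1)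

    -- The odd exponents of w₁ and b₂ contribute the common factor `z`; all that remains depends on
    -- the squares `u`, `v`, `p`, `q`.
    term-generating :
      ∑< n (λ i → ∑< (suc n) (λ j → ∑< (suc n) (λ k → ∑< n (λ l → term i j k l)))) ≈
        z * generating u v p q
    term-generating = begin
      ∑< n (λ i → ∑< (suc n) (λ j → ∑ᴮ< (λ k l → term i j k l)))
        ≈⟨ ∑<-cong n (λ i _ → ∑-∑ᴮ<-comm (suc n) (λ j k l → term i j k l)) ⟩
      ∑< n (λ i → ∑ᴮ< (λ k l → ∑< (suc n) (λ j → term i j k l)))
        ≈⟨ ∑-∑ᴮ<-comm n (λ i k l → ∑< (suc n) (λ j → term i j k l)) ⟩
      ∑ᴮ< (λ k l → ∑< n (λ i → ∑< (suc n) (λ j → term i j k l)))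
        ≈⟨ ∑ᴮ<-cong (λ k l _ _ → ∑<-comm n (suc n) (λ i j → term i j k l)) ⟩
      ∑ᴮ< (λ k l → ∑< (suc n) (λ j → ∑< n (λ i → term i j k l)))
        ≈⟨ ∑ᴮ<-cong (λ k l _ _ → trans
             (∑<-cong (suc n) λ j _ → trans (∑<-cong n λ i _ → term-powers i j k l) (sym (∑<-distribˡ n _ _)))
             (trans (∑<-cong (suc n) λ j _ → trans (*-assoc _ _ _) (*-congˡ (*-comm _ _)))
                    (sym (∑<-distribˡ (suc n) _ _)))) ⟩
      ∑ᴮ< (λ k l → z * (p ^ k * q ^ l) * ∑< (suc n) (λ j → row-sum u j k l * v ^ j))
        ≈⟨ ∑ᴮ<-cong (λ k l _ _ → *-assoc _ _ _) ⟩
      ∑ᴮ< (λ k l → z * (p ^ k * q ^ l * ∑< (suc n) (λ j → row-sum u j k l * v ^ j)))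
        ≈⟨ ∑ᴮ<-distribˡ z _ ⟨
      z * generating u v p q ∎
      where
      ∑-∑ᴮ<-comm : ∀ N (f : ℕ → ℕ → ℕ → Carrier) →
        ∑< N (λ i → ∑ᴮ< (f i)) ≈ ∑ᴮ< (λ k l → ∑< N (λ i → f i k l))
      ∑-∑ᴮ<-comm N f = trans (∑<-comm N (suc n) (λ i k → ∑< n (f i k)))
        (∑<-cong (suc n) λ k _ → ∑<-comm N n (λ i l → f i k l))
      term-powers : ∀ i j k l → term i j k l ≈ z * (p ^ k * q ^ l) * v ^ j * (entry i j k l * u ^ i)
      term-powers i j k l = begin
        entry i j k l * w₁ ^ (2 ℕ.* i ℕ.+ 1) * w₂ ^ (2 ℕ.* j) * b₁ ^ (2 ℕ.* k) * b₂ ^ (2 ℕ.* l ℕ.+ 1)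
          ≈⟨ *-cong (*-cong (*-cong (*-congˡ (x^2k+1 w₁ i)) (sym (^-assocʳ w₂ 2 j))) (sym (^-assocʳ b₁ 2 k)))
                    (x^2k+1 b₂ l) ⟩
        entry i j k l * (w₁ * u ^ i) * v ^ j * p ^ k * (b₂ * q ^ l)
          ≈⟨ solve 7 (λ e w₁ b₂ uⁱ vʲ pᵏ qˡ →
               e :* (w₁ :* uⁱ) :* vʲ :* pᵏ :* (b₂ :* qˡ) :=
               w₁ :* b₂ :* (pᵏ :* qˡ) :* vʲ :* (e :* uⁱ))
               refl (entry i j k l) w₁ b₂ (u ^ i) (v ^ j) (p ^ k) (q ^ l) ⟩
        z * (p ^ k * q ^ l) * v ^ j * (entry i j k l * u ^ i) ∎

    sum-generating :
      sum {n} (λ i → sum {suc n} λ j → sum {suc n} λ k → sum {n} λ l →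
        inverse (i , j) (k , l)
          * w₁ ^ proj₁ (white (i , j)) * w₂ ^ proj₂ (white (i , j))
          * b₁ ^ proj₁ (black (k , l)) * b₂ ^ proj₂ (black (k , l)))
        ≈ z * generating u v p q
    sum-generating = trans
      (sum-cong-≋ {n} λ i → trans
        (sum-cong-≋ {suc n} λ j → trans
          (sum-cong-≋ {suc n} λ k → sym (∑<-sum n λ l → term (toℕ i) (toℕ j) (toℕ k) l))
          (sym (∑<-sum (suc n) λ k → ∑< n (λ l → term (toℕ i) (toℕ j) k l))))
        (sym (∑<-sum (suc n) λ j → ∑< (suc n) (λ k → ∑< n (λ l → term (toℕ i) j k l)))))
      (trans (sym (∑<-sum n λ i → ∑< (suc n) (λ j → ∑< (suc n) (λ k → ∑< n (λ l → term i j k l)))))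
        term-generating)

    -- Each quotient enters through a reciprocal and the equation defining it, so the identity makes
    -- sense in any commutative ring with a `Weighting`.
    generating-formula : ∀ {ra u⁻¹ q⁻¹ rᵘᵖ rᵛᑫ r⁰⁰ r⁰¹ r¹⁰ r¹¹ rʷ rʷᵇ} →
      a * ra ≈ 1# → u * u⁻¹ ≈ 1# → q * q⁻¹ ≈ 1# →
      (1# - u * p) * rᵘᵖ ≈ 1# → (1# - v * q) * rᵛᑫ ≈ 1# →
      (1# - T u q a δ) * r⁰⁰ ≈ 1# →
      (1# - T (- 1# * u⁻¹) (- q) a⁻¹ δ′) * r⁰¹ ≈ 1# →
      (1# - T (- u) (- 1# * q⁻¹) a⁻¹ δ′) * r¹⁰ ≈ 1# →
      (1# - T (1# * u⁻¹) (1# * q⁻¹) a δ) * r¹¹ ≈ 1# →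
      C w₁ w₂ * rʷ ≈ 1# → C w₁ w₂ * C b₁ b₂ * rʷᵇ ≈ 1# →
      z * generating u v p q ≈
        w₁ * v * b₂ * ((1# - (u * p) ^ (n ℕ.+ 1)) * rᵘᵖ) * ((1# - (v * q) ^ n) * rᵛᑫ) * rʷ
        + (1# + α * u)
            * ((1# + α * q) * (F u q a δ r⁰⁰ * w₁ * b₂)
               + p * (b₂ * w₁ * ((1# - (u * p) ^ n) * rᵘᵖ)
                      + (α + q) * (F (- 1# * u⁻¹) (- q) a⁻¹ δ′ r⁰¹
                                     * w₁ ^ (2 ℕ.* n ∸ 1) * b₁ ^ (2 ℕ.* n) * b₂ * (𝕚 * ra))))
            * rʷᵇ
        + (α + u) * v
            * (p * b₂ ^ (2 ℕ.* n ℕ.+ 1) * w₁ * w₂ ^ (2 ℕ.* n) * ((1# - (u * p) ^ n) * rᵘᵖ)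
               + (1# + α * q) * (F (- u) (- 1# * q⁻¹) a⁻¹ δ′ r¹⁰
                                   * w₁ * w₂ ^ (2 ℕ.* n) * b₂ ^ (2 ℕ.* n ∸ 1) * (𝕚 * ra))
               + p * (α + q) * (F (1# * u⁻¹) (1# * q⁻¹) a δ r¹¹
                                  * w₁ ^ (2 ℕ.* n ∸ 1) * w₂ ^ (2 ℕ.* n) * b₁ ^ (2 ℕ.* n) * b₂ ^ (2 ℕ.* n ∸ 1)))
            * rʷᵇ
    generating-formula {ra} {u⁻¹} {q⁻¹} {rᵘᵖ} {rᵛᑫ} {r⁰⁰} {r⁰¹} {r¹⁰} {r¹¹} {rʷ} {rʷᵇ}
      a·ra uu⁻¹ qq⁻¹ up≠1 vq≠1 T⁰⁰ T⁰¹ T¹⁰ T¹¹ Cʷ Cʷᵇ = trans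
      (generating-corners u v p q z
        (trans (*-congʳ (sym (C-form w₁ w₂))) Cʷ)
        (trans (*-congʳ (sym (*-cong (C-form w₁ w₂) (C-form′ b₁ b₂)))) Cʷᵇ))
      (+-cong (+-cong
        (*-congʳ first)
        (*-congʳ (*-cong (+-comm _ _)
          (+-cong (*-cong (+-comm _ _) e⁰⁰)
                  (*-congˡ (+-cong (*-cong (*-comm w₁ b₂) φ) (*-cong t-form e⁰¹)))))))
        (*-congʳ (*-cong (*-congʳ t-form)
          (+-cong (+-cong top (*-cong (+-comm _ _) e¹⁰)) (*-cong (*-congˡ t-form) e¹¹)))))
      where
      φ : geometric n (u * p) ≈ (1# - (u * p) ^ n) * rᵘᵖ
      φ = geometric-quotient n (u * p) up≠1

      t-form : ∀ {x} → t x ≈ α + x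
      t-form {x} = trans (+-congʳ (*-identityˡ x)) (+-comm x α)

      first : z * (v * (geometric (suc n) (u * p) * geometric n (v * q))) ≈
        w₁ * v * b₂ * ((1# - (u * p) ^ (n ℕ.+ 1)) * rᵘᵖ) * ((1# - (v * q) ^ n) * rᵛᑫ)
      first = begin
        w₁ * b₂ * (v * (geometric (suc n) (u * p) * geometric n (v * q)))
          ≈⟨ solve 5 (λ w₁ b₂ v x y → w₁ :* b₂ :* (v :* (x :* y)) := w₁ :* v :* b₂ :* x :* y)
               refl w₁ b₂ v (geometric (suc n) (u * p)) (geometric n (v * q)) ⟩
        w₁ * v * b₂ * geometric (suc n) (u * p) * geometric n (v * q)
          ≈⟨ *-cong (*-congˡ (trans (geometric-quotient (suc n) (u * p) up≠1)
               (reflexive (≡.cong (λ k → (1# - (u * p) ^ k) * rᵘᵖ) (ℕ.+-comm 1 n)))))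
               (geometric-quotient n (v * q) vq≠1) ⟩
        w₁ * v * b₂ * ((1# - (u * p) ^ (n ℕ.+ 1)) * rᵘᵖ) * ((1# - (v * q) ^ n) * rᵛᑫ) ∎

      top : p * (z * v ^ n * q ^ n * geometric n (u * p)) ≈
        p * b₂ ^ (2 ℕ.* n ℕ.+ 1) * w₁ * w₂ ^ (2 ℕ.* n) * ((1# - (u * p) ^ n) * rᵘᵖ)
      top = begin
        p * (w₁ * b₂ * v ^ n * q ^ n * geometric n (u * p))
          ≈⟨ solve 6 (λ w₁ b₂ p vⁿ qⁿ x →
               p :* (w₁ :* b₂ :* vⁿ :* qⁿ :* x) := p :* (b₂ :* qⁿ) :* w₁ :* vⁿ :* x)
               refl w₁ b₂ p (v ^ n) (q ^ n) (geometric n (u * p)) ⟩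
        p * (b₂ * q ^ n) * w₁ * v ^ n * geometric n (u * p)
          ≈⟨ *-cong (*-cong (*-congʳ (*-congˡ (sym (x^2k+1 b₂ n)))) (^-assocʳ w₂ 2 n)) φ ⟩
        p * b₂ ^ (2 ℕ.* n ℕ.+ 1) * w₁ * w₂ ^ (2 ℕ.* n) * ((1# - (u * p) ^ n) * rᵘᵖ) ∎

      e⁰⁰ : z * corner q 0 0 u ≈ F u q a δ r⁰⁰ * w₁ * b₂
      e⁰⁰ = trans (*-congˡ (sym (F⁰⁰-corner u q T⁰⁰)))
        (solve 3 (λ w₁ b₂ x → w₁ :* b₂ :* x := x :* w₁ :* b₂) refl w₁ b₂ _)

      e⁰¹ : z * p ^ n * corner q n 0 u ≈
        F (- 1# * u⁻¹) (- q) a⁻¹ δ′ r⁰¹ * w₁ ^ (2 ℕ.* n ∸ 1) * b₁ ^ (2 ℕ.* n) * b₂ * (𝕚 * ra)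
      e⁰¹ = begin
        w₁ * b₂ * p ^ n * corner q n 0 u
          ≈⟨ *-congˡ (F⁰¹-corner u q a·ra uu⁻¹ T⁰¹) ⟨
        w₁ * b₂ * p ^ n * (u ^ m * (𝕚 * ra) * x)
          ≈⟨ solve 6 (λ w₁ b₂ pⁿ uᵐ η x →
               w₁ :* b₂ :* pⁿ :* (uᵐ :* η :* x) := x :* (w₁ :* uᵐ) :* pⁿ :* b₂ :* η)
               refl w₁ b₂ (p ^ n) (u ^ m) (𝕚 * ra) x ⟩
        x * (w₁ * u ^ m) * p ^ n * b₂ * (𝕚 * ra)
          ≈⟨ *-congʳ (*-congʳ (*-cong (*-congˡ (sym (x^2n∸1 w₁))) (^-assocʳ b₁ 2 n))) ⟩
        x * w₁ ^ (2 ℕ.* n ∸ 1) * b₁ ^ (2 ℕ.* n) * b₂ * (𝕚 * ra) ∎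
        where x = F (- 1# * u⁻¹) (- q) a⁻¹ δ′ r⁰¹

      e¹⁰ : z * v ^ n * corner q 0 n u ≈
        F (- u) (- 1# * q⁻¹) a⁻¹ δ′ r¹⁰ * w₁ * w₂ ^ (2 ℕ.* n) * b₂ ^ (2 ℕ.* n ∸ 1) * (𝕚 * ra)
      e¹⁰ = begin
        w₁ * b₂ * v ^ n * corner q 0 n u
          ≈⟨ *-congˡ (F¹⁰-corner u q a·ra qq⁻¹ T¹⁰) ⟨
        w₁ * b₂ * v ^ n * (q ^ m * (𝕚 * ra) * x)
          ≈⟨ solve 6 (λ w₁ b₂ vⁿ qᵐ η x →
               w₁ :* b₂ :* vⁿ :* (qᵐ :* η :* x) := x :* w₁ :* vⁿ :* (b₂ :* qᵐ) :* η)
               refl w₁ b₂ (v ^ n) (q ^ m) (𝕚 * ra) x ⟩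
        x * w₁ * v ^ n * (b₂ * q ^ m) * (𝕚 * ra)
          ≈⟨ *-congʳ (*-cong (*-congˡ (^-assocʳ w₂ 2 n)) (sym (x^2n∸1 b₂))) ⟩
        x * w₁ * w₂ ^ (2 ℕ.* n) * b₂ ^ (2 ℕ.* n ∸ 1) * (𝕚 * ra) ∎
        where x = F (- u) (- 1# * q⁻¹) a⁻¹ δ′ r¹⁰

      e¹¹ : z * p ^ n * v ^ n * corner q n n u ≈
        F (1# * u⁻¹) (1# * q⁻¹) a δ r¹¹
          * w₁ ^ (2 ℕ.* n ∸ 1) * w₂ ^ (2 ℕ.* n) * b₁ ^ (2 ℕ.* n) * b₂ ^ (2 ℕ.* n ∸ 1)
      e¹¹ = begin
        w₁ * b₂ * p ^ n * v ^ n * corner q n n u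
          ≈⟨ *-congˡ (trans (*-congʳ (sym (^-distrib-* u q m))) (F¹¹-corner u q uu⁻¹ qq⁻¹ T¹¹)) ⟨
        w₁ * b₂ * p ^ n * v ^ n * (u ^ m * q ^ m * x)
          ≈⟨ solve 7 (λ w₁ b₂ pⁿ vⁿ uᵐ qᵐ x →
               w₁ :* b₂ :* pⁿ :* vⁿ :* (uᵐ :* qᵐ :* x) := x :* (w₁ :* uᵐ) :* vⁿ :* pⁿ :* (b₂ :* qᵐ))
               refl w₁ b₂ (p ^ n) (v ^ n) (u ^ m) (q ^ m) x ⟩
        x * (w₁ * u ^ m) * v ^ n * p ^ n * (b₂ * q ^ m)
          ≈⟨ *-cong (*-cong (*-cong (*-congˡ (sym (x^2n∸1 w₁))) (^-assocʳ w₂ 2 n)) (^-assocʳ b₁ 2 n))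
                    (sym (x^2n∸1 b₂)) ⟩
        x * w₁ ^ (2 ℕ.* n ∸ 1) * w₂ ^ (2 ℕ.* n) * b₁ ^ (2 ℕ.* n) * b₂ ^ (2 ℕ.* n ∸ 1) ∎
        where x = F (1# * u⁻¹) (1# * q⁻¹) a δ r¹¹

-- Kasteleyn weights in terms of vertex displacements

module KasteleynEntries {c ℓ} (R : CommutativeRing c ℓ) where

  open CommutativeRing R hiding (zero)
  open IntegerCoefficients R
  open Polynomials R using (mono; lin)

  -- UnitView z x y: x and y are the indicators of z = 1 and of z = -1.
  data UnitView : ℤ → Carrier → Carrier → Set c where
    plus  : UnitView ℤ.1ℤ 1# 0#
    minus : UnitView ℤ.-1ℤ 0# 1#
    other : ∀ {z} → z ≢ ℤ.1ℤ → z ≢ ℤ.-1ℤ → UnitView z 0# 0#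

  private
    view≡ : ∀ {z z′ x y} → z ≡ z′ → UnitView z′ x y → UnitView z x y
    view≡ ≡.refl view = view

    other-pos : ∀ k → UnitView (+ suc (suc k)) 0# 0#
    other-pos k = other (λ ()) (λ ())

    other-neg : ∀ k → UnitView -[1+ suc k ] 0# 0#
    other-neg k = other (λ ()) (λ ())

  -- The difference 2i - (2i′ + 1) is odd; it is 1 exactly for i = i′ + 1 and -1 exactly for i = i′,
  -- hence the two deltas.
  odd-even : ∀ i i′ → UnitView (2 ℕ.* i ⊖ (2 ℕ.* i′ ℕ.+ 1)) (mono (suc i′) i) (mono i′ i)
  odd-even zero zero = minus
  odd-even zero (suc i′) rewrite ℕ.+-suc i′ (i′ ℕ.+ 0) = other-neg _
  odd-even (suc zero) zero = plus
  odd-even (suc (suc i)) zero rewrite ℕ.+-suc i (suc (i ℕ.+ 0)) = other-pos _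
  odd-even (suc i) (suc i′) = view≡ (≡.trans
    (≡.cong₂ (λ x y → x ⊖ (y ℕ.+ 1)) (ℕ.*-suc 2 i) (ℕ.*-suc 2 i′))
    (ℤ.+-cancelˡ-⊖ 2 (2 ℕ.* i) (2 ℕ.* i′ ℕ.+ 1))) (odd-even i i′)

  even-odd : ∀ j j′ → UnitView ((2 ℕ.* j ℕ.+ 1) ⊖ 2 ℕ.* j′) (mono j j′) (mono (suc j) j′)
  even-odd zero zero = plus
  even-odd zero (suc zero) = minus
  even-odd zero (suc (suc j′)) rewrite ℕ.+-suc j′ (suc (j′ ℕ.+ 0)) = other-neg _
  even-odd (suc j) zero rewrite ℕ.+-suc j (j ℕ.+ 0) = other-pos _
  even-odd (suc j) (suc j′) = view≡ (≡.trans
    (≡.cong₂ (λ x y → (x ℕ.+ 1) ⊖ y) (ℕ.*-suc 2 j) (ℕ.*-suc 2 j′))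
    (ℤ.+-cancelˡ-⊖ 2 (2 ℕ.* j ℕ.+ 1) (2 ℕ.* j′))) (even-odd j j′)

  module _ (α : Carrier) where

    weight : ℤ × ℤ → Carrier
    weight d =
      if      does (d ≟ᶻ e₁) ∨ does (d ≟ᶻ neg e₁) then 1#
      else if does (d ≟ᶻ e₂) ∨ does (d ≟ᶻ neg e₂) then α
      else 0#

    weight-zero : ∀ {d} → d ≢ e₁ → d ≢ neg e₁ → d ≢ e₂ → d ≢ neg e₂ → weight d ≈ 0#
    weight-zero {d} d≢e₁ d≢-e₁ d≢e₂ d≢-e₂
      rewrite dec-false (d ≟ᶻ e₁) d≢e₁ | dec-false (d ≟ᶻ neg e₁) d≢-e₁
            | dec-false (d ≟ᶻ e₂) d≢e₂ | dec-false (d ≟ᶻ neg e₂) d≢-e₂ = refl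

    -- If both components are ±1, equal signs give ±e₁ and opposite signs ±e₂. Any other component
    -- excludes all four edges and makes both of its deltas zero.
    weight-view : ∀ {d₁ d₂ x₁ y₁ x₂ y₂} → UnitView d₁ x₁ y₁ → UnitView d₂ x₂ y₂ →
      weight (d₁ , d₂) ≈ y₂ * (α * x₁ + 1# * y₁) + x₂ * (1# * x₁ + α * y₁)
    weight-view plus plus =
      solve 1 (λ α → 𝟙 := 𝟘 :* (α :* 𝟙 :+ 𝟙 :* 𝟘) :+ 𝟙 :* (𝟙 :* 𝟙 :+ α :* 𝟘)) refl α
    weight-view minus minus =
      solve 1 (λ α → 𝟙 := 𝟙 :* (α :* 𝟘 :+ 𝟙 :* 𝟙) :+ 𝟘 :* (𝟙 :* 𝟘 :+ α :* 𝟙)) refl α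
    weight-view plus minus =
      solve 1 (λ α → α := 𝟙 :* (α :* 𝟙 :+ 𝟙 :* 𝟘) :+ 𝟘 :* (𝟙 :* 𝟙 :+ α :* 𝟘)) refl α
    weight-view minus plus =
      solve 1 (λ α → α := 𝟘 :* (α :* 𝟘 :+ 𝟙 :* 𝟙) :+ 𝟙 :* (𝟙 :* 𝟘 :+ α :* 𝟙)) refl α
    weight-view {d₁} {d₂} {x₂ = x₂} {y₂ = y₂} (other d₁≢1 d₁≢-1) _ = trans
      (weight-zero {d₁ , d₂} (λ d≡ → d₁≢1 (≡.cong proj₁ d≡)) (λ d≡ → d₁≢-1 (≡.cong proj₁ d≡))
                   (λ d≡ → d₁≢-1 (≡.cong proj₁ d≡)) (λ d≡ → d₁≢1 (≡.cong proj₁ d≡)))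
      (solve 3 (λ α x₂ y₂ → 𝟘 := y₂ :* (α :* 𝟘 :+ 𝟙 :* 𝟘) :+ x₂ :* (𝟙 :* 𝟘 :+ α :* 𝟘)) refl α x₂ y₂)
    weight-view {d₁} {d₂} {x₁ = x₁} {y₁ = y₁} _ (other d₂≢1 d₂≢-1) = trans
      (weight-zero {d₁ , d₂} (λ d≡ → d₂≢1 (≡.cong proj₂ d≡)) (λ d≡ → d₂≢-1 (≡.cong proj₂ d≡))
                   (λ d≡ → d₂≢1 (≡.cong proj₂ d≡)) (λ d≡ → d₂≢-1 (≡.cong proj₂ d≡)))
      (solve 3 (λ α x₁ y₁ → 𝟘 := 𝟘 :* (α :* x₁ :+ 𝟙 :* y₁) :+ 𝟘 :* (𝟙 :* x₁ :+ α :* y₁)) refl α x₁ y₁)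

    weight-lin : ∀ i j i′ j′ →
      weight (displacement (2 ℕ.* i , 2 ℕ.* j ℕ.+ 1) (2 ℕ.* i′ ℕ.+ 1 , 2 ℕ.* j′)) ≈
        mono (suc j) j′ * lin α 1# (mono i′) i + mono j j′ * lin 1# α (mono i′) i
    weight-lin i j i′ j′ = weight-view (odd-even i i′) (even-odd j j′)

-- Ring structure and reciprocals of the complex numbers

module ComplexField {c ℓ₁ ℓ₂ ℓ₃} (ℝ : RealNumbers c ℓ₁ ℓ₂ ℓ₃) where

  open ComplexNumbers ℝ
  open RealProperties ℝ using (inv; pos⇒#0; sum-squares#0; *-inverseʳ)

  private
    module ℝ = CommutativeRing (RealNumbers.commutativeRing ℝ)
    open IntegerCoefficients (RealNumbers.commutativeRing ℝ)

  ℂ-commutativeRing : CommutativeRing c ℓ₁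
  ℂ-commutativeRing = record
    { Carrier = ℂ ; _≈_ = _≈_ ; _+_ = _+_ ; _*_ = _*_ ; -_ = -_ ; 0# = 0# ; 1# = 1#
    ; isCommutativeRing = record
      { isRing = record
        { +-isAbelianGroup = record
          { isGroup = record
            { isMonoid = record
              { isSemigroup = record
                { isMagma = record
                  { isEquivalence = record
                    { refl  = mk≈ ℝ.refl ℝ.refl
                    ; sym   = λ (mk≈ p q) → mk≈ (ℝ.sym p) (ℝ.sym q)
                    ; trans = λ (mk≈ p q) (mk≈ p′ q′) → mk≈ (ℝ.trans p p′) (ℝ.trans q q′)
                    }
                  ; ∙-cong = λ (mk≈ p q) (mk≈ p′ q′) → mk≈ (ℝ.+-cong p p′) (ℝ.+-cong q q′)
                  }
                ; assoc = λ x y z → mk≈ (ℝ.+-assoc _ _ _) (ℝ.+-assoc _ _ _)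
                }
              ; identity = (λ x → mk≈ (ℝ.+-identityˡ _) (ℝ.+-identityˡ _))
                         , (λ x → mk≈ (ℝ.+-identityʳ _) (ℝ.+-identityʳ _))
              }
            ; inverse = (λ x → mk≈ (ℝ.-‿inverseˡ _) (ℝ.-‿inverseˡ _))
                      , (λ x → mk≈ (ℝ.-‿inverseʳ _) (ℝ.-‿inverseʳ _))
            ; ⁻¹-cong = λ (mk≈ p q) → mk≈ (ℝ.-‿cong p) (ℝ.-‿cong q)
            }
          ; comm = λ x y → mk≈ (ℝ.+-comm _ _) (ℝ.+-comm _ _)
          }
        ; *-cong = λ (mk≈ p q) (mk≈ p′ q′) → mk≈
            (ℝ.+-cong (ℝ.*-cong p p′) (ℝ.-‿cong (ℝ.*-cong q q′)))
            (ℝ.+-cong (ℝ.*-cong p q′) (ℝ.*-cong q p′))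
        ; *-assoc = λ x y z → mk≈
            (solve 6 (λ a b c d e f →
               (a :* c :- b :* d) :* e :- (a :* d :+ b :* c) :* f :=
               a :* (c :* e :- d :* f) :- b :* (c :* f :+ d :* e))
               ℝ.refl (re x) (im x) (re y) (im y) (re z) (im z))
            (solve 6 (λ a b c d e f →
               (a :* c :- b :* d) :* f :+ (a :* d :+ b :* c) :* e :=
               a :* (c :* f :+ d :* e) :+ b :* (c :* e :- d :* f))
               ℝ.refl (re x) (im x) (re y) (im y) (re z) (im z))
        ; *-identity =
            (λ x → mk≈ (solve 2 (λ a b → 𝟙 :* a :- 𝟘 :* b := a) ℝ.refl (re x) (im x))
                       (solve 2 (λ a b → 𝟙 :* b :+ 𝟘 :* a := b) ℝ.refl (re x) (im x)))
          , (λ x → mk≈ (solve 2 (λ a b → a :* 𝟙 :- b :* 𝟘 := a) ℝ.refl (re x) (im x))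
                       (solve 2 (λ a b → a :* 𝟘 :+ b :* 𝟙 := b) ℝ.refl (re x) (im x)))
        ; distrib =
            (λ x y z → mk≈
              (solve 6 (λ a b c d e f →
                 a :* (c :+ e) :- b :* (d :+ f) := a :* c :- b :* d :+ (a :* e :- b :* f))
                 ℝ.refl (re x) (im x) (re y) (im y) (re z) (im z))
              (solve 6 (λ a b c d e f →
                 a :* (d :+ f) :+ b :* (c :+ e) := a :* d :+ b :* c :+ (a :* f :+ b :* e))
                 ℝ.refl (re x) (im x) (re y) (im y) (re z) (im z)))
          , (λ x y z → mk≈
              (solve 6 (λ a b c d e f →
                 (c :+ e) :* a :- (d :+ f) :* b := c :* a :- d :* b :+ (e :* a :- f :* b))
                 ℝ.refl (re x) (im x) (re y) (im y) (re z) (im z))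
              (solve 6 (λ a b c d e f →
                 (c :+ e) :* b :+ (d :+ f) :* a := c :* b :+ d :* a :+ (e :* b :+ f :* a))
                 ℝ.refl (re x) (im x) (re y) (im y) (re z) (im z)))
        }
      ; *-comm = λ x y → mk≈
          (solve 4 (λ a b c d → a :* c :- b :* d := c :* a :- d :* b)
             ℝ.refl (re x) (im x) (re y) (im y))
          (solve 4 (λ a b c d → a :* d :+ b :* c := c :* b :+ d :* a)
             ℝ.refl (re x) (im x) (re y) (im y))
      }
    }

  recip-inverseʳ : ∀ z z≠0 → z * recip z z≠0 ≈ 1#
  recip-inverseʳ z (nonZero z≠0) = mk≈
    (ℝ.trans
      (solve 3 (λ a b y → a :* (a :* y) :- b :* (:- b :* y) := (a :* a :+ b :* b) :* y)
        ℝ.refl (re z) (im z) (inv ∣ z ∣² (sum-squares#0 (re z) (im z) z≠0)))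
      (*-inverseʳ ∣ z ∣² (sum-squares#0 (re z) (im z) z≠0)))
    (solve 3 (λ a b y → a :* (:- b :* y) :+ b :* (a :* y) := 𝟘)
      ℝ.refl (re z) (im z) (inv ∣ z ∣² (sum-squares#0 (re z) (im z) z≠0)))

  𝕚²≈-1 : 𝕚 * 𝕚 ≈ - 1#
  𝕚²≈-1 = mk≈
    (solve 0 (𝟘 :* 𝟘 :- 𝟙 :* 𝟙 := :- 𝟙) ℝ.refl)
    (solve 0 (𝟘 :* 𝟙 :+ 𝟙 :* 𝟘 := :- 𝟘) ℝ.refl)

  ⟦⟧-inverseʳ : ∀ a → ⟦ a ⟧ * ⟦ a ⁻¹ ⟧ ≈ 1#
  ⟦⟧-inverseʳ (x , 0<x) = mk≈
    (ℝ.trans (solve 2 (λ x y → x :* y :- 𝟘 :* 𝟘 := x :* y) ℝ.refl x y) (*-inverseʳ x (pos⇒#0 0<x)))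
    (solve 2 (λ x y → x :* 𝟘 :+ 𝟘 :* y := 𝟘) ℝ.refl x y)
    where y = inv x (pos⇒#0 0<x)

-- The complex Kasteleyn matrix and its generating function

module Solution {c ℓ₁ ℓ₂ ℓ₃}
  (ℝ : RealNumbers c ℓ₁ ℓ₂ ℓ₃) (m : ℕ) (a : ComplexNumbers.ℝ⁺ ℝ) where

  open AztecDiamond ℝ
  open ComplexField ℝ
  open CommutativeRing ℂ-commutativeRing using (refl; sym; trans; *-comm; *-congˡ; *-congʳ)
  open DoubleSums ℂ-commutativeRing using (∑∑-sum; ∑∑-cong; indicator)
  open KasteleynEntries ℂ-commutativeRing using (weight; weight-lin)

  weighting : Weighting ℂ-commutativeRing
  weighting = record
    { 𝕚           = 𝕚
    ; a           = ⟦ a ⟧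
    ; a⁻¹         = ⟦ a ⁻¹ ⟧
    ; δ           = recip _ (1+a²-nonZero a)
    ; δ′          = recip _ (1+a²-nonZero (a ⁻¹))
    ; 𝕚²≈-1       = 𝕚²≈-1
    ; aa⁻¹≈1      = ⟦⟧-inverseʳ a
    ; [1+a²]δ≈1   = recip-inverseʳ _ (1+a²-nonZero a)
    ; [1+a⁻²]δ′≈1 = recip-inverseʳ _ (1+a²-nonZero (a ⁻¹))
    }

  open WeightedKasteleyn ℂ-commutativeRing weighting m
    using (n; kernel; inverse; kernel-inverse; inverse-kernel; sum-generating; generating-formula)

  K⁻¹ : White n → Black n → ℂ
  K⁻¹ = inverse

  weight-cong : ∀ {x y} → x ≈ y → ∀ d → weight x d ≈ weight y d
  weight-cong x≈y d with does (d ≟ᶻ e₁) ∨ does (d ≟ᶻ neg e₁) | does (d ≟ᶻ e₂) ∨ does (d ≟ᶻ neg e₂)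
  ... | true  | _     = refl
  ... | false | true  = x≈y
  ... | false | false = refl

  K-kernel : ∀ x y → K a x y ≈ kernel x y
  K-kernel x@(i , j) y@(i′ , j′) = trans
    -- The matrix has the weight `⟦ a ⟧ * 𝕚`, whereas the kernel is built from α = `𝕚 * ⟦ a ⟧`.
    (weight-cong (*-comm ⟦ a ⟧ 𝕚) (displacement (black x) (white y)))
    (weight-lin (𝕚 * ⟦ a ⟧) (toℕ i) (toℕ j) (toℕ i′) (toℕ j′))

  K-inverse : ∀ x x′ → ∑ᵂ (λ y → K a x y * inverse y x′) ≈ indicator (does (x ≟ᴮ x′))
  K-inverse x x′ = trans (sym (∑∑-sum _))
    (trans (∑∑-cong λ y → *-congʳ (K-kernel x y)) (kernel-inverse x x′))

  inverse-K : ∀ y y′ → ∑ᴮ (λ x → inverse y x * K a x y′) ≈ indicator (does (y ≟ᵂ y′))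
  inverse-K y y′ = trans (sym (∑∑-sum _))
    (trans (∑∑-cong λ x → *-congˡ (K-kernel x y′)) (inverse-kernel y y′))

  module _ (w b : ℂ × ℂ) (noPole : NoPole a w b) where

    open NoPole noPole
    private
      ia = 𝕚 * ⟦ a ⟧

    formula :
      G K⁻¹ w b ≈
        w₁ * w₂ ^ 2 * b₂ * f (n ℕ.+ 1) (w₁ ^ 2 * b₁ ^ 2) w₁²b₁²≠1 * f n (w₂ ^ 2 * b₂ ^ 2) w₂²b₂²≠1
          / C a w₁ w₂ [ Cʷ≠0 ]
        + (1# + ia * w₁ ^ 2)
            * ((1# + ia * b₂ ^ 2) * F⁰⁰ n
               + b₁ ^ 2 * (b₂ * w₁ * f n (w₁ ^ 2 * b₁ ^ 2) w₁²b₁²≠1 + (ia + b₂ ^ 2) * F⁰¹ n))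
            / (C a w₁ w₂ * C a b₁ b₂) [ CʷCᵇ≠0 ]
        + (ia + w₁ ^ 2) * w₂ ^ 2
            * (b₁ ^ 2 * b₂ ^ (2 ℕ.* n ℕ.+ 1) * w₁ * w₂ ^ (2 ℕ.* n) * f n (w₁ ^ 2 * b₁ ^ 2) w₁²b₁²≠1
               + (1# + ia * b₂ ^ 2) * F¹⁰ n
               + b₁ ^ 2 * (ia + b₂ ^ 2) * F¹¹ n)
            / (C a w₁ w₂ * C a b₁ b₂) [ CʷCᵇ≠0 ]
    formula = trans (sum-generating w₁ w₂ b₁ b₂) (generating-formula w₁ w₂ b₁ b₂
      (recip-inverseʳ _ (⟦⟧-nonZero a)) (recip-inverseʳ _ w₁²≠0) (recip-inverseʳ _ b₂²≠0)
      (recip-inverseʳ _ w₁²b₁²≠1) (recip-inverseʳ _ w₂²b₂²≠1)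
      (recip-inverseʳ _ T⁰⁰≠1) (recip-inverseʳ _ T⁰¹≠1) (recip-inverseʳ _ T¹⁰≠1) (recip-inverseʳ _ T¹¹≠1)
      (recip-inverseʳ _ Cʷ≠0) (recip-inverseʳ _ CʷCᵇ≠0))

theorem2 : ∀ {c ℓ₁ ℓ₂ ℓ₃} (ℝ : RealNumbers c ℓ₁ ℓ₂ ℓ₃) → let open AztecDiamond ℝ in
  (n : ℕ) → 1 ≤ n → (a : ℝ⁺) →
  ∃[ K⁻¹ ] IsInverse {n} (K a) K⁻¹ ×
  (∀ w b (noPole : NoPole a w b) →
    let open NoPole noPole
        ia = 𝕚 * ⟦ a ⟧
    in
    G K⁻¹ w b ≈
      w₁ * w₂ ^ 2 * b₂ * f (n +ℕ 1) (w₁ ^ 2 * b₁ ^ 2) w₁²b₁²≠1 * f n (w₂ ^ 2 * b₂ ^ 2) w₂²b₂²≠1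
        / C a w₁ w₂ [ Cʷ≠0 ]
      + (1# + ia * w₁ ^ 2)
          * ((1# + ia * b₂ ^ 2) * F⁰⁰ n
             + b₁ ^ 2 * (b₂ * w₁ * f n (w₁ ^ 2 * b₁ ^ 2) w₁²b₁²≠1 + (ia + b₂ ^ 2) * F⁰¹ n))
          / (C a w₁ w₂ * C a b₁ b₂) [ CʷCᵇ≠0 ]
      + (ia + w₁ ^ 2) * w₂ ^ 2
          * (b₁ ^ 2 * b₂ ^ (2 *ℕ n +ℕ 1) * w₁ * w₂ ^ (2 *ℕ n) * f n (w₁ ^ 2 * b₁ ^ 2) w₁²b₁²≠1
             + (1# + ia * b₂ ^ 2) * F¹⁰ n
             + b₁ ^ 2 * (ia + b₂ ^ 2) * F¹¹ n)
          / (C a w₁ w₂ * C a b₁ b₂) [ CʷCᵇ≠0 ])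
-- `1 ≤ n` supplies the degree bound `m` = n - 1 of the row polynomials.
theorem2 ℝ (suc m) (s≤s z≤n) a = K⁻¹ , (K-inverse , inverse-K) , formula
  where
  open Solution ℝ m a
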